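{- For indeterminates $t,u,x_1,\dots,x_{2n}$, $$\sum_{\lambda}\ \prod_{\substack{j\in\{2,4,6,\dots\}\\ j\le m_0(\lambda)}}(1-ut^{j-2})\ b^{\rm el}_\lambda(t)\,P_\lambda(x_1,\dots,x_{2n};t)=\prod_{1\le i<j\le 2n}\frac{1-tx_ix_j}{x_i-x_j}\ \mathop{\rm Pf}_{1\le i<j\le 2n}\left[\frac{(x_i-x_j)(1-u+(u-t)x_ix_j)}{(1-x_ix_j)(1-tx_ix_j)}\right],$$ where the sum runs over all partitions $\lambda$ of length at most $2n$ whose conjugate $\lambda'$ has only even parts.
   Context: $P_\lambda(\cdot;t)$ denotes the Hall–Littlewood polynomial (Macdonald's normalization). $m_0(\lambda)=2n-\ell(\lambda)$, and for $i\ge1$, $m_i(\lambda)$ is the number of parts equal to $i$. $b^{\rm el}_\lambda(t)=\prod_{i\ge1}\prod_{j\in\{2,4,\dots\},\,j\le m_i(\lambda)}(1-t^{j-1})$. Empty products are $1$. $\mathop{\rm Pf}$ denotes the Pfaffian of the antisymmetric matrix with the given upper-triangular entries. Identity of formal power series. -}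

module Defs where

-- Formal power series with integer coefficients in the variables
-- t, u, x_1, ..., x_N  (N = 2n), encoded as coefficient functions on
-- exponent vectors  (e_t ∷ e_u ∷ e_x1 ∷ ... ∷ e_xN).

open import Data.Nat as ℕ using (ℕ; zero; suc)
open import Data.Integer as ℤ using (ℤ; +_)
open import Data.Fin as Fin using (Fin; punchIn; toℕ)
open import Data.Vec as Vec using (Vec; []; _∷_; lookup; tabulate; removeAt)
open import Data.List as List using (List; []; _∷_; concatMap; map; allFin; filterᵇ; upTo; length)
open import Data.Product using (_×_; _,_)
open import Data.Bool using (Bool; true; false; _∧_; if_then_else_)
open import Relation.Binary.PropositionalEquality using (_≡_)

FPS : ℕ → Set
FPS m = Vec ℕ m → ℤ

_≈_ : ∀ {m} → FPS m → FPS m → Set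
f ≈ g = ∀ α → f α ≡ g α

infix 4 _≈_

sumℤ : List ℤ → ℤ
sumℤ = List.foldr ℤ._+_ (+ 0)

eqVec : ∀ {m} → Vec ℕ m → Vec ℕ m → Bool
eqVec [] [] = true
eqVec (a ∷ as) (b ∷ bs) = (a ℕ.≡ᵇ b) ∧ eqVec as bs

zeroV : ∀ {m} → Vec ℕ m
zeroV = Vec.replicate _ 0

unitV : ∀ {m} → Fin m → Vec ℕ m
unitV k = tabulate (λ i → if toℕ i ℕ.≡ᵇ toℕ k then 1 else 0)

const : ∀ {m} → ℤ → FPS m
const c α = if eqVec α zeroV then c else + 0

𝟘 𝟙 : ∀ {m} → FPS m
𝟘 = const (+ 0)
𝟙 = const (+ 1)

var : ∀ {m} → Fin m → FPS m
var k α = if eqVec α (unitV k) then + 1 else + 0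

_⊕_ : ∀ {m} → FPS m → FPS m → FPS m
(f ⊕ g) α = f α ℤ.+ g α

⊝_ : ∀ {m} → FPS m → FPS m
(⊝ f) α = ℤ.- f α

_⊖_ : ∀ {m} → FPS m → FPS m → FPS m
f ⊖ g = f ⊕ (⊝ g)

splits : ∀ {m} → Vec ℕ m → List (Vec ℕ m × Vec ℕ m)
splits [] = ([] , []) ∷ []
splits (a ∷ α) =
  concatMap (λ k → map (λ { (β , γ) → (k ∷ β , (a ℕ.∸ k) ∷ γ) }) (splits α))
            (upTo (suc a))

_⊗_ : ∀ {m} → FPS m → FPS m → FPS m
(f ⊗ g) α = sumℤ (map (λ { (β , γ) → f β ℤ.* g γ }) (splits α))

infixl 7 _⊗_
infixl 6 _⊕_ _⊖_

scale : ∀ {m} → ℤ → FPS m → FPS m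
scale c f α = c ℤ.* f α

pow : ∀ {m} → FPS m → ℕ → FPS m
pow f zero = 𝟙
pow f (suc k) = f ⊗ pow f k

sumF : ∀ {m} → List (FPS m) → FPS m
sumF = List.foldr _⊕_ 𝟘

prodF : ∀ {m} → List (FPS m) → FPS m
prodF = List.foldr _⊗_ 𝟙

-- 1/(1 - f) = Σ_k f^k, for f with zero constant term; the coefficient
-- at α only receives contributions from k ≤ total degree of α.
inv1m : ∀ {m} → FPS m → FPS m
inv1m f α = sumℤ (map (λ k → pow f k α) (upTo (suc (Vec.sum α))))

evenᵇ : ℕ → Bool
evenᵇ zero = true
evenᵇ (suc zero) = false
evenᵇ (suc (suc k)) = evenᵇ k

pairs : (N : ℕ) → List (Fin N × Fin N)
pairs N = concatMap (λ i → map (λ j → (i , j))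
                       (filterᵇ (λ j → toℕ i ℕ.<ᵇ toℕ j) (allFin N)))
                    (allFin N)

extPerm : ∀ {N} → Fin (suc N) → (Fin N → Fin N) → Fin (suc N) → Fin (suc N)
extPerm p σ Fin.zero = p
extPerm p σ (Fin.suc i) = punchIn p (σ i)

perms : (N : ℕ) → List (Fin N → Fin N)
perms zero = (λ ()) ∷ []
perms (suc N) = concatMap (λ p → map (extPerm p) (perms N)) (allFin (suc N))

inversions : ∀ {N} → (Fin N → Fin N) → ℕ
inversions {N} w =
  length (filterᵇ (λ { (i , j) → toℕ (w j) ℕ.<ᵇ toℕ (w i) }) (pairs N))

sign : ∀ {N} → (Fin N → Fin N) → ℤ
sign w = if evenᵇ (inversions w) then + 1 else ℤ.- (+ 1)

-- Partitions with at most N parts, written as weakly decreasing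
-- vectors of length N (padded by zeros).

decreasingᵇ : List ℕ → Bool
decreasingᵇ [] = true
decreasingᵇ (a ∷ []) = true
decreasingᵇ (a ∷ b ∷ l) = (b ℕ.≤ᵇ a) ∧ decreasingᵇ (b ∷ l)

IsPartition : ∀ {N} → Vec ℕ N → Set
IsPartition μ = decreasingᵇ (Vec.toList μ) ≡ true

size : ∀ {N} → Vec ℕ N → ℕ
size = Vec.sum

countᵇ : ∀ {N} → (ℕ → Bool) → Vec ℕ N → ℕ
countᵇ p μ = length (filterᵇ p (Vec.toList μ))

-- m_i(μ): number of entries equal to i (for i = 0 this is N - ℓ(μ))
mult : ∀ {N} → ℕ → Vec ℕ N → ℕ
mult i μ = countᵇ (λ a → a ℕ.≡ᵇ i) μ

maxPart : ∀ {N} → Vec ℕ N → ℕ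
maxPart μ = Vec.foldr _ ℕ._⊔_ 0 μ

conjPart : ∀ {N} → ℕ → Vec ℕ N → ℕ
conjPart j μ = countᵇ (λ a → j ℕ.≤ᵇ a) μ

conjEvenᵇ : ∀ {N} → Vec ℕ N → Bool
conjEvenᵇ μ = List.foldr (λ j b → evenᵇ (conjPart j μ) ∧ b) true (map suc (upTo (maxPart μ)))

allVecs : (N d : ℕ) → List (Vec ℕ N)
allVecs zero d = [] ∷ []
allVecs (suc N) d = concatMap (λ a → map (a ∷_) (allVecs N d)) (upTo (suc d))

evenConjPartitions : (N d : ℕ) → List (Vec ℕ N)
evenConjPartitions N d =
  filterᵇ (λ μ → decreasingᵇ (Vec.toList μ) ∧ (size μ ℕ.≤ᵇ d) ∧ conjEvenᵇ μ)
          (allVecs N d)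

evensUpTo : ℕ → List ℕ
evensUpTo m = filterᵇ evenᵇ (map suc (upTo m))

Ser : ℕ → Set
Ser N = FPS (suc (suc N))

tV : ∀ {N} → Ser N
tV = var Fin.zero

uV : ∀ {N} → Ser N
uV = var (Fin.suc Fin.zero)

xV : ∀ {N} → Fin N → Ser N
xV i = var (Fin.suc (Fin.suc i))

-- the action of a permutation w on the x-variables: x_i ↦ x_{w(i)}
act : ∀ {N} → (Fin N → Fin N) → Ser N → Ser N
act w f (a ∷ b ∷ xs) = f (a ∷ b ∷ tabulate (λ i → lookup xs (w i)))

xdeg : ∀ {N} → Vec ℕ (suc (suc N)) → ℕ
xdeg (a ∷ b ∷ xs) = Vec.sum xs

xmono : ∀ {N} → Vec ℕ N → Ser N
xmono {N} μ = prodF (map (λ i → pow (xV i) (lookup μ i)) (allFin N))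

vandermonde : (N : ℕ) → Ser N
vandermonde N = prodF (map (λ { (i , j) → xV i ⊖ xV j }) (pairs N))

-- v_m(t) = ∏_{k=1}^m (1 - t^k)/(1 - t) = ∏_{k=1}^m (1 + t + ... + t^{k-1})
vm : ∀ {N} → ℕ → Ser N
vm m = prodF (map (λ k → sumF (map (pow tV) (upTo k))) (map suc (upTo m)))

vPart : ∀ {N} → Vec ℕ N → Ser N
vPart μ = prodF (map (λ i → vm (mult i μ)) (upTo (suc (maxPart μ))))

hlNumerator : (N : ℕ) → Vec ℕ N → Ser N
hlNumerator N μ =
  sumF (map (λ w → scale (sign w)
                     (act w (xmono μ ⊗ prodF (map (λ { (i , j) → xV i ⊖ tV ⊗ xV j })
                                                  (pairs N)))))
            (perms N))

-- P is the family of Hall–Littlewood polynomials P_μ(x_1..x_N; t):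
-- Macdonald's definition  P_μ = v_μ(t)^{-1} Σ_w w( x^μ ∏_{i<j} (x_i - t x_j)/(x_i - x_j) ),
-- with the Vandermonde denominator cleared (this determines P_μ uniquely,
-- since ℤ[[t,u,x]] is an integral domain).
IsHallLittlewood : (N : ℕ) → (Vec ℕ N → Ser N) → Set
IsHallLittlewood N P =
  ∀ μ → IsPartition μ → vPart μ ⊗ vandermonde N ⊗ P μ ≈ hlNumerator N μ

bel : ∀ {N} → Vec ℕ N → Ser N
bel μ = prodF (map (λ i → prodF (map (λ j → 𝟙 ⊖ pow tV (j ℕ.∸ 1)) (evensUpTo (mult i μ))))
                   (map suc (upTo (maxPart μ))))

uFactor : ∀ {N} → Vec ℕ N → Ser N
uFactor μ = prodF (map (λ j → 𝟙 ⊖ uV ⊗ pow tV (j ℕ.∸ 2)) (evensUpTo (mult 0 μ)))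

-- LHS: Σ_μ uFactor_μ b^el_μ P_μ over partitions μ, ℓ(μ) ≤ N, μ' even.
-- The coefficient at α only involves μ with |μ| = x-degree of α
-- (P_μ is homogeneous of degree |μ| in x), so summing over |μ| ≤ xdeg α
-- computes the formal infinite sum exactly.
lhs : (N : ℕ) → (Vec ℕ N → Ser N) → Ser N
lhs N P α =
  sumℤ (map (λ μ → (uFactor μ ⊗ bel μ ⊗ P μ) α) (evenConjPartitions N (xdeg α)))

pfEntry : ∀ {N} → Fin N → Fin N → Ser N
pfEntry i j =
  (xV i ⊖ xV j) ⊗ (𝟙 ⊖ uV ⊕ (uV ⊖ tV) ⊗ xV i ⊗ xV j)
    ⊗ inv1m (xV i ⊗ xV j) ⊗ inv1m (tV ⊗ xV i ⊗ xV j)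

-- Pfaffian of the antisymmetric matrix with upper-triangular entries a i j,
-- restricted to the index list (expansion along the first row).
pfaffian : ∀ {N k} → (Fin N → Fin N → Ser N) → Vec (Fin N) k → Ser N
pfaffian {k = zero} a [] = 𝟙
pfaffian {k = suc zero} a _ = 𝟘
pfaffian {k = suc (suc k)} a (i ∷ rest) =
  sumF (map (λ p → scale (if evenᵇ (toℕ p) then + 1 else ℤ.- (+ 1))
                     (a i (lookup rest p) ⊗ pfaffian a (removeAt rest p)))
            (allFin (suc k)))

rhsTimesVandermonde : (N : ℕ) → Ser N
rhsTimesVandermonde N =
  prodF (map (λ { (i , j) → 𝟙 ⊖ tV ⊗ xV i ⊗ xV j }) (pairs N))
    ⊗ pfaffian pfEntry (tabulate {n = N} (λ i → i))

{-# OPTIONS --safe #-}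

-- Write alt φ for the signed sum over the ways of picking one entry of a list, and clear denominators: with
-- e_w(x,y) = (x − y)(1 − w + (w − t) x y) and k(x,y) = (1 − x y)(1 − t x y), let G_w(x₁..xₙ) be Pf[e_w / k] times the product
-- of k over all pairs, with an extra index (paired with every x by 1) if n is odd.  The key identity is
--   G_w = Σ_r g_r(w) D^(r) W,   D f (X) = alt_y ∏_z (t y − z)(1 − y z) f(X ∖ y),   W = G_1 for n even, 0 for n odd,
-- where g_r(w) = ∏ (1 − w t^j) over 0 ≤ j < r with n − j even and D^(r) = D^r / [r]_t!.  Both sides are polynomials of degree
-- 2n − 2 in x₁ and agree at 2n − 1 points: at x_k both vanish by antisymmetry; at 1 / x_k both are the same multiple of the
-- identity with two variables fewer; at 0 both reduce to the identity for t w with one variable fewer, because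
-- e_w = x y e_{tw} + (1 − w)(x − y) k makes one Pfaffian a Schur complement of the other.
--
-- Removing ∏ (1 − x_i x_j) turns D into the operator that appends a zero part to a Hall–Littlewood numerator, and
-- G_1 = (∏ x_i) G_t says that W is the same sum at w = t with all parts increased by 1.  Iterating d times produces the
-- terms of the left-hand side with parts ≤ d, up to an error of x-order > d.
module Submission where

open import Algebra.Bundles using (CommutativeRing; RawRing; CommutativeMonoid)
open import Algebra.Solver.Ring.AlmostCommutativeRing using (AlmostCommutativeRing; fromCommutativeRing; _-Raw-AlmostCommutative⟶_)
open import Data.Bool using (Bool; true; false; not; if_then_else_; _∧_; T; T?)
open import Data.Bool.Properties using (not-involutive)
open import Data.Empty using (⊥-elim)
open import Data.Fin as Fin using (Fin; toℕ; punchIn; punchOut)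
open import Data.Fin.Properties as FinP using (punchIn-punchOut; punchIn-injective)
open import Data.Integer as ℤ using (ℤ; +_)
import Data.Integer.Properties as ℤP
open import Data.List as List using (List; []; _∷_; map; length)
open import Data.List.Properties using (length-map; length-replicate; length-++; map-∘; ++-identityʳ; ++-assoc; map-++; map-cong; map-upTo; map-tabulate; concatMap-cong; concatMap-map; map-concatMap; length-tabulate)
open import Data.List.Relation.Unary.All as All using (All; []; _∷_)
import Data.List.Relation.Unary.All.Properties as AllP
open import Data.List.Relation.Unary.AllPairs using (AllPairs; []; _∷_)
open import Data.Maybe as Maybe using (Maybe; just; nothing)
open import Data.Nat as ℕ using (ℕ; zero; suc)
import Data.Nat.ListAction as ListAction
import Data.Nat.Properties as ℕP
open import Data.Product as Prod using (_×_; _,_; proj₁; proj₂; ∃)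
open import Data.Sum using (_⊎_; inj₁; inj₂)
open import Data.Vec as Vec using (Vec; []; _∷_; lookup; tabulate; updateAt)
import Data.Vec.Properties as VecP
open import Function using (_∘_)
import Level
open import Relation.Binary.PropositionalEquality as ≡ using (_≡_; _≢_)
open import Relation.Nullary using (yes; no)

-- The case of even length at w = u cannot be proved alone: the node 0 removes one variable and
-- turns w into t w, so the key identity needs all lengths and all w, and odd lengths need the
-- padding index. The choice W = G_1 is forced by this node. At 0, G_w with n even acquires the
-- factor 1 - w, so W vanishes there; then D applied to D^(r) W becomes [r+1]_t times D^(r) W in the
-- remaining variables, and the divided power cancels the q-integer. At the node 1 / x_k all G_w
-- have the same factor because e_w(1/x, x) is independent of w. No field is at hand, so
-- interpolation is a factor theorem for binary forms in which non-zero-divisors are cancelled. Only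
-- q-integers must be inverted, and they are units among the power series in t. The weights come out
-- level by level: r zero parts contribute g_r(w) / [r]_t!. The outermost level has w = u and gives
-- the product for m_0; every deeper level has w = t and gives a factor of b^el, while 1 / [r]_t! is
-- the inverse of v_r(t).

-- Integers as formal differences of naturals, kept in the normal form (a , 0) or (0 , b).
Diff : Set
Diff = ℕ × ℕ

-- Ring solver with integer coefficients, q-integers and finite sums.

module RingKit {c ℓ} (R : CommutativeRing c ℓ) where

  open CommutativeRing R public hiding (zero)
  open import Algebra.Properties.Ring ring public using (-0#≈0#; -‿involutive; -‿distribˡ-*; -‿distribʳ-*; -‿+-comm)
  open import Relation.Binary.Reasoning.Setoid setoid public

  private
    norm : ℕ → ℕ → Diff
    norm a b = a ℕ.∸ b , b ℕ.∸ a

    norm-balance : ∀ a b → (a ℕ.∸ b) ℕ.+ b ≡ a ℕ.+ (b ℕ.∸ a)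
    norm-balance zero b = ≡.cong (ℕ._+ b) (ℕP.0∸n≡0 b)
    norm-balance (suc a) zero = ≡.refl
    norm-balance (suc a) (suc b) = ≡.trans (ℕP.+-suc _ b) (≡.cong suc (norm-balance a b))

    diffs : RawRing _ _
    diffs = record
      { Carrier = Diff ; _≈_ = _≡_
      ; _+_ = λ (a , b) (c , d) → norm (a ℕ.+ c) (b ℕ.+ d)
      ; _*_ = λ (a , b) (c , d) → norm (a ℕ.* c ℕ.+ b ℕ.* d) (a ℕ.* d ℕ.+ b ℕ.* c)
      ; -_ = λ (a , b) → b , a
      ; 0# = 0 , 0 ; 1# = 1 , 0 }

    -- The clause for 1 is separate so that the solver constants 0 and 1 evaluate to `0#` and `1#`
    -- on the nose.
    nat : ℕ → Carrier
    nat 0 = 0#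
    nat 1 = 1#
    nat (suc (suc n)) = 1# + nat (suc n)

    val : Diff → Carrier
    val (a , 0) = nat a
    val (a , suc b) = nat a - nat (suc b)

    nat-suc : ∀ n → nat (suc n) ≈ 1# + nat n
    nat-suc zero = sym (+-identityʳ 1#)
    nat-suc (suc n) = refl

    val-def : ∀ a b → val (a , b) ≈ nat a - nat b
    val-def a zero = sym (trans (+-congˡ -0#≈0#) (+-identityʳ _))
    val-def a (suc b) = refl

    nat-+ : ∀ m n → nat (m ℕ.+ n) ≈ nat m + nat n
    nat-+ zero n = sym (+-identityˡ _)
    nat-+ (suc m) n = begin
      nat (suc (m ℕ.+ n)) ≈⟨ nat-suc (m ℕ.+ n) ⟩
      1# + nat (m ℕ.+ n)  ≈⟨ +-congˡ (nat-+ m n) ⟩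
      1# + (nat m + nat n) ≈⟨ +-assoc _ _ _ ⟨
      1# + nat m + nat n   ≈⟨ +-congʳ (nat-suc m) ⟨
      nat (suc m) + nat n  ∎

    nat-* : ∀ m n → nat (m ℕ.* n) ≈ nat m * nat n
    nat-* zero n = sym (zeroˡ _)
    nat-* (suc m) n = begin
      nat (n ℕ.+ m ℕ.* n)    ≈⟨ nat-+ n (m ℕ.* n) ⟩
      nat n + nat (m ℕ.* n)  ≈⟨ +-cong (sym (*-identityˡ _)) (nat-* m n) ⟩
      1# * nat n + nat m * nat n ≈⟨ distribʳ _ _ _ ⟨
      (1# + nat m) * nat n   ≈⟨ *-congʳ (nat-suc m) ⟨
      nat (suc m) * nat n    ∎

    interchange : ∀ a b c d → (a + b) + (c + d) ≈ (a + c) + (b + d)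
    interchange a b c d = begin
      (a + b) + (c + d) ≈⟨ +-assoc a b (c + d) ⟩
      a + (b + (c + d)) ≈⟨ +-congˡ (+-assoc b c d) ⟨
      a + ((b + c) + d) ≈⟨ +-congˡ (+-congʳ (+-comm b c)) ⟩
      a + ((c + b) + d) ≈⟨ +-congˡ (+-assoc c b d) ⟩
      a + (c + (b + d)) ≈⟨ +-assoc a c (b + d) ⟨
      (a + c) + (b + d) ∎

    cancel : ∀ {a b c d} → a ℕ.+ d ≡ c ℕ.+ b → val (a , b) ≈ val (c , d)
    cancel {a} {b} {c} {d} eq = begin
      val (a , b) ≈⟨ val-def a b ⟩
      nat a - nat b ≈⟨ +-identityʳ _ ⟨
      (nat a - nat b) + 0# ≈⟨ +-congˡ (-‿inverseʳ (nat d)) ⟨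
      (nat a - nat b) + (nat d - nat d) ≈⟨ interchange _ _ _ _ ⟩
      (nat a + nat d) + (- nat b - nat d) ≈⟨ +-congʳ (trans (sym (nat-+ a d)) (trans (reflexive (≡.cong nat eq)) (nat-+ c b))) ⟩
      (nat c + nat b) + (- nat b - nat d) ≈⟨ +-congˡ (+-comm _ _) ⟩
      (nat c + nat b) + (- nat d - nat b) ≈⟨ interchange _ _ _ _ ⟩
      (nat c - nat d) + (nat b - nat b) ≈⟨ +-congˡ (-‿inverseʳ (nat b)) ⟩
      (nat c - nat d) + 0# ≈⟨ +-identityʳ _ ⟩
      nat c - nat d ≈⟨ val-def c d ⟨
      val (c , d) ∎

    val-norm : ∀ a b → val (norm a b) ≈ nat a - nat b
    val-norm a b = trans (cancel {a ℕ.∸ b} {b ℕ.∸ a} {a} {b} (norm-balance a b)) (val-def a b)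

    val-+ : ∀ x y → val (RawRing._+_ diffs x y) ≈ val x + val y
    val-+ (a , b) (c , d) = begin
      val (norm (a ℕ.+ c) (b ℕ.+ d)) ≈⟨ val-norm (a ℕ.+ c) (b ℕ.+ d) ⟩
      nat (a ℕ.+ c) - nat (b ℕ.+ d) ≈⟨ +-cong (nat-+ a c) (-‿cong (nat-+ b d)) ⟩
      (nat a + nat c) - (nat b + nat d) ≈⟨ +-congˡ (-‿+-comm _ _) ⟨
      (nat a + nat c) + (- nat b - nat d) ≈⟨ interchange _ _ _ _ ⟩
      (nat a - nat b) + (nat c - nat d) ≈⟨ +-cong (val-def a b) (val-def c d) ⟨
      val (a , b) + val (c , d) ∎

    val-* : ∀ x y → val (RawRing._*_ diffs x y) ≈ val x * val y
    val-* (a , b) (c , d) = begin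
      val (norm (a ℕ.* c ℕ.+ b ℕ.* d) (a ℕ.* d ℕ.+ b ℕ.* c)) ≈⟨ val-norm (a ℕ.* c ℕ.+ b ℕ.* d) (a ℕ.* d ℕ.+ b ℕ.* c) ⟩
      nat (a ℕ.* c ℕ.+ b ℕ.* d) - nat (a ℕ.* d ℕ.+ b ℕ.* c)
        ≈⟨ +-cong (trans (nat-+ (a ℕ.* c) _) (+-cong (nat-* a c) (nat-* b d)))
                  (-‿cong (trans (nat-+ (a ℕ.* d) _) (+-cong (nat-* a d) (nat-* b c)))) ⟩
      (nat a * nat c + nat b * nat d) - (nat a * nat d + nat b * nat c) ≈⟨ +-congˡ (-‿+-comm _ _) ⟨
      (nat a * nat c + nat b * nat d) + (- (nat a * nat d) - (nat b * nat c)) ≈⟨ interchange _ _ _ _ ⟩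
      (nat a * nat c - nat a * nat d) + (nat b * nat d - nat b * nat c)
        ≈⟨ +-cong (+-congˡ (-‿distribʳ-* _ _)) (trans (+-congˡ (-‿distribˡ-* _ _)) (+-comm _ _)) ⟩
      (nat a * nat c + nat a * (- nat d)) + ((- nat b) * nat c + nat b * nat d)
        ≈⟨ +-congˡ (+-congˡ (trans (*-congʳ (sym (-‿involutive _))) (trans (sym (-‿distribˡ-* _ _)) (-‿distribʳ-* _ _)))) ⟩
      (nat a * nat c + nat a * (- nat d)) + ((- nat b) * nat c + (- nat b) * (- nat d))
        ≈⟨ +-cong (distribˡ _ _ _) (distribˡ _ _ _) ⟨
      nat a * (nat c - nat d) + (- nat b) * (nat c - nat d) ≈⟨ distribʳ _ _ _ ⟨
      (nat a - nat b) * (nat c - nat d) ≈⟨ *-cong (val-def a b) (val-def c d) ⟨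
      val (a , b) * val (c , d) ∎

    val-- : ∀ x → val (proj₂ x , proj₁ x) ≈ - val x
    val-- (a , b) = begin
      val (b , a) ≈⟨ val-def b a ⟩
      nat b - nat a ≈⟨ +-comm _ _ ⟩
      - nat a + nat b ≈⟨ +-congˡ (-‿involutive _) ⟨
      - nat a - (- nat b) ≈⟨ -‿+-comm _ _ ⟩
      - (nat a - nat b) ≈⟨ -‿cong (val-def a b) ⟨
      - val (a , b) ∎

    almost : AlmostCommutativeRing c ℓ
    almost = fromCommutativeRing R

    morphism : diffs -Raw-AlmostCommutative⟶ almost
    morphism = record
      { ⟦_⟧ = val ; +-homo = val-+ ; *-homo = val-* ; -‿homo = val-- ; 0-homo = refl ; 1-homo = refl }

    _≟D_ : ∀ (x y : Diff) → Maybe (val x ≈ val y)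
    (a , b) ≟D (c , d) with a ℕ.+ d ℕ.≟ c ℕ.+ b
    ... | yes eq = just (cancel {a} {b} {c} {d} eq)
    ... | no _ = nothing

  open import Algebra.Solver.Ring diffs almost morphism _≟D_ public
    using (Polynomial; solve; _:=_; _:+_; _:*_; _:-_; :-_; con)

  :0 :1 : ∀ {n} → Polynomial n
  :0 = con (0 , 0)
  :1 = con (1 , 0)

  -- The q-integer [r]_t in Horner form, the shape in which the factor 1 + t [r]_t arises when a
  -- variable is set to zero.
  qint : Carrier → ℕ → Carrier
  qint t zero = 0#
  qint t (suc r) = 1# + t * qint t r

  Σ≤ : ℕ → (ℕ → Carrier) → Carrier
  Σ≤ zero f = f 0
  Σ≤ (suc n) f = f 0 + Σ≤ n (λ r → f (suc r))

  Σ≤-cong : ∀ n {f g} → (∀ r → r ℕ.≤ n → f r ≈ g r) → Σ≤ n f ≈ Σ≤ n g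
  Σ≤-cong zero h = h 0 ℕ.z≤n
  Σ≤-cong (suc n) h = +-cong (h 0 ℕ.z≤n) (Σ≤-cong n (λ r p → h (suc r) (ℕ.s≤s p)))

  Σ≤-* : ∀ k n f → Σ≤ n (λ r → k * f r) ≈ k * Σ≤ n f
  Σ≤-* k zero f = refl
  Σ≤-* k (suc n) f = trans (+-congˡ (Σ≤-* k n _)) (sym (distribˡ _ _ _))

  Σ≤-neg : ∀ n f → Σ≤ n (λ r → - f r) ≈ - Σ≤ n f
  Σ≤-neg zero f = refl
  Σ≤-neg (suc n) f = trans (+-congˡ (Σ≤-neg n _)) (-‿+-comm _ _)

  Σ≤-last : ∀ n f → f (suc n) ≈ 0# → Σ≤ (suc n) f ≈ Σ≤ n f
  Σ≤-last zero f z = trans (+-congˡ z) (+-identityʳ _)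
  Σ≤-last (suc n) f z = +-congˡ (Σ≤-last n (λ r → f (suc r)) z)

  Σ≤-+ : ∀ n f g → Σ≤ n (λ r → f r + g r) ≈ Σ≤ n f + Σ≤ n g
  Σ≤-+ zero f g = refl
  Σ≤-+ (suc n) f g = trans (+-congˡ (Σ≤-+ n _ _)) (solve 4 (λ a b c d → (a :+ b) :+ (c :+ d) := (a :+ c) :+ (b :+ d)) refl _ _ _ _)

  Σ≤-top : ∀ n f → (∀ r → r ℕ.< n → f r ≈ 0#) → Σ≤ n f ≈ f n
  Σ≤-top zero f h = refl
  Σ≤-top (suc n) f h = trans (+-cong (h 0 (ℕ.s≤s ℕ.z≤n)) (Σ≤-top n (λ r → f (suc r)) (λ r p → h (suc r) (ℕ.s≤s p)))) (+-identityˡ _)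

-- Signed sums over picked entries, and Pfaffians with cleared denominators.

module Alternants {c ℓ} (R : CommutativeRing c ℓ) where

  open RingKit R

  data Pick {a} {P : Set a} (x : P) : List P → List P → Set a where
    here  : ∀ {l} → Pick x (x ∷ l) l
    there : ∀ {y l l'} → Pick x l l' → Pick x (y ∷ l) (y ∷ l')

  data Swap {a} {P : Set a} : List P → List P → Set a where
    here  : ∀ {x y l} → Swap (x ∷ y ∷ l) (y ∷ x ∷ l)
    there : ∀ {x l l'} → Swap l l' → Swap (x ∷ l) (x ∷ l')

  swap-length : ∀ {a} {P : Set a} {l l' : List P} → Swap l l' → length l ≡ length l'
  swap-length here = ≡.refl
  swap-length (there s) = ≡.cong suc (swap-length s)

  pick-length : ∀ {a} {P : Set a} {x : P} {l l'} → Pick x l l' → length l ≡ suc (length l')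
  pick-length here = ≡.refl
  pick-length (there p) = ≡.cong suc (pick-length p)

  ∏ : ∀ {a} {P : Set a} → (P → Carrier) → List P → Carrier
  ∏ f [] = 1#
  ∏ f (x ∷ l) = f x * ∏ f l

  ∏-cong : ∀ {a} {P : Set a} {f g : P → Carrier} → (∀ x → f x ≈ g x) → ∀ l → ∏ f l ≈ ∏ g l
  ∏-cong h [] = refl
  ∏-cong h (x ∷ l) = *-cong (h x) (∏-cong h l)

  ∏-one : ∀ {a} {P : Set a} {f : P → Carrier} → (∀ x → f x ≈ 1#) → ∀ l → ∏ f l ≈ 1#
  ∏-one h [] = refl
  ∏-one h (x ∷ l) = trans (*-cong (h x) (∏-one h l)) (*-identityˡ 1#)

  ∏-* : ∀ {a} {P : Set a} (f g : P → Carrier) l → ∏ (λ x → f x * g x) l ≈ ∏ f l * ∏ g l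
  ∏-* f g [] = sym (*-identityˡ 1#)
  ∏-* f g (x ∷ l) = trans (*-congˡ (∏-* f g l))
    (solve 4 (λ a b c d → (a :* b) :* (c :* d) := (a :* c) :* (b :* d)) refl _ _ _ _)

  ∏-map : ∀ {a b} {P : Set a} {X : Set b} (f : P → Carrier) (h : X → P) l → ∏ f (map h l) ≡ ∏ (λ x → f (h x)) l
  ∏-map f h [] = ≡.refl
  ∏-map f h (x ∷ l) = ≡.cong (f (h x) *_) (∏-map f h l)

  ∏-pick : ∀ {a} {P : Set a} (f : P → Carrier) {x l l'} → Pick x l l' → ∏ f l ≈ f x * ∏ f l'
  ∏-pick f here = refl
  ∏-pick f (there {y} p) = trans (*-congˡ (∏-pick f p))
    (solve 3 (λ a b c → a :* (b :* c) := b :* (a :* c)) refl _ _ _)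

  ∏-swap : ∀ {a} {P : Set a} (f : P → Carrier) {l l'} → Swap l l' → ∏ f l ≈ ∏ f l'
  ∏-swap f here = solve 3 (λ a b c → a :* (b :* c) := b :* (a :* c)) refl _ _ _
  ∏-swap f (there s) = *-congˡ (∏-swap f s)

  alt : ∀ {a} {P : Set a} → (P → List P → Carrier) → List P → Carrier
  alt φ [] = 0#
  alt φ (x ∷ xs) = φ x xs - alt (λ y ys → φ y (x ∷ ys)) xs

  module _ {a} {P : Set a} where

    Anti : (List P → Carrier) → Set _
    Anti f = ∀ {l l'} → Swap l l' → f l ≈ - f l'

    alt-cong-pick : ∀ {φ ψ : P → List P → Carrier} l → (∀ {y ys} → Pick y l ys → φ y ys ≈ ψ y ys) → alt φ l ≈ alt ψ l
    alt-cong-pick [] h = refl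
    alt-cong-pick (x ∷ xs) h = +-cong (h here) (-‿cong (alt-cong-pick xs (λ p → h (there p))))

    alt-cong : ∀ {φ ψ : P → List P → Carrier} l → (∀ y ys → φ y ys ≈ ψ y ys) → alt φ l ≈ alt ψ l
    alt-cong l h = alt-cong-pick l (λ _ → h _ _)

    alt-+ : ∀ (φ ψ : P → List P → Carrier) l → alt (λ y ys → φ y ys + ψ y ys) l ≈ alt φ l + alt ψ l
    alt-+ φ ψ [] = sym (+-identityˡ 0#)
    alt-+ φ ψ (x ∷ xs) = trans (+-congˡ (-‿cong (alt-+ (λ y ys → φ y (x ∷ ys)) (λ y ys → ψ y (x ∷ ys)) xs)))
      (solve 4 (λ a b c d → (a :+ b) :- (c :+ d) := (a :- c) :+ (b :- d)) refl _ _ _ _)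

    alt-* : ∀ k (φ : P → List P → Carrier) l → alt (λ y ys → k * φ y ys) l ≈ k * alt φ l
    alt-* k φ [] = sym (zeroʳ k)
    alt-* k φ (x ∷ xs) = trans (+-congˡ (-‿cong (alt-* k (λ y ys → φ y (x ∷ ys)) xs)))
      (solve 3 (λ k a b → k :* a :- k :* b := k :* (a :- b)) refl _ _ _)

    alt-0 : ∀ {φ : P → List P → Carrier} l → (∀ {y ys} → Pick y l ys → φ y ys ≈ 0#) → alt φ l ≈ 0#
    alt-0 [] h = refl
    alt-0 (x ∷ xs) h = trans (+-cong (h here) (-‿cong (alt-0 xs (λ p → h (there p)))))
      (solve 0 (:0 :- :0 := :0) refl)

    alt-neg : ∀ (φ : P → List P → Carrier) l → alt (λ y ys → - φ y ys) l ≈ - alt φ l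
    alt-neg φ [] = sym -0#≈0#
    alt-neg φ (x ∷ xs) = trans (+-congˡ (-‿cong (alt-neg (λ y ys → φ y (x ∷ ys)) xs)))
      (solve 2 (λ a b → :- a :- (:- b) := :- (a :- b)) refl _ _)

    alt-- : ∀ (φ ψ : P → List P → Carrier) l → alt (λ y ys → φ y ys - ψ y ys) l ≈ alt φ l - alt ψ l
    alt-- φ ψ l = trans (alt-+ φ _ l) (+-congˡ (alt-neg ψ l))

    -- If one of the two exchanged entries is picked, the two terms trade places with opposite
    -- signs; if neither is, the sign comes from `φ`.
    alt-anti : ∀ (φ : P → List P → Carrier) → (∀ y → Anti (φ y)) → Anti (alt φ)
    alt-anti φ h (here {x} {y} {l}) = begin
      φ x (y ∷ l) - (φ y (x ∷ l) - alt (λ z zs → φ z (x ∷ y ∷ zs)) l)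
        ≈⟨ +-congˡ (-‿cong (+-congˡ (-‿cong (trans (alt-cong l (λ z zs → h z here)) (alt-neg _ l))))) ⟩
      φ x (y ∷ l) - (φ y (x ∷ l) - (- alt (λ z zs → φ z (y ∷ x ∷ zs)) l))
        ≈⟨ solve 3 (λ a b c → a :- (b :- (:- c)) := :- (b :- (a :- c))) refl _ _ _ ⟩
      - (φ y (x ∷ l) - (φ x (y ∷ l) - alt (λ z zs → φ z (y ∷ x ∷ zs)) l)) ∎
    alt-anti φ h (there {x} {l} {l'} s) = trans
      (+-cong (h x s) (-‿cong (alt-anti (λ y ys → φ y (x ∷ ys)) (λ y s' → h y (there s')) s)))
      (solve 2 (λ a b → :- a :- (:- b) := :- (a :- b)) refl _ _)

    -- A double pick is a signed sum over ordered pairs of positions; exchanging the order of the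
    -- two picks moves one entry past the other and changes the sign.
    alt-alt : ∀ (φ : P → P → List P → Carrier) l →
      alt (λ y ys → alt (λ z zs → φ y z zs) ys) l ≈ - alt (λ y ys → alt (λ z zs → φ z y zs) ys) l
    alt-alt φ [] = sym -0#≈0#
    alt-alt φ (x ∷ xs) = begin
      alt (φ x) xs - alt (λ y ys → φ y x ys - alt (λ z zs → φ y z (x ∷ zs)) ys) xs
        ≈⟨ +-congˡ (-‿cong (alt-- _ _ xs)) ⟩
      alt (φ x) xs - (alt (λ y ys → φ y x ys) xs - alt (λ y ys → alt (λ z zs → φ y z (x ∷ zs)) ys) xs)
        ≈⟨ +-congˡ (-‿cong (+-congˡ (-‿cong (alt-alt (λ y z zs → φ y z (x ∷ zs)) xs)))) ⟩
      alt (φ x) xs - (alt (λ y ys → φ y x ys) xs - (- alt (λ y ys → alt (λ z zs → φ z y (x ∷ zs)) ys) xs))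
        ≈⟨ solve 3 (λ a b c → a :- (b :- (:- c)) := :- (b :- (a :- c))) refl _ _ _ ⟩
      - (alt (λ y ys → φ y x ys) xs - (alt (φ x) xs - alt (λ y ys → alt (λ z zs → φ z y (x ∷ zs)) ys) xs))
        ≈⟨ -‿cong (+-congˡ (-‿cong (alt-- _ _ xs))) ⟨
      - (alt (λ y ys → φ y x ys) xs - alt (λ y ys → φ x y ys - alt (λ z zs → φ z y (x ∷ zs)) ys) xs) ∎

    -- A zero deep inside the list is moved to the front by adjacent swaps.
    anti-pick-0 : ∀ (F : List P → Carrier) → Anti F → ∀ {x y l l'} → Pick y l l' → F (x ∷ y ∷ l') ≈ 0# → F (x ∷ l) ≈ 0#
    anti-pick-0 F h here z = z
    anti-pick-0 F h {x} {y} (there {w} {l} {l'} p) z = begin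
      F (x ∷ w ∷ l) ≈⟨ h here ⟩
      - F (w ∷ x ∷ l) ≈⟨ -‿cong (anti-pick-0 (λ l → F (w ∷ l)) (λ s → h (there s)) p (begin
         F (w ∷ x ∷ y ∷ l') ≈⟨ h here ⟩
         - F (x ∷ w ∷ y ∷ l') ≈⟨ -‿cong (h (there here)) ⟩
         - (- F (x ∷ y ∷ w ∷ l')) ≈⟨ -‿involutive _ ⟩
         F (x ∷ y ∷ w ∷ l') ≈⟨ z ⟩
         0# ∎)) ⟩
      - 0# ≈⟨ -0#≈0# ⟩
      0# ∎

  alt-map : ∀ {a b} {P : Set a} {X : Set b} (f : X → P) (φ : P → List P → Carrier) l →
            alt φ (map f l) ≡ alt (λ y ys → φ (f y) (map f ys)) l
  alt-map f φ [] = ≡.refl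
  alt-map f φ (x ∷ l) = ≡.cong (λ z → φ (f x) (map f l) - z) (alt-map f (λ y ys → φ y (f x ∷ ys)) l)

  swap-map : ∀ {a b} {P : Set a} {X : Set b} (f : X → P) {l l'} → Swap l l' → Swap (map f l) (map f l')
  swap-map f here = here
  swap-map f (there s) = there (swap-map f s)

  module Pfaffian {p} {P : Set p} (e c : P → P → Carrier) where

    -- Pf(e / c) multiplied by the product of c over all pairs, for lists of length 2 k (and 0 for other lists).
    Q : ℕ → List P → Carrier
    Q zero [] = 1#
    Q zero (_ ∷ _) = 0#
    Q (suc k) [] = 0#
    Q (suc k) (x ∷ xs) = alt (λ y ys → e x y * (∏ (c x) ys * ∏ (c y) ys) * Q k ys) xs

    module _ (e-anti : ∀ x y → e x y ≈ - e y x) (c-sym : ∀ x y → c x y ≈ c y x) where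

      -- The term that matches x with y is antisymmetric through `e`. In all others x is matched
      -- with some z and y with some w; exchanging x with y and z with w preserves the summand, and
      -- `alt-alt` supplies the sign.
      Q-swap-head : ∀ k x y zs → Q k (x ∷ y ∷ zs) ≈ - Q k (y ∷ x ∷ zs)
      Q-swap-head zero x y zs = sym -0#≈0#
      -- Only one pair is available, so x and y must be matched with each other.
      Q-swap-head (suc zero) x y zs = begin
        e x y * (∏ (c x) zs * ∏ (c y) zs) * Q 0 zs - alt (λ z zs → e x z * _ * 0#) zs
          ≈⟨ +-cong (*-congʳ (*-congʳ (e-anti x y))) (-‿cong (alt-0 zs (λ _ → zeroʳ _))) ⟩
        (- e y x) * (∏ (c x) zs * ∏ (c y) zs) * Q 0 zs - 0#
          ≈⟨ solve 4 (λ a b c d → (:- a) :* (b :* c) :* d :- :0 := :- (a :* (c :* b) :* d :- :0)) refl _ _ _ _ ⟩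
        - (e y x * (∏ (c y) zs * ∏ (c x) zs) * Q 0 zs - 0#)
          ≈⟨ -‿cong (+-congˡ (-‿cong (alt-0 zs (λ _ → zeroʳ _)))) ⟨
        - (e y x * (∏ (c y) zs * ∏ (c x) zs) * Q 0 zs - alt (λ z zs → e y z * _ * 0#) zs) ∎
      Q-swap-head (suc (suc k)) x y zs = begin
        e x y * (∏ (c x) zs * ∏ (c y) zs) * Q (suc k) zs - rest x y
          ≈⟨ +-cong (*-congʳ (*-congʳ (e-anti x y))) (-‿cong rest-anti) ⟩
        (- e y x) * (∏ (c x) zs * ∏ (c y) zs) * Q (suc k) zs - (- rest y x)
          ≈⟨ solve 5 (λ a b c d t → (:- a) :* (b :* c) :* d :- (:- t) := :- (a :* (c :* b) :* d :- t)) refl _ _ _ _ _ ⟩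
        - (e y x * (∏ (c y) zs * ∏ (c x) zs) * Q (suc k) zs - rest y x) ∎
        where
        rest : P → P → Carrier
        rest x y = alt (λ z zs → e x z * (∏ (c x) (y ∷ zs) * ∏ (c z) (y ∷ zs)) * Q (suc k) (y ∷ zs)) zs
        φ : P → P → P → P → List P → Carrier
        φ x y z w ws = e x z * (∏ (c x) (y ∷ w ∷ ws) * ∏ (c z) (y ∷ w ∷ ws)) * (e y w * (∏ (c y) ws * ∏ (c w) ws) * Q k ws)
        expand : ∀ x y → rest x y ≈ alt (λ z zs → alt (λ w ws → φ x y z w ws) zs) zs
        expand x y = alt-cong zs (λ z zs' → trans (sym (alt-* _ _ zs'))
          (alt-cong-pick zs' (λ p → *-congʳ (*-congˡ (*-cong (*-congˡ (∏-pick _ p)) (*-congˡ (∏-pick _ p)))))))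
        φ-sym : ∀ z w ws → φ x y z w ws ≈ φ y x w z ws
        φ-sym z w ws = begin
          e x z * ((c x y * (c x w * X)) * (c z y * (c z w * Z))) * (e y w * (Y * W) * q)
            ≈⟨ *-congʳ (*-congˡ (*-cong (*-congʳ (c-sym x y)) (*-cong (c-sym z y) (*-congʳ (c-sym z w))))) ⟩
          e x z * ((c y x * (c x w * X)) * (c y z * (c w z * Z))) * (e y w * (Y * W) * q)
            ≈⟨ *-congʳ (*-congˡ (*-congʳ (*-congˡ (*-congʳ (c-sym x w))))) ⟩
          e x z * ((c y x * (c w x * X)) * (c y z * (c w z * Z))) * (e y w * (Y * W) * q)
            ≈⟨ solve 11 (λ exz cyx cwx X cyz cwz Z eyw Y W q →
                  exz :* ((cyx :* (cwx :* X)) :* (cyz :* (cwz :* Z))) :* (eyw :* (Y :* W) :* q)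
                  := eyw :* ((cyx :* (cyz :* Y)) :* (cwx :* (cwz :* W))) :* (exz :* (X :* Z) :* q)) refl
                 _ _ _ _ _ _ _ _ _ _ _ ⟩
          e y w * ((c y x * (c y z * Y)) * (c w x * (c w z * W))) * (e x z * (X * Z) * q) ∎
          where
          X = ∏ (c x) ws
          Y = ∏ (c y) ws
          Z = ∏ (c z) ws
          W = ∏ (c w) ws
          q = Q k ws
        rest-anti : rest x y ≈ - rest y x
        rest-anti = begin
          rest x y ≈⟨ expand x y ⟩
          alt (λ z zs → alt (λ w ws → φ x y z w ws) zs) zs
            ≈⟨ alt-cong zs (λ z zs → alt-cong zs (λ w ws → φ-sym z w ws)) ⟩
          alt (λ z zs → alt (λ w ws → φ y x w z ws) zs) zs ≈⟨ alt-alt (λ z w ws → φ y x w z ws) zs ⟩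
          - alt (λ z zs → alt (λ w ws → φ y x z w ws) zs) zs ≈⟨ -‿cong (expand y x) ⟨
          - rest y x ∎

      Q-anti : ∀ k → Anti (Q k)
      Q-anti k here = Q-swap-head k _ _ _
      Q-anti zero (there s) = sym -0#≈0#
      Q-anti (suc k) (there {x} s) = alt-anti _ (λ y s' → trans
        (*-cong (*-congˡ (*-cong (∏-swap _ s') (∏-swap _ s'))) (Q-anti k s'))
        (sym (-‿distribʳ-* _ _))) s

-- Pfaffians under rescaling, clearing of denominators, and Schur complements.

module Bordered {c ℓ} (R : CommutativeRing c ℓ) where

  open RingKit R
  open Alternants R

  module _ {a b} {P : Set a} {X : Set b} (e c : P → P → Carrier) (e' c' : X → X → Carrier) (f : X → P) (s : X → Carrier)
           (e-scale : ∀ x y → e (f x) (f y) ≈ s x * s y * e' x y) (c-map : ∀ x y → c (f x) (f y) ≈ c' x y) where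

    open Pfaffian e c
    open Pfaffian e' c' using () renaming (Q to Q')

    -- Each point lies in exactly one matched pair, so every matching contributes the same product
    -- of the scalings `s`.
    Q-scale : ∀ k l → Q k (map f l) ≈ ∏ s l * Q' k l
    Q-scale zero [] = sym (*-identityˡ 1#)
    Q-scale zero (x ∷ l) = sym (zeroʳ _)
    Q-scale (suc k) [] = sym (zeroʳ _)
    Q-scale (suc k) (x ∷ xs) = begin
      alt (λ y ys → e (f x) y * (∏ (c (f x)) ys * ∏ (c y) ys) * Q k ys) (map f xs)
        ≈⟨ reflexive (alt-map f _ xs) ⟩
      alt (λ y ys → e (f x) (f y) * (∏ (c (f x)) (map f ys) * ∏ (c (f y)) (map f ys)) * Q k (map f ys)) xs
        ≈⟨ alt-cong-pick xs (λ {y} {ys} p → begin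
             e (f x) (f y) * (∏ (c (f x)) (map f ys) * ∏ (c (f y)) (map f ys)) * Q k (map f ys)
               ≈⟨ *-cong (*-cong (e-scale x y) (*-cong (∏c x ys) (∏c y ys))) (Q-scale k ys) ⟩
             (s x * s y * e' x y) * (∏ (c' x) ys * ∏ (c' y) ys) * (∏ s ys * Q' k ys)
               ≈⟨ solve 7 (λ a b e u v w q → (a :* b :* e) :* (u :* v) :* (w :* q) := (a :* (b :* w)) :* (e :* (u :* v) :* q)) refl _ _ _ _ _ _ _ ⟩
             (s x * (s y * ∏ s ys)) * (e' x y * (∏ (c' x) ys * ∏ (c' y) ys) * Q' k ys)
               ≈⟨ *-congʳ (*-congˡ (∏-pick s p)) ⟨
             (s x * ∏ s xs) * (e' x y * (∏ (c' x) ys * ∏ (c' y) ys) * Q' k ys) ∎) ⟩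
      alt (λ y ys → (s x * ∏ s xs) * (e' x y * (∏ (c' x) ys * ∏ (c' y) ys) * Q' k ys)) xs
        ≈⟨ alt-* _ _ xs ⟩
      (s x * ∏ s xs) * Q' (suc k) (x ∷ xs) ∎
      where
      ∏c : ∀ x ys → ∏ (c (f x)) (map f ys) ≈ ∏ (c' x) ys
      ∏c x ys = trans (reflexive (∏-map _ f ys)) (∏-cong (c-map x) ys)

  ∏₂ : ∀ {a} {P : Set a} → (P → P → Carrier) → List P → Carrier
  ∏₂ d [] = 1#
  ∏₂ d (x ∷ l) = ∏ (d x) l * ∏₂ d l

  module _ {a} {P : Set a} (d : P → P → Carrier) (d-sym : ∀ x y → d x y ≈ d y x) where

    ∏₂-pick : ∀ {y l l'} → Pick y l l' → ∏₂ d l ≈ ∏ (d y) l' * ∏₂ d l'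
    ∏₂-pick here = refl
    ∏₂-pick {y} (there {x} {l} {l'} p) = begin
      ∏ (d x) l * ∏₂ d l ≈⟨ *-cong (trans (∏-pick (d x) p) (*-congʳ (d-sym x y))) (∏₂-pick p) ⟩
      (d y x * ∏ (d x) l') * (∏ (d y) l' * ∏₂ d l')
        ≈⟨ solve 4 (λ a b c d → (a :* b) :* (c :* d) := (a :* c) :* (b :* d)) refl _ _ _ _ ⟩
      (d y x * ∏ (d y) l') * (∏ (d x) l' * ∏₂ d l') ∎

    module _ (e c e₀ c₀ : P → P → Carrier) (he : ∀ x y → e x y ≈ e₀ x y * d x y) (hc : ∀ x y → c x y ≈ c₀ x y * d x y) where

      open Pfaffian e c
      open Pfaffian e₀ c₀ using () renaming (Q to Q₀)

      -- A pair of points contributes through `e` if it is matched and through `c` otherwise, so its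
      -- factor `d` occurs exactly once for every matching.
      Q-clear : ∀ k l → Q k l ≈ ∏₂ d l * Q₀ k l
      Q-clear zero [] = sym (*-identityˡ 1#)
      Q-clear zero (x ∷ l) = sym (zeroʳ _)
      Q-clear (suc k) [] = sym (zeroʳ _)
      Q-clear (suc k) (x ∷ xs) = trans (alt-cong-pick xs (λ {y} {ys} p → begin
        e x y * (∏ (c x) ys * ∏ (c y) ys) * Q k ys
          ≈⟨ *-cong (*-cong (he x y) (*-cong (split x ys) (split y ys))) (Q-clear k ys) ⟩
        (e₀ x y * d x y) * ((∏ (c₀ x) ys * ∏ (d x) ys) * (∏ (c₀ y) ys * ∏ (d y) ys)) * (∏₂ d ys * Q₀ k ys)
          ≈⟨ solve 8 (λ e d a b a' b' p q → (e :* d) :* ((a :* b) :* (a' :* b')) :* (p :* q)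
               := ((d :* b) :* (b' :* p)) :* (e :* (a :* a') :* q)) refl _ _ _ _ _ _ _ _ ⟩
        ((d x y * ∏ (d x) ys) * (∏ (d y) ys * ∏₂ d ys)) * (e₀ x y * (∏ (c₀ x) ys * ∏ (c₀ y) ys) * Q₀ k ys)
          ≈⟨ *-congʳ (*-cong (∏-pick (d x) p) (∏₂-pick p)) ⟨
        (∏ (d x) xs * ∏₂ d xs) * (e₀ x y * (∏ (c₀ x) ys * ∏ (c₀ y) ys) * Q₀ k ys) ∎)) (alt-* _ _ xs)
        where
        split : ∀ x l → ∏ (c x) l ≈ ∏ (c₀ x) l * ∏ (d x) l
        split x l = trans (∏-cong (hc x) l) (∏-* (c₀ x) (d x) l)

  module _ (tors : ∀ x → x ≈ - x → x ≈ 0#) {p} {P : Set p} (e c : P → P → Carrier)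
           (e-anti : ∀ x y → e x y ≈ - e y x) (c-sym : ∀ x y → c x y ≈ c y x)
           (α β : P) (e-αβ : e α β ≈ 1#) (c-α : ∀ z → c α z ≈ 1#) (c-β : ∀ z → c β z ≈ 1#) where

    open Pfaffian e c

    private
      anti : ∀ k → Anti (Q k)
      anti = Q-anti e-anti c-sym

      Q-repeat : ∀ k x l → Q k (x ∷ x ∷ l) ≈ 0#
      Q-repeat k x l = tors _ (anti k here)

      cα : ∀ l → ∏ (c α) l ≈ 1#
      cα = ∏-one c-α

      cβ : ∀ l → ∏ (c β) l ≈ 1#
      cβ = ∏-one c-β

      drop : ∀ z l → ∏ (c z) (α ∷ β ∷ l) ≈ ∏ (c z) l
      drop z l = trans (*-cong (trans (c-sym z α) (c-α z)) (*-congʳ (trans (c-sym z β) (c-β z))))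
        (trans (*-identityˡ _) (*-identityˡ _))

    -- The Pfaffian of α, α, β, `xs` vanishes because α is repeated. In its first-row expansion the
    -- partner α gives zero, the partner β gives the right-hand side up to sign, and the other
    -- partners give the sum.
    border-α : ∀ k xs → alt (λ y ys → e α y * ∏ (c y) ys * Q k (α ∷ β ∷ ys)) xs ≈ Q k (α ∷ xs)
    border-α k xs = begin
      A ≈⟨ solve 2 (λ a q → a := (:0 :* (:1 :* :1) :* q :- (:1 :* (:1 :* :1) :* q :- a)) :+ q) refl A (Q k (α ∷ xs)) ⟩
      (0# * (1# * 1#) * Q k (α ∷ xs) - (1# * (1# * 1#) * Q k (α ∷ xs) - A)) + Q k (α ∷ xs)
        ≈⟨ +-congʳ (+-cong (trans (*-congʳ (zeroˡ _)) (trans (zeroˡ _) (sym (trans (*-congʳ (trans (*-congʳ (tors _ (e-anti α α))) (zeroˡ _))) (zeroˡ _)))))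
            (-‿cong (+-cong (*-congʳ (*-cong (sym e-αβ) (*-cong (sym (cα (α ∷ xs))) (sym (cβ (α ∷ xs)))))) (-‿cong A≈)))) ⟩
      (e α α * (∏ (c α) (β ∷ xs) * ∏ (c α) (β ∷ xs)) * Q k (β ∷ xs)
        - (e α β * (∏ (c α) (α ∷ xs) * ∏ (c β) (α ∷ xs)) * Q k (α ∷ xs)
           - alt (λ y ys → e α y * (∏ (c α) (α ∷ β ∷ ys) * ∏ (c y) (α ∷ β ∷ ys)) * Q k (α ∷ β ∷ ys)) xs)) + Q k (α ∷ xs)
        ≈⟨ +-congʳ (Q-repeat (suc k) α (β ∷ xs)) ⟩
      0# + Q k (α ∷ xs) ≈⟨ +-identityˡ _ ⟩
      Q k (α ∷ xs) ∎
      where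
      A = alt (λ y ys → e α y * ∏ (c y) ys * Q k (α ∷ β ∷ ys)) xs
      A≈ = alt-cong xs (λ y ys → *-congʳ (*-congˡ (sym (trans (*-cong (cα (α ∷ β ∷ ys)) (drop y ys)) (*-identityˡ _)))))

    -- The same argument for the list β, α, β, `xs`; the repeated β becomes adjacent after one swap.
    border-β : ∀ k xs → alt (λ y ys → e β y * ∏ (c y) ys * Q k (α ∷ β ∷ ys)) xs ≈ Q k (β ∷ xs)
    border-β k xs = begin
      A ≈⟨ solve 2 (λ a q → a := ((:- :1) :* (:1 :* :1) :* q :- (:0 :- a)) :+ q) refl A (Q k (β ∷ xs)) ⟩
      ((- 1#) * (1# * 1#) * Q k (β ∷ xs) - (0# - A)) + Q k (β ∷ xs)
        ≈⟨ +-congʳ (+-cong (*-congʳ (*-cong (sym (trans (e-anti β α) (-‿cong e-αβ))) (*-cong (sym (cβ (β ∷ xs))) (sym (cα (β ∷ xs))))))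
            (-‿cong (+-cong (sym (trans (*-congʳ (trans (*-congʳ (tors _ (e-anti β β))) (zeroˡ _))) (zeroˡ _))) (-‿cong A≈)))) ⟩
      (e β α * (∏ (c β) (β ∷ xs) * ∏ (c α) (β ∷ xs)) * Q k (β ∷ xs)
        - (e β β * (∏ (c β) (α ∷ xs) * ∏ (c β) (α ∷ xs)) * Q k (α ∷ xs)
           - alt (λ y ys → e β y * (∏ (c β) (α ∷ β ∷ ys) * ∏ (c y) (α ∷ β ∷ ys)) * Q k (α ∷ β ∷ ys)) xs)) + Q k (β ∷ xs)
        ≈⟨ +-congʳ (trans (anti (suc k) (there {x = β} (here {x = α} {y = β} {l = xs}))) (trans (-‿cong (Q-repeat (suc k) β (α ∷ xs))) -0#≈0#)) ⟩
      0# + Q k (β ∷ xs) ≈⟨ +-identityˡ _ ⟩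
      Q k (β ∷ xs) ∎
      where
      A = alt (λ y ys → e β y * ∏ (c y) ys * Q k (α ∷ β ∷ ys)) xs
      A≈ = alt-cong xs (λ y ys → *-congʳ (*-congˡ (sym (trans (*-cong (cβ (α ∷ β ∷ ys)) (drop y ys)) (*-identityˡ _)))))

    -- The Schur complement of the block of α and β, whose Pfaffian is 1. The factor `c x y` clears
    -- the denominators; `c` is 1 on the border.
    schur : P → P → Carrier
    schur x y = e x y - (e α x * e β y - e β x * e α y) * c x y

    open Pfaffian schur c using () renaming (Q to Qₛ)

    -- Two swaps bring x to the front, and one expands along x. When its partner is α or β, the
    -- remaining Pfaffian has half of the border and is rewritten by `border-β` or `border-α` as a
    -- sum over y; all terms then combine into `schur x y` times a smaller bordered Pfaffian.
    Q-schur : ∀ k l → Q (suc k) (α ∷ β ∷ l) ≈ Qₛ k l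
    Q-schur zero [] = trans (+-congʳ (*-congʳ (*-congʳ e-αβ)))
      (solve 0 (:1 :* (:1 :* :1) :* :1 :- :0 := :1) refl)
    Q-schur zero (x ∷ xs) = trans (+-cong (zeroʳ _) (-‿cong (alt-0 {φ = λ y ys → e α y * (∏ (c α) (β ∷ ys) * ∏ (c y) (β ∷ ys)) * 0#} (x ∷ xs) (λ _ → zeroʳ _))))
      (solve 0 (:0 :- :0 := :0) refl)
    Q-schur (suc k) [] = trans (+-congʳ (zeroʳ _)) (solve 0 (:0 :- :0 := :0) refl)
    Q-schur (suc k) (x ∷ xs) = begin
      Q (suc (suc k)) (α ∷ β ∷ x ∷ xs)
        ≈⟨ trans (anti (suc (suc k)) (there {x = α} (here {x = β} {y = x} {l = xs}))) (trans (-‿cong (anti (suc (suc k)) (here {x = α} {y = x} {l = β ∷ xs}))) (-‿involutive _)) ⟩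
      e x α * (∏ (c x) (β ∷ xs) * ∏ (c α) (β ∷ xs)) * Q (suc k) (β ∷ xs)
        - (e x β * (∏ (c x) (α ∷ xs) * ∏ (c β) (α ∷ xs)) * Q (suc k) (α ∷ xs)
           - alt (λ y ys → e x y * (∏ (c x) (α ∷ β ∷ ys) * ∏ (c y) (α ∷ β ∷ ys)) * Q (suc k) (α ∷ β ∷ ys)) xs)
        ≈⟨ +-cong (*-congʳ (*-cong (e-anti x α) (*-cong (*-congʳ (trans (c-sym x β) (c-β x))) (cα (β ∷ xs)))))
            (-‿cong (+-cong (*-congʳ (*-cong (e-anti x β) (*-cong (*-congʳ (trans (c-sym x α) (c-α x))) (cβ (α ∷ xs)))))
              (-‿cong (alt-cong xs (λ y ys → *-congʳ (*-congˡ (*-cong (drop x ys) (drop y ys)))))))) ⟩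
      (- e α x) * ((1# * X) * 1#) * Q (suc k) (β ∷ xs)
        - ((- e β x) * ((1# * X) * 1#) * Q (suc k) (α ∷ xs) - E)
        ≈⟨ solve 6 (λ a b x q r s → (:- a) :* ((:1 :* x) :* :1) :* q :- ((:- b) :* ((:1 :* x) :* :1) :* r :- s)
              := s :- (x :* a :* q :- x :* b :* r)) refl _ _ _ _ _ _ ⟩
      E - (X * e α x * Q (suc k) (β ∷ xs) - X * e β x * Q (suc k) (α ∷ xs))
        ≈⟨ +-congˡ (-‿cong (+-cong (*-congˡ (border-β (suc k) xs)) (-‿cong (*-congˡ (border-α (suc k) xs))))) ⟨
      E - (X * e α x * B β - X * e β x * B α)
        ≈⟨ +-congˡ (-‿cong (trans (+-cong (alt-* _ _ xs) (-‿cong (alt-* _ _ xs))) refl)) ⟨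
      E - (alt (λ y ys → X * e α x * h β y ys) xs - alt (λ y ys → X * e β x * h α y ys) xs)
        ≈⟨ +-congˡ (-‿cong (alt-- _ _ xs)) ⟨
      E - alt (λ y ys → X * e α x * h β y ys - X * e β x * h α y ys) xs
        ≈⟨ alt-- _ _ xs ⟨
      alt (λ y ys → e x y * (∏ (c x) ys * ∏ (c y) ys) * Q (suc k) (α ∷ β ∷ ys) - (X * e α x * h β y ys - X * e β x * h α y ys)) xs
        ≈⟨ alt-cong-pick xs (λ {y} {ys} p → begin
             e x y * (∏ (c x) ys * ∏ (c y) ys) * Q (suc k) (α ∷ β ∷ ys) - (X * e α x * h β y ys - X * e β x * h α y ys)
               ≈⟨ +-congˡ (-‿cong (+-cong (*-congʳ (*-congʳ (∏-pick _ p))) (-‿cong (*-congʳ (*-congʳ (∏-pick _ p)))))) ⟩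
             e x y * (∏ (c x) ys * ∏ (c y) ys) * Q (suc k) (α ∷ β ∷ ys)
               - ((c x y * ∏ (c x) ys) * e α x * h β y ys - (c x y * ∏ (c x) ys) * e β x * h α y ys)
               ≈⟨ solve 9 (λ e u v q k a b a' b' → e :* (u :* v) :* q :- ((k :* u) :* a :* (b' :* v :* q) :- (k :* u) :* b :* (a' :* v :* q))
                     := (e :- (a :* b' :- b :* a') :* k) :* (u :* v) :* q) refl _ _ _ _ _ _ _ _ _ ⟩
             schur x y * (∏ (c x) ys * ∏ (c y) ys) * Q (suc k) (α ∷ β ∷ ys)
               ≈⟨ *-congˡ (Q-schur k ys) ⟩
             schur x y * (∏ (c x) ys * ∏ (c y) ys) * Qₛ k ys ∎) ⟩
      Qₛ (suc k) (x ∷ xs) ∎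
      where
      X = ∏ (c x) xs
      E = alt (λ y ys → e x y * (∏ (c x) ys * ∏ (c y) ys) * Q (suc k) (α ∷ β ∷ ys)) xs
      h : P → P → List P → Carrier
      h γ y ys = e γ y * ∏ (c y) ys * Q (suc k) (α ∷ β ∷ ys)
      B : P → Carrier
      B γ = alt (h γ) xs

-- Binary forms that vanish at sufficiently many points.

module BinaryForms {c ℓ} (R : CommutativeRing c ℓ) where

  open RingKit R
  open Alternants R

  -- Non-zero-divisors take the place of nonzero elements, since the ring is not assumed to be a
  -- domain.
  Reg : Carrier → Set _
  Reg r = ∀ z → r * z ≈ 0# → z ≈ 0#

  reg-resp : ∀ {r s} → r ≈ s → Reg r → Reg s
  reg-resp eq h z sz = h z (trans (*-congʳ eq) sz)

  reg-neg : ∀ {r} → Reg r → Reg (- r)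
  reg-neg {r} h z nz = h z (begin
    r * z ≈⟨ solve 2 (λ r z → r :* z := :- ((:- r) :* z)) refl r z ⟩
    - ((- r) * z) ≈⟨ -‿cong nz ⟩
    - 0# ≈⟨ -0#≈0# ⟩
    0# ∎)

  reg-1 : Reg 1#
  reg-1 z h = trans (sym (*-identityˡ z)) h

  reg-* : ∀ {r s} → Reg r → Reg s → Reg (r * s)
  reg-* hr hs z h = hs z (hr _ (trans (sym (*-assoc _ _ z)) h))

  _^_ : Carrier → ℕ → Carrier
  x ^ zero = 1#
  x ^ suc n = x * x ^ n

  reg-^ : ∀ {r} → Reg r → ∀ n → Reg (r ^ n)
  reg-^ h zero = reg-1
  reg-^ h (suc n) = reg-* h (reg-^ h n)

  -- Homogeneity of degree d is certified by a construction tree instead of a coefficient vector: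
  -- division by a linear factor is then an induction on the tree, and forms built by signed sums
  -- need no coefficient computation.
  data Form : ℕ → (Carrier → Carrier → Carrier) → Set (c Level.⊔ ℓ) where
    con₀ : ∀ k → Form 0 (λ _ _ → k)
    nul  : ∀ {d} → Form d (λ _ _ → 0#)
    lin  : ∀ {d F} p q → Form d F → Form (suc d) (λ a b → (p * a + q * b) * F a b)
    scl  : ∀ {d F} k → Form d F → Form d (λ a b → k * F a b)
    add  : ∀ {d F G} → Form d F → Form d G → Form d (λ a b → F a b + G a b)
    ext  : ∀ {d F G} → (∀ a b → F a b ≈ G a b) → Form d F → Form d G

  form-neg : ∀ {d F} → Form d F → Form d (λ a b → - F a b)
  form-neg f = ext (λ a b → solve 1 (λ x → (:- :1) :* x := :- x) refl _) (scl (- 1#) f)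

  form-sub : ∀ {d F G} → Form d F → Form d G → Form d (λ a b → F a b - G a b)
  form-sub f g = add f (form-neg g)

  form-mul : ∀ {d d' F G} → Form d F → Form d' G → Form (d ℕ.+ d') (λ a b → F a b * G a b)
  form-mul (con₀ k) g = scl k g
  form-mul nul g = ext (λ a b → sym (zeroˡ _)) nul
  form-mul (lin p q f) g = ext (λ a b → sym (*-assoc _ _ _)) (lin p q (form-mul f g))
  form-mul (scl k f) g = ext (λ a b → sym (*-assoc _ _ _)) (scl k (form-mul f g))
  form-mul (add f h) g = ext (λ a b → sym (distribʳ _ _ _)) (add (form-mul f g) (form-mul h g))
  form-mul (ext e f) g = ext (λ a b → *-congʳ (e a b)) (form-mul f g)

  form-const : ∀ {F} → Form 0 F → ∀ a b a' b' → F a b ≈ F a' b'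
  form-const (con₀ k) a b a' b' = refl
  form-const nul a b a' b' = refl
  form-const (scl k f) a b a' b' = *-congˡ (form-const f a b a' b')
  form-const (add f g) a b a' b' = +-cong (form-const f a b a' b') (form-const g a b a' b')
  form-const (ext e f) a b a' b' = trans (sym (e a b)) (trans (form-const f a b a' b') (e a' b'))

  form-alt : ∀ {p} {P : Set p} {d} {φ : Carrier → Carrier → P → List P → Carrier} l →
    (∀ {y ys} → Pick y l ys → Form d (λ a b → φ a b y ys)) → Form d (λ a b → alt (φ a b) l)
  form-alt [] h = nul
  form-alt (x ∷ xs) h = form-sub (h here) (form-alt xs (λ p → h (there p)))

  -- The factor theorem F(x) - F(x₁) = (x - x₁) H(x), homogenized: the powers of b₁ and b bring both
  -- values to a common degree without division.
  form-div : ∀ {d F} → Form (suc d) F → ∀ a₁ b₁ → ∃ λ H → Form d H ×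
    (∀ a b → b₁ ^ suc d * F a b - b ^ suc d * F a₁ b₁ ≈ (a * b₁ - a₁ * b) * H a b)
  form-div nul a₁ b₁ = _ , nul , λ a b → solve 4 (λ x y u v → x :* :0 :- y :* :0 := (u :- v) :* :0) refl _ _ _ _
  form-div {zero} (lin {F = F} p q f) a₁ b₁ = _ , scl p f , λ a b → begin
    (b₁ * 1#) * ((p * a + q * b) * F a b) - (b * 1#) * ((p * a₁ + q * b₁) * F a₁ b₁)
      ≈⟨ +-congˡ (-‿cong (*-congˡ (*-congˡ (form-const f a₁ b₁ a b)))) ⟩
    (b₁ * 1#) * ((p * a + q * b) * F a b) - (b * 1#) * ((p * a₁ + q * b₁) * F a b)
      ≈⟨ solve 7 (λ a b a₁ b₁ p q F → (b₁ :* :1) :* ((p :* a :+ q :* b) :* F) :- (b :* :1) :* ((p :* a₁ :+ q :* b₁) :* F)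
           := (a :* b₁ :- a₁ :* b) :* (p :* F)) refl _ _ _ _ _ _ _ ⟩
    (a * b₁ - a₁ * b) * (p * F a b) ∎
  form-div {suc d} (lin {F = F} p q f) a₁ b₁ with form-div f a₁ b₁
  -- With L the linear factor, b₁ L(a, b) - b L(a₁, b₁) = p (a b₁ - a₁ b). This yields the first
  -- summand; the second is b L(a₁, b₁) times the inductive quotient, with b written as a linear
  -- form to raise the degree.
  ... | H , h , eq = _ , add (scl (p * b₁ ^ suc d) f) (lin 0# (p * a₁ + q * b₁) h) , λ a b → begin
    (b₁ * b₁ ^ suc d) * ((p * a + q * b) * F a b) - (b * b ^ suc d) * ((p * a₁ + q * b₁) * F a₁ b₁)
      ≈⟨ solve 10 (λ a b a₁ b₁ p q F F₁ u v →
           (b₁ :* u) :* ((p :* a :+ q :* b) :* F) :- (b :* v) :* ((p :* a₁ :+ q :* b₁) :* F₁)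
           := (a :* b₁ :- a₁ :* b) :* ((p :* u) :* F) :+ b :* (p :* a₁ :+ q :* b₁) :* (u :* F :- v :* F₁)) refl
           a b a₁ b₁ p q (F a b) (F a₁ b₁) (b₁ ^ suc d) (b ^ suc d) ⟩
    (a * b₁ - a₁ * b) * ((p * b₁ ^ suc d) * F a b) + b * (p * a₁ + q * b₁) * (b₁ ^ suc d * F a b - b ^ suc d * F a₁ b₁)
      ≈⟨ +-congˡ (*-congˡ (eq a b)) ⟩
    (a * b₁ - a₁ * b) * ((p * b₁ ^ suc d) * F a b) + b * (p * a₁ + q * b₁) * ((a * b₁ - a₁ * b) * H a b)
      ≈⟨ solve 6 (λ a b D Y u H → D :* Y :+ b :* u :* (D :* H) := D :* (Y :+ (:0 :* a :+ u :* b) :* H)) refl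
           a b (a * b₁ - a₁ * b) ((p * b₁ ^ suc d) * F a b) (p * a₁ + q * b₁) (H a b) ⟩
    (a * b₁ - a₁ * b) * ((p * b₁ ^ suc d) * F a b + (0# * a + (p * a₁ + q * b₁) * b) * H a b) ∎
  form-div {d} (scl {F = F} k f) a₁ b₁ with form-div f a₁ b₁
  ... | H , h , eq = _ , scl k h , λ a b → begin
    b₁ ^ suc d * (k * F a b) - b ^ suc d * (k * F a₁ b₁)
      ≈⟨ solve 5 (λ u v k x y → u :* (k :* x) :- v :* (k :* y) := k :* (u :* x :- v :* y)) refl _ _ _ _ _ ⟩
    k * (b₁ ^ suc d * F a b - b ^ suc d * F a₁ b₁) ≈⟨ *-congˡ (eq a b) ⟩
    k * ((a * b₁ - a₁ * b) * H a b) ≈⟨ solve 3 (λ u v k → k :* (u :* v) := u :* (k :* v)) refl _ _ _ ⟩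
    (a * b₁ - a₁ * b) * (k * H a b) ∎
  form-div {d} (add {F = F} {G = G} f g) a₁ b₁ with form-div f a₁ b₁ | form-div g a₁ b₁
  ... | H , h , eq | H' , h' , eq' = _ , add h h' , λ a b → begin
    b₁ ^ suc d * (F a b + G a b) - b ^ suc d * (F a₁ b₁ + G a₁ b₁)
      ≈⟨ solve 6 (λ u v x y z w → u :* (x :+ y) :- v :* (z :+ w) := (u :* x :- v :* z) :+ (u :* y :- v :* w)) refl _ _ _ _ _ _ ⟩
    (b₁ ^ suc d * F a b - b ^ suc d * F a₁ b₁) + (b₁ ^ suc d * G a b - b ^ suc d * G a₁ b₁) ≈⟨ +-cong (eq a b) (eq' a b) ⟩
    (a * b₁ - a₁ * b) * H a b + (a * b₁ - a₁ * b) * H' a b ≈⟨ distribˡ _ _ _ ⟨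
    (a * b₁ - a₁ * b) * (H a b + H' a b) ∎
  form-div (ext e f) a₁ b₁ with form-div f a₁ b₁
  ... | H , h , eq = _ , h , λ a b → trans (+-cong (*-congˡ (sym (e a b))) (-‿cong (*-congˡ (sym (e a₁ b₁))))) (eq a b)

  Pt : Set c
  Pt = Carrier × Carrier

  det : Pt → Pt → Carrier
  det (a , b) (a' , b') = a * b' - a' * b

  -- Dividing by the first node lowers the degree by one. The quotient still vanishes at the other
  -- nodes because their determinants with the first are regular, and in the end b₁ is cancelled by
  -- its own regularity.
  form-zero : ∀ {d F} → Form d F → ∀ nodes → length nodes ≡ suc d →
    AllPairs (λ p q → Reg (det q p)) nodes → All (λ p → Reg (proj₂ p)) nodes →
    All (λ p → F (proj₁ p) (proj₂ p) ≈ 0#) nodes → ∀ a b → F a b ≈ 0#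
  form-zero {zero} f ((a₁ , b₁) ∷ _) _ _ _ (z ∷ _) a b = trans (form-const f a b a₁ b₁) z
  form-zero {suc d} {F} f ((a₁ , b₁) ∷ nodes) len (r ∷ rs) (rb ∷ rbs) (z ∷ zs) a b with form-div f a₁ b₁
  ... | H , h , eq = reg-^ rb (suc d) _ (trans (eq' a b) (trans (*-congˡ (H≈0 a b)) (zeroʳ _)))
    where
    eq' : ∀ a b → b₁ ^ suc d * F a b ≈ (a * b₁ - a₁ * b) * H a b
    eq' a b = begin
      b₁ ^ suc d * F a b ≈⟨ solve 2 (λ x y → x := x :- y :* :0) refl _ _ ⟩
      b₁ ^ suc d * F a b - b ^ suc d * 0# ≈⟨ +-congˡ (-‿cong (*-congˡ z)) ⟨
      b₁ ^ suc d * F a b - b ^ suc d * F a₁ b₁ ≈⟨ eq a b ⟩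
      (a * b₁ - a₁ * b) * H a b ∎
    H-zeros : ∀ {nodes} → All (λ q → Reg (det q (a₁ , b₁))) nodes →
      All (λ p → F (proj₁ p) (proj₂ p) ≈ 0#) nodes → All (λ p → H (proj₁ p) (proj₂ p) ≈ 0#) nodes
    H-zeros [] [] = []
    H-zeros (r ∷ rs) (z ∷ zs) = r _ (trans (sym (eq' _ _)) (trans (*-congˡ z) (zeroʳ _))) ∷ H-zeros rs zs
    H≈0 : ∀ a b → H a b ≈ 0#
    H≈0 = form-zero h nodes (ℕP.suc-injective len) rs rbs (H-zeros r zs)

-- Parity of lengths, and the two hypotheses on the ring.

-- Parity and rounded-down half come together, so one case split decides both whether a list is
-- padded and how many pairs it has.
halve : ℕ → Bool × ℕ
halve zero = true , zero
halve (suc n) = next (halve n)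
  where
  next : Bool × ℕ → Bool × ℕ
  next (true , k) = false , k
  next (false , k) = true , suc k

dbl : ℕ → ℕ
dbl zero = 0
dbl (suc n) = suc (suc (dbl n))

even? : ℕ → Bool
even? n = proj₁ (halve n)

even?-suc : ∀ n → even? (suc n) ≡ not (even? n)
even?-suc n with halve n
... | true , k = ≡.refl
... | false , k = ≡.refl

even?-suc² : ∀ n → even? (suc (suc n)) ≡ even? n
even?-suc² n with halve n
... | true , k = ≡.refl
... | false , k = ≡.refl

halve-dbl : ∀ n → halve (dbl n) ≡ (true , n)
halve-dbl zero = ≡.refl
halve-dbl (suc n) rewrite halve-dbl n = ≡.refl

TorsionFree₂ : ∀ {c ℓ} → CommutativeRing c ℓ → Set _
TorsionFree₂ R = ∀ x → x ≈ - x → x ≈ 0#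
  where open CommutativeRing R

-- The index is shifted because [0]_t = 0 has no inverse: `ι r` inverts [r+1]_t.
InvertsQIntegers : ∀ {c ℓ} (R : CommutativeRing c ℓ) (t : CommutativeRing.Carrier R) → (ℕ → CommutativeRing.Carrier R) → Set _
InvertsQIntegers R t ι = ∀ r → ι r * qint t (suc r) ≈ 1#
  where open RingKit R

-- The key identity `G` = `S`.

module ClearedIdentity {c ℓ} (R : CommutativeRing c ℓ) (tors : TorsionFree₂ R)
  (t : CommutativeRing.Carrier R) (ι : ℕ → CommutativeRing.Carrier R) (ι-inv : InvertsQIntegers R t ι) where

  open RingKit R
  open Alternants R
  open Bordered R
  open BinaryForms R

  -- The point (a , b) stands for x = a / b, and everything is homogeneous in (a , b), so that x = 1 / x_k needs no division.
  -- nothing is the extra index that pads lists of odd length.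
  e : Carrier → Maybe Pt → Maybe Pt → Carrier
  e w nothing nothing = 0#
  e w nothing (just _) = 1#
  e w (just _) nothing = - 1#
  e w (just (a , b)) (just (a' , b')) = (a * b' - a' * b) * ((1# - w) * (b * b') + (w - t) * (a * a'))

  k : Maybe Pt → Maybe Pt → Carrier
  k nothing _ = 1#
  k (just _) nothing = 1#
  k (just (a , b)) (just (a' , b')) = (b * b' - a * a') * (b * b' - t * (a * a'))

  e-anti : ∀ w x y → e w x y ≈ - e w y x
  e-anti w nothing nothing = sym -0#≈0#
  e-anti w nothing (just _) = sym (-‿involutive 1#)
  e-anti w (just _) nothing = refl
  e-anti w (just (a , b)) (just (a' , b')) = solve 6 (λ a b a' b' w t →
    (a :* b' :- a' :* b) :* ((:1 :- w) :* (b :* b') :+ (w :- t) :* (a :* a'))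
    := :- ((a' :* b :- a :* b') :* ((:1 :- w) :* (b' :* b) :+ (w :- t) :* (a' :* a)))) refl _ _ _ _ _ _

  k-sym : ∀ x y → k x y ≈ k y x
  k-sym nothing nothing = refl
  k-sym nothing (just _) = refl
  k-sym (just _) nothing = refl
  k-sym (just (a , b)) (just (a' , b')) =
    *-cong (+-cong (*-comm _ _) (-‿cong (*-comm _ _))) (+-cong (*-comm _ _) (-‿cong (*-congˡ (*-comm _ _))))

  module Pf (w : Carrier) = Pfaffian (e w) k
  open Pf public using (Q)

  Q-antisym : ∀ w n → Anti (Q w n)
  Q-antisym w = Pf.Q-anti w (e-anti w) k-sym

  G' : Bool × ℕ → Carrier → List Pt → Carrier
  G' (true , n) w l = Q w n (map just l)
  G' (false , n) w l = Q w (suc n) (nothing ∷ map just l)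

  G : Carrier → List Pt → Carrier
  G w l = G' (halve (length l)) w l

  W' : Bool × ℕ → List Pt → Carrier
  W' (true , n) l = Q 1# n (map just l)
  W' (false , n) l = 0#

  W : List Pt → Carrier
  W l = W' (halve (length l)) l

  κ : Pt → Pt → Carrier
  κ (a , b) (a' , b') = (t * (a * b') - a' * b) * (b * b' - a * a')

  D : (List Pt → Carrier) → List Pt → Carrier
  D f l = alt (λ y ys → ∏ (κ y) ys * f ys) l

  -- The q-divided powers D^r / [r]!.
  D^ : ℕ → (List Pt → Carrier) → List Pt → Carrier
  D^ zero f l = f l
  D^ (suc r) f l = ι r * D (D^ r f) l

  ε : Bool → Carrier → Carrier
  ε true w = 1# - w
  ε false w = 1#

  g : Bool → ℕ → Carrier → Carrier
  g b zero w = 1#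
  g b (suc r) w = ε b w * g (not b) r (t * w)

  S : Carrier → List Pt → Carrier
  S w l = Σ≤ (length l) (λ r → g (even? (length l)) r w * D^ r W l)

  G-anti : ∀ w → Anti (G w)
  G-anti w {l} {l'} s rewrite swap-length s with halve (length l')
  ... | true , n = Q-antisym w n (swap-map just s)
  ... | false , n = Q-antisym w (suc n) (there {x = nothing} {l = map just l} {l' = map just l'} (swap-map just s))

  W-anti : Anti W
  W-anti {l} {l'} s rewrite swap-length s with halve (length l')
  ... | true , n = Q-antisym 1# n (swap-map just s)
  ... | false , n = sym -0#≈0#

  D-anti : ∀ {f} → Anti f → Anti (D f)
  D-anti h = alt-anti _ (λ y s → trans (*-cong (∏-swap _ s) (h s)) (sym (-‿distribʳ-* _ _)))

  D^-anti : ∀ r {f} → Anti f → Anti (D^ r f)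
  D^-anti zero h = h
  D^-anti (suc r) {f} h s = trans (*-congˡ (D-anti {D^ r f} (D^-anti r h) s)) (sym (-‿distribʳ-* _ _))

  S-anti : ∀ w → Anti (S w)
  S-anti w {l} {l'} s rewrite swap-length s = trans
    (Σ≤-cong (length l') (λ r _ → trans (*-congˡ (D^-anti r {W} W-anti s)) (sym (-‿distribʳ-* _ _))))
    (Σ≤-neg (length l') _)

  -- Each application of `D` removes one variable, and the signed sum over an empty list is zero.
  D^-vanish : ∀ r f l → length l ℕ.< r → D^ r f l ≈ 0#
  D^-vanish (suc r) f l (ℕ.s≤s p) = trans (*-congˡ (alt-0 l (λ pk →
    trans (*-congˡ (D^-vanish r f _ (≡.subst (ℕ._≤ r) (pick-length pk) p))) (zeroʳ _)))) (zeroʳ _)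

  fin inv : Carrier → Pt
  fin x = x , 1#
  inv x = 1# , x

  -- The prefactor is e_w at the pair (1/x, x). In it (1 - w) x + (w - t) x = (1 - t) x, so w drops
  -- out; hence the same ρ serves `G w` and `W`.
  ρ : Carrier → List Pt → Carrier
  ρ x l = ((1# - x * x) * (1# - t) * x) * (∏ (λ z → k (just (inv x)) (just z)) l * ∏ (λ z → k (just (fin x)) (just z)) l)

  -- Since k vanishes at the pair (1 / x , x), only the terms that pair these two points with each other survive.
  Residual : (List Pt → Carrier) → Set _
  Residual f = ∀ x l → f (inv x ∷ fin x ∷ l) ≈ ρ x l * f l

  k-inv : ∀ x → k (just (inv x)) (just (fin x)) ≈ 0#
  k-inv x = solve 2 (λ x t → (x :* :1 :- :1 :* x) :* (x :* :1 :- t :* (:1 :* x)) := :0) refl x t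

  Q-residue : ∀ w n x l → Q w (suc n) (just (inv x) ∷ just (fin x) ∷ l) ≈
    ((1# - x * x) * (1# - t) * x) * (∏ (k (just (inv x))) l * ∏ (k (just (fin x))) l) * Q w n l
  Q-residue w n x l = begin
    e w i f * (∏ (k i) l * ∏ (k f) l) * Q w n l - alt (λ z zs → e w i z * ((k i f * ∏ (k i) zs) * (k z f * ∏ (k z) zs)) * Q w n (f ∷ zs)) l
      ≈⟨ +-congˡ (-‿cong (alt-0 l (λ {z} {zs} _ → trans (*-congʳ (*-congˡ (*-congʳ (*-congʳ (k-inv x)))))
           (solve 5 (λ a b c d e → a :* ((:0 :* b) :* (c :* d)) :* e := :0) refl _ _ _ _ _)))) ⟩
    e w i f * (∏ (k i) l * ∏ (k f) l) * Q w n l - 0#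
      ≈⟨ solve 6 (λ x w t a b q →
           ((:1 :* :1 :- x :* x) :* ((:1 :- w) :* (x :* :1) :+ (w :- t) :* (:1 :* x))) :* (a :* b) :* q :- :0
           := ((:1 :- x :* x) :* (:1 :- t) :* x) :* (a :* b) :* q) refl x w t _ _ _ ⟩
    ((1# - x * x) * (1# - t) * x) * (∏ (k i) l * ∏ (k f) l) * Q w n l ∎
    where
    i = just (inv x)
    f = just (fin x)

  ρ-just : ∀ x l → ((1# - x * x) * (1# - t) * x) * (∏ (k (just (inv x))) (map just l) * ∏ (k (just (fin x))) (map just l)) ≈ ρ x l
  ρ-just x l = *-congˡ (*-cong (reflexive (∏-map _ just l)) (reflexive (∏-map _ just l)))

  G-residual : ∀ w → Residual (G w)
  G-residual w x l with halve (length l)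
  ... | true , n = trans (Q-residue w n x _) (*-congʳ (ρ-just x l))
  -- The padding index is moved past both special points, so no sign remains.
  ... | false , n = begin
    Q w (suc (suc n)) (nothing ∷ just (inv x) ∷ just (fin x) ∷ map just l)
      ≈⟨ Q-antisym w (suc (suc n)) (here {x = nothing} {y = just (inv x)} {l = just (fin x) ∷ map just l}) ⟩
    - Q w (suc (suc n)) (just (inv x) ∷ nothing ∷ just (fin x) ∷ map just l)
      ≈⟨ -‿cong (Q-antisym w (suc (suc n)) (there {x = just (inv x)} (here {x = nothing} {y = just (fin x)} {l = map just l}))) ⟩
    - - Q w (suc (suc n)) (just (inv x) ∷ just (fin x) ∷ nothing ∷ map just l) ≈⟨ -‿involutive _ ⟩
    Q w (suc (suc n)) (just (inv x) ∷ just (fin x) ∷ nothing ∷ map just l) ≈⟨ Q-residue w (suc n) x (nothing ∷ map just l) ⟩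
    ((1# - x * x) * (1# - t) * x) * ((1# * ∏ (k (just (inv x))) (map just l)) * (1# * ∏ (k (just (fin x))) (map just l))) * Q w (suc n) (nothing ∷ map just l)
      ≈⟨ *-congʳ (*-congˡ (*-cong (*-identityˡ _) (*-identityˡ _))) ⟩
    ((1# - x * x) * (1# - t) * x) * (∏ (k (just (inv x))) (map just l) * ∏ (k (just (fin x))) (map just l)) * Q w (suc n) (nothing ∷ map just l)
      ≈⟨ *-congʳ (ρ-just x l) ⟩
    ρ x l * Q w (suc n) (nothing ∷ map just l) ∎

  W-residual : Residual W
  W-residual x l with halve (length l)
  ... | true , n = trans (Q-residue 1# n x _) (*-congʳ (ρ-just x l))
  ... | false , n = sym (zeroʳ _)

  -- Neither special point can be picked, because κ vanishes between 1/x and x in both orders. For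
  -- any other picked z the two factors κ z (1/x) and κ z x multiply to the factors of z in ρ, which
  -- completes ρ for the shorter list.
  D-residual : ∀ {f} → Residual f → Residual (D f)
  D-residual {f} h x l = begin
    (κ i j * ∏ (κ i) l) * f (j ∷ l) - ((κ j i * ∏ (κ j) l) * f (i ∷ l) - alt (λ z zs → (κ z i * (κ z j * ∏ (κ z) zs)) * f (i ∷ j ∷ zs)) l)
      ≈⟨ +-cong (*-congʳ (*-congʳ κij)) (-‿cong (+-cong (*-congʳ (*-congʳ κji)) (-‿cong (alt-cong-pick l term)))) ⟩
    (0# * ∏ (κ i) l) * f (j ∷ l) - ((0# * ∏ (κ j) l) * f (i ∷ l) - alt (λ z zs → ρ x l * (∏ (κ z) zs * f zs)) l)
      ≈⟨ solve 5 (λ a b c d s → (:0 :* a) :* b :- ((:0 :* c) :* d :- s) := s) refl _ _ _ _ _ ⟩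
    alt (λ z zs → ρ x l * (∏ (κ z) zs * f zs)) l ≈⟨ alt-* _ _ l ⟩
    ρ x l * D f l ∎
    where
    i = inv x
    j = fin x
    κij : κ i j ≈ 0#
    κij = solve 2 (λ x t → (t :* (:1 :* :1) :- x :* x) :* (x :* :1 :- :1 :* x) := :0) refl x t
    κji : κ j i ≈ 0#
    κji = solve 2 (λ x t → (t :* (x :* x) :- :1 :* :1) :* (:1 :* x :- x :* :1) := :0) refl x t
    κκ : ∀ z → κ z i * κ z j ≈ k (just i) (just z) * k (just j) (just z)
    κκ (p , q) = solve 4 (λ p q x t →
      ((t :* (p :* x) :- :1 :* q) :* (q :* x :- p :* :1)) :* ((t :* (p :* :1) :- x :* q) :* (q :* :1 :- p :* x))
      := ((x :* q :- :1 :* p) :* (x :* q :- t :* (:1 :* p))) :* ((:1 :* q :- x :* p) :* (:1 :* q :- t :* (x :* p)))) refl p q x t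
    term : ∀ {z zs} → Pick z l zs → (κ z i * (κ z j * ∏ (κ z) zs)) * f (i ∷ j ∷ zs) ≈ ρ x l * (∏ (κ z) zs * f zs)
    term {z} {zs} p = begin
      (κ z i * (κ z j * ∏ (κ z) zs)) * f (i ∷ j ∷ zs) ≈⟨ *-congˡ (h x zs) ⟩
      (κ z i * (κ z j * ∏ (κ z) zs)) * ((E * (A * B)) * f zs)
        ≈⟨ solve 7 (λ u v w e a b y → (u :* (v :* w)) :* ((e :* (a :* b)) :* y) := (u :* v) :* ((e :* (a :* b)) :* (w :* y))) refl _ _ _ _ _ _ _ ⟩
      (κ z i * κ z j) * ((E * (A * B)) * (∏ (κ z) zs * f zs)) ≈⟨ *-congʳ (κκ z) ⟩
      (k (just i) (just z) * k (just j) (just z)) * ((E * (A * B)) * (∏ (κ z) zs * f zs))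
        ≈⟨ solve 6 (λ u v e a b y → (u :* v) :* ((e :* (a :* b)) :* y) := (e :* ((u :* a) :* (v :* b))) :* y) refl _ _ _ _ _ _ ⟩
      (E * ((k (just i) (just z) * A) * (k (just j) (just z) * B))) * (∏ (κ z) zs * f zs)
        ≈⟨ *-congʳ (*-congˡ (*-cong (∏-pick _ p) (∏-pick _ p))) ⟨
      ρ x l * (∏ (κ z) zs * f zs) ∎
      where
      E = (1# - x * x) * (1# - t) * x
      A = ∏ (λ z → k (just i) (just z)) zs
      B = ∏ (λ z → k (just j) (just z)) zs

  D^-residual : ∀ r {f} → Residual f → Residual (D^ r f)
  D^-residual zero h = h
  D^-residual (suc r) {f} h x l = trans (*-congˡ (D-residual {D^ r f} (D^-residual r h) x l))
    (solve 3 (λ a b c → a :* (b :* c) := b :* (a :* c)) refl _ _ _)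

  -- Two variables more do not change the parity, hence not `g`; the two additional terms of the sum
  -- vanish by `D^-vanish`.
  S-residual : ∀ w → Residual (S w)
  S-residual w x l rewrite even?-suc² (length l) = begin
    Σ≤ (suc (suc n)) (λ r → g (even? n) r w * D^ r W (inv x ∷ fin x ∷ l))
      ≈⟨ Σ≤-cong (suc (suc n)) (λ r _ → trans (*-congˡ (D^-residual r {W} W-residual x l))
            (solve 3 (λ a b c → a :* (b :* c) := b :* (a :* c)) refl (g (even? n) r w) (ρ x l) (D^ r W l))) ⟩
    Σ≤ (suc (suc n)) (λ r → ρ x l * (g (even? n) r w * D^ r W l)) ≈⟨ Σ≤-* (ρ x l) (suc (suc n)) s ⟩
    ρ x l * Σ≤ (suc (suc n)) s ≈⟨ *-congˡ (Σ≤-last (suc n) s (van (suc (suc n)) (ℕP.m<n⇒m<1+n (ℕP.n<1+n n)))) ⟩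
    ρ x l * Σ≤ (suc n) s ≈⟨ *-congˡ (Σ≤-last n s (van (suc n) (ℕP.n<1+n n))) ⟩
    ρ x l * Σ≤ n s ∎
    where
    n = length l
    s : ℕ → Carrier
    s r = g (even? n) r w * D^ r W l
    van : ∀ r → n ℕ.< r → s r ≈ 0#
    van r p = trans (*-congˡ (D^-vanish r W l p)) (zeroʳ _)

  -- The degree in a further point placed in front: each finite partner contributes 2 and the
  -- padding index 0.
  degree : List (Maybe Pt) → ℕ
  degree [] = 0
  degree (nothing ∷ l) = degree l
  degree (just _ ∷ l) = suc (suc (degree l))

  degree-just : ∀ l → degree (map just l) ≡ dbl (length l)
  degree-just [] = ≡.refl
  degree-just (x ∷ l) = ≡.cong (λ n → suc (suc n)) (degree-just l)

  degree-pick : ∀ {y l l'} → Pick y l l' → degree l ≡ degree (y ∷ []) ℕ.+ degree l'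
  degree-pick {nothing} here = ≡.refl
  degree-pick {just _} here = ≡.refl
  degree-pick (there {nothing} p) = degree-pick p
  degree-pick {nothing} (there {just _} p) = ≡.cong (λ n → suc (suc n)) (degree-pick p)
  degree-pick {just _} (there {just _} p) = ≡.cong (λ n → suc (suc n)) (degree-pick p)

  two-lin : ∀ {F} p q p' q' → (∀ a b → (p * a + q * b) * ((p' * a + q' * b) * 1#) ≈ F a b) → Form 2 F
  two-lin p q p' q' eq = ext eq (lin p q (lin p' q' (con₀ 1#)))

  k-form : ∀ y → Form (degree (y ∷ [])) (λ a b → k (just (a , b)) y)
  k-form nothing = con₀ 1#
  k-form (just (a' , b')) = two-lin (- a') b' (- (t * a')) b' (λ a b →
    solve 5 (λ a b a' b' t → ((:- a') :* a :+ b' :* b) :* (((:- (t :* a')) :* a :+ b' :* b) :* :1)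
      := (b :* b' :- a :* a') :* (b :* b' :- t :* (a :* a'))) refl _ _ _ _ _)

  e-form : ∀ w y → Form (degree (y ∷ [])) (λ a b → e w (just (a , b)) y)
  e-form w nothing = con₀ (- 1#)
  e-form w (just (a' , b')) = two-lin b' (- a') ((w - t) * a') ((1# - w) * b') (λ a b →
    solve 6 (λ a b a' b' w t → (b' :* a :+ (:- a') :* b) :* ((((w :- t) :* a') :* a :+ ((:1 :- w) :* b') :* b) :* :1)
      := (a :* b' :- a' :* b) :* ((:1 :- w) :* (b :* b') :+ (w :- t) :* (a :* a'))) refl _ _ _ _ _ _)

  κ-formˡ : ∀ y → Form 2 (λ a b → κ (a , b) y)
  κ-formˡ (a' , b') = two-lin (t * b') (- a') (- a') b' (λ a b →
    solve 5 (λ a b a' b' t → ((t :* b') :* a :+ (:- a') :* b) :* (((:- a') :* a :+ b' :* b) :* :1)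
      := (t :* (a :* b') :- a' :* b) :* (b :* b' :- a :* a')) refl _ _ _ _ _)

  κ-formʳ : ∀ y → Form 2 (λ a b → κ y (a , b))
  κ-formʳ (a' , b') = two-lin (- b') (t * a') (- a') b' (λ a b →
    solve 5 (λ a b a' b' t → ((:- b') :* a :+ (t :* a') :* b) :* (((:- a') :* a :+ b' :* b) :* :1)
      := (t :* (a' :* b) :- a :* b') :* (b' :* b :- a' :* a)) refl _ _ _ _ _)

  ∏k-form : ∀ l → Form (degree l) (λ a b → ∏ (k (just (a , b))) l)
  ∏k-form [] = con₀ 1#
  ∏k-form (nothing ∷ l) = form-mul (k-form nothing) (∏k-form l)
  ∏k-form (just y ∷ l) = form-mul (k-form (just y)) (∏k-form l)

  ∏κ-form : ∀ l → Form (dbl (length l)) (λ a b → ∏ (κ (a , b)) l)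
  ∏κ-form [] = con₀ 1#
  ∏κ-form (y ∷ l) = form-mul (κ-formˡ y) (∏κ-form l)

  -- In every matching the moving point meets each other point once, through `e` or through `k`, and
  -- both have the same degree in it.
  Q-form : ∀ w n l → Form (degree l) (λ a b → Q w n (just (a , b) ∷ l))
  Q-form w zero l = nul
  Q-form w (suc n) l = form-alt l (λ {y} {ys} p → ≡.subst (λ d → Form d _) (≡.sym (degree-pick p))
    (ext (λ a b → solve 4 (λ x z q u → x :* ((z :* q) :* u) := x :* (u :* z) :* q) refl _ _ _ _)
      (form-mul (e-form w y) (ext (λ a b → *-comm _ _)
        (form-mul (∏k-form ys) (con₀ (∏ (k y) ys * Q w n ys)) ⟪ ys)))))
    where
    _⟪_ : ∀ {F} {d} → Form (d ℕ.+ 0) F → (ys : List (Maybe Pt)) → Form d F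
    _⟪_ {F} {d} f _ = ≡.subst (λ d → Form d F) (ℕP.+-identityʳ d) f

  G-form : ∀ w l → Form (dbl (length l)) (λ a b → G w ((a , b) ∷ l))
  G-form w l = ≡.subst (λ d → Form d (λ a b → G w ((a , b) ∷ l))) (degree-just l) G'-form
    where
    G'-form : Form (degree (map just l)) (λ a b → G' (halve (suc (length l))) w ((a , b) ∷ l))
    G'-form with halve (suc (length l))
    ... | true , n = Q-form w n (map just l)
    ... | false , n = ext (λ a b → sym (Q-antisym w (suc n) (here {x = nothing} {y = just (a , b)} {l = map just l}))) (form-neg (Q-form w (suc n) (nothing ∷ map just l)))

  W-form : ∀ l → Form (dbl (length l)) (λ a b → W ((a , b) ∷ l))
  W-form l = ≡.subst (λ d → Form d (λ a b → W ((a , b) ∷ l))) (degree-just l) W'-form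
    where
    W'-form : Form (degree (map just l)) (λ a b → W' (halve (suc (length l))) ((a , b) ∷ l))
    W'-form with halve (suc (length l))
    ... | true , n = Q-form 1# n (map just l)
    ... | false , n = nul

  D-form : ∀ {f} → (∀ l → Form (dbl (length l)) (λ a b → f ((a , b) ∷ l))) → ∀ l → Form (dbl (length l)) (λ a b → D f ((a , b) ∷ l))
  D-form {f} h l = form-sub (ext (λ a b → *-comm _ _) (scl (f l) (∏κ-form l)))
    (form-alt l (λ {y} {ys} p → ≡.subst (λ d → Form d (λ a b → (κ y (a , b) * ∏ (κ y) ys) * f ((a , b) ∷ ys)))
      (≡.sym (≡.cong dbl (pick-length p)))
      (form-mul (ext (λ a b → *-comm _ _) (scl (∏ (κ y) ys) (κ-formʳ y))) (h ys))))

  D^-form : ∀ r {f} → (∀ l → Form (dbl (length l)) (λ a b → f ((a , b) ∷ l))) → ∀ l → Form (dbl (length l)) (λ a b → D^ r f ((a , b) ∷ l))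
  D^-form zero h = h
  D^-form (suc r) {f} h l = scl (ι r) (D-form {D^ r f} (D^-form r {f} h) l)

  form-Σ : ∀ {d} n {F : ℕ → Carrier → Carrier → Carrier} → (∀ r → Form d (F r)) → Form d (λ a b → Σ≤ n (λ r → F r a b))
  form-Σ zero h = h 0
  form-Σ (suc n) h = add (h 0) (form-Σ n (λ r → h (suc r)))

  S-form : ∀ w l → Form (dbl (length l)) (λ a b → S w ((a , b) ∷ l))
  S-form w l = form-Σ (suc (length l)) (λ r → scl (g (even? (suc (length l))) r w) (D^-form r {W} W-form l))

  -- At affine points and infinity the weights k p (−) of p = 0 and p = ∞ are 1, as the Schur complement requires.
  eR kR : Carrier → Carrier → Carrier → Carrier
  eR w x y = (x - y) * ((1# - w) + (w - t) * (x * y))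
  kR _ x y = (1# - x * y) * (1# - t * (x * y))

  eA : Carrier → Maybe Carrier → Maybe Carrier → Carrier
  eA w nothing nothing = 0#
  eA w nothing (just _) = 1#
  eA w (just _) nothing = - 1#
  eA w (just x) (just y) = eR w x y

  kA : Maybe Carrier → Maybe Carrier → Carrier
  kA nothing _ = 1#
  kA (just _) nothing = 1#
  kA (just x) (just y) = kR 0# x y

  private
    module PfA (w : Carrier) = Pfaffian (eA w) kA
    module PfR (w : Carrier) = Pfaffian (eR w) (kR w)
    open PfA using () renaming (Q to QA)
    open PfR using () renaming (Q to QR)

  ∏1 : ∀ {a} {X : Set a} (l : List X) → ∏ (λ _ → 1#) l ≈ 1#
  ∏1 = ∏-one (λ _ → refl)

  Q-affine : ∀ w n l → Q w n (map (Maybe.map fin) l) ≈ QA w n l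
  Q-affine w n l = trans (Q-scale (e w) k (eA w) kA (Maybe.map fin) (λ _ → 1#) he hk n l) (trans (*-congʳ (∏1 l)) (*-identityˡ _))
    where
    he : ∀ x y → e w (Maybe.map fin x) (Maybe.map fin y) ≈ 1# * 1# * eA w x y
    he nothing nothing = solve 0 (:0 := :1 :* :1 :* :0) refl
    he nothing (just _) = solve 0 (:1 := :1 :* :1 :* :1) refl
    he (just _) nothing = solve 0 (:- :1 := :1 :* :1 :* (:- :1)) refl
    he (just x) (just y) = solve 4 (λ x y w t → (x :* :1 :- y :* :1) :* ((:1 :- w) :* (:1 :* :1) :+ (w :- t) :* (x :* y))
      := :1 :* :1 :* ((x :- y) :* ((:1 :- w) :+ (w :- t) :* (x :* y)))) refl x y w t
    hk : ∀ x y → k (Maybe.map fin x) (Maybe.map fin y) ≈ kA x y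
    hk nothing _ = refl
    hk (just _) nothing = refl
    hk (just x) (just y) = solve 3 (λ x y t → (:1 :* :1 :- x :* y) :* (:1 :* :1 :- t :* (x :* y))
      := (:1 :- x :* y) :* (:1 :- t :* (x :* y))) refl x y t

  fin-just : ∀ xs → map just (map fin xs) ≡ map (Maybe.map fin) (map just xs)
  fin-just [] = ≡.refl
  fin-just (x ∷ xs) = ≡.cong (just (fin x) ∷_) (fin-just xs)

  QA-just : ∀ w n xs → QA w n (map just xs) ≈ QR w n xs
  QA-just w n xs = trans (Q-scale (eA w) kA (eR w) (kR w) just (λ _ → 1#)
    (λ x y → solve 1 (λ z → z := :1 :* :1 :* z) refl _) (λ _ _ → refl) n xs) (trans (*-congʳ (∏1 xs)) (*-identityˡ _))

  Q-fin : ∀ w n xs → Q w n (map just (map fin xs)) ≈ QR w n xs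
  Q-fin w n xs = trans (reflexive (≡.cong (Q w n) (fin-just xs))) (trans (Q-affine w n _) (QA-just w n xs))

  ∏id ∏neg : List Carrier → Carrier
  ∏id = ∏ (λ x → x)
  ∏neg = ∏ (λ x → - x)

  private
    eA-anti : ∀ w x y → eA w x y ≈ - eA w y x
    eA-anti w nothing nothing = sym -0#≈0#
    eA-anti w nothing (just _) = sym (-‿involutive 1#)
    eA-anti w (just _) nothing = refl
    eA-anti w (just x) (just y) = solve 4 (λ x y w t → (x :- y) :* ((:1 :- w) :+ (w :- t) :* (x :* y))
      := :- ((y :- x) :* ((:1 :- w) :+ (w :- t) :* (y :* x)))) refl x y w t

    kA-sym : ∀ x y → kA x y ≈ kA y x
    kA-sym nothing nothing = refl
    kA-sym nothing (just _) = refl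
    kA-sym (just _) nothing = refl
    kA-sym (just x) (just y) = *-cong (+-congˡ (-‿cong (*-comm x y))) (+-congˡ (-‿cong (*-congˡ (*-comm x y))))

    k0 : ∀ z → kA (just 0#) z ≈ 1#
    k0 nothing = refl
    k0 (just z) = solve 2 (λ z t → (:1 :- :0 :* z) :* (:1 :- t :* (:0 :* z)) := :1) refl z t

  -- e_w = x y e_{t w} + (1 − w) (x − y) k, so e_{t w} is, up to scaling, the Schur complement of (∞ , 0).
  QA-border : ∀ w n xs → QA w (suc n) (nothing ∷ just 0# ∷ map just xs) ≈ ∏id xs * QA (t * w) n (map just xs)
  QA-border w n xs = begin
    QA w (suc n) (nothing ∷ just 0# ∷ map just xs)
      ≈⟨ Q-schur tors (eA w) kA (eA-anti w) kA-sym nothing (just 0#) refl (λ _ → refl) k0 n (map just xs) ⟩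
    Pfaffian.Q sch kA n (map just xs)
      ≈⟨ Q-scale sch kA (eR (t * w)) (kR (t * w)) just (λ x → x) (λ x y → solve 4 (λ x y w t →
           (x :- y) :* ((:1 :- w) :+ (w :- t) :* (x :* y))
             :- (:1 :* ((:0 :- y) :* ((:1 :- w) :+ (w :- t) :* (:0 :* y))) :- ((:0 :- x) :* ((:1 :- w) :+ (w :- t) :* (:0 :* x))) :* :1)
                :* ((:1 :- x :* y) :* (:1 :- t :* (x :* y)))
           := x :* y :* ((x :- y) :* ((:1 :- t :* w) :+ (t :* w :- t) :* (x :* y)))) refl x y w t) (λ _ _ → refl) n xs ⟩
    ∏id xs * QR (t * w) n xs ≈⟨ *-congˡ (QA-just (t * w) n xs) ⟨
    ∏id xs * QA (t * w) n (map just xs) ∎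
    where sch = schur tors (eA w) kA (eA-anti w) kA-sym nothing (just 0#) refl (λ _ → refl) k0

  -- `border-β` restores the missing index ∞ at the cost of a sum over y with weight e_w(0, y) = -(1
  -- - w) y. By `QA-border` the summands are those of the first-row expansion of the Pfaffian for t
  -- w padded by ∞.
  QA-zero : ∀ w n xs → QA w (suc n) (just 0# ∷ map just xs) ≈ - ((1# - w) * ∏id xs) * QA (t * w) (suc n) (nothing ∷ map just xs)
  QA-zero w n xs = begin
    QA w (suc n) (just 0# ∷ map just xs)
      ≈⟨ border-β tors (eA w) kA (eA-anti w) kA-sym nothing (just 0#) refl (λ _ → refl) k0 (suc n) (map just xs) ⟨
    alt (λ y ys → eA w (just 0#) y * ∏ (kA y) ys * QA w (suc n) (nothing ∷ just 0# ∷ ys)) (map just xs)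
      ≈⟨ reflexive (alt-map just _ xs) ⟩
    alt (λ y ys → eR w 0# y * ∏ (kA (just y)) (map just ys) * QA w (suc n) (nothing ∷ just 0# ∷ map just ys)) xs
      ≈⟨ alt-cong-pick xs (λ {y} {ys} p → begin
           eR w 0# y * ∏ (kA (just y)) (map just ys) * QA w (suc n) (nothing ∷ just 0# ∷ map just ys)
             ≈⟨ *-congˡ (QA-border w n ys) ⟩
           eR w 0# y * ∏ (kA (just y)) (map just ys) * (∏id ys * QA (t * w) n (map just ys))
             ≈⟨ solve 6 (λ y w t a b q → (:0 :- y) :* ((:1 :- w) :+ (w :- t) :* (:0 :* y)) :* a :* (b :* q)
                  := (:- ((:1 :- w) :* (y :* b))) :* (:1 :* (:1 :* a) :* q)) refl y w t _ _ _ ⟩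
           (- ((1# - w) * (y * ∏id ys))) * (1# * (1# * ∏ (kA (just y)) (map just ys)) * QA (t * w) n (map just ys))
             ≈⟨ *-cong (-‿cong (*-congˡ (sym (∏-pick _ p)))) (*-congʳ (*-congˡ (*-congʳ (sym (∏-one (λ _ → refl) (map just ys)))))) ⟩
           (- ((1# - w) * ∏id xs)) * (1# * (∏ (kA nothing) (map just ys) * ∏ (kA (just y)) (map just ys)) * QA (t * w) n (map just ys)) ∎) ⟩
    alt (λ y ys → (- ((1# - w) * ∏id xs)) * (1# * (∏ (kA nothing) (map just ys) * ∏ (kA (just y)) (map just ys)) * QA (t * w) n (map just ys))) xs
      ≈⟨ alt-* _ _ xs ⟩
    (- ((1# - w) * ∏id xs)) * alt (λ y ys → 1# * (∏ (kA nothing) (map just ys) * ∏ (kA (just y)) (map just ys)) * QA (t * w) n (map just ys)) xs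
      ≈⟨ *-congˡ (reflexive (alt-map just _ xs)) ⟨
    (- ((1# - w) * ∏id xs)) * QA (t * w) (suc n) (nothing ∷ map just xs) ∎

  sgn : Bool → Carrier → Carrier
  sgn true z = z
  sgn false z = - z

  ∏id-sgn : ∀ xs → ∏id xs ≈ sgn (even? (length xs)) (∏neg xs)
  ∏id-sgn [] = refl
  ∏id-sgn (x ∷ xs) = trans (*-congˡ (∏id-sgn xs)) (step (halve (length xs)) ≡.refl)
    where
    step : ∀ p → p ≡ halve (length xs) → x * sgn (proj₁ (halve (length xs))) (∏neg xs) ≈ sgn (even? (suc (length xs))) (- x * ∏neg xs)
    step (true , n) eq rewrite even?-suc (length xs) | ≡.sym eq = solve 2 (λ x y → x :* y := :- (:- x :* y)) refl _ _
    step (false , n) eq rewrite even?-suc (length xs) | ≡.sym eq = solve 2 (λ x y → x :* (:- y) := :- x :* y) refl _ _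

  -- An odd list is padded, and padding index and 0 together are the border of a Schur complement
  -- (`QA-border`). In an even list 0 stands alone, and completing the border costs 1 - w
  -- (`QA-zero`).
  G-zero : ∀ w xs → G w (fin 0# ∷ map fin xs) ≈ ε (even? (suc (length xs))) w * ∏neg xs * G (t * w) (map fin xs)
  G-zero w xs with ∏id-sgn xs
  ... | s rewrite length-map fin xs with halve (length xs)
  ... | true , n = begin
    Q w (suc n) (nothing ∷ just (fin 0#) ∷ map just (map fin xs)) ≈⟨ reflexive (≡.cong (λ l → Q w (suc n) (nothing ∷ just (fin 0#) ∷ l)) (fin-just xs)) ⟩
    Q w (suc n) (map (Maybe.map fin) (nothing ∷ just 0# ∷ map just xs)) ≈⟨ Q-affine w (suc n) (nothing ∷ just 0# ∷ map just xs) ⟩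
    QA w (suc n) (nothing ∷ just 0# ∷ map just xs) ≈⟨ QA-border w n xs ⟩
    ∏id xs * QA (t * w) n (map just xs) ≈⟨ *-cong (trans s (sym (*-identityˡ _))) (trans (QA-just (t * w) n xs) (sym (Q-fin (t * w) n xs))) ⟩
    1# * ∏neg xs * Q (t * w) n (map just (map fin xs)) ∎
  ... | false , n = begin
    Q w (suc n) (just (fin 0#) ∷ map just (map fin xs)) ≈⟨ reflexive (≡.cong (λ l → Q w (suc n) (just (fin 0#) ∷ l)) (fin-just xs)) ⟩
    Q w (suc n) (map (Maybe.map fin) (just 0# ∷ map just xs)) ≈⟨ Q-affine w (suc n) (just 0# ∷ map just xs) ⟩
    QA w (suc n) (just 0# ∷ map just xs) ≈⟨ QA-zero w n xs ⟩
    - ((1# - w) * ∏id xs) * QA (t * w) (suc n) (nothing ∷ map just xs)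
      ≈⟨ *-cong (trans (-‿cong (*-congˡ s)) (solve 2 (λ a b → :- (a :* (:- b)) := a :* b) refl _ _))
           (trans (sym (Q-affine (t * w) (suc n) (nothing ∷ map just xs))) (reflexive (≡.cong (λ l → Q (t * w) (suc n) (nothing ∷ l)) (≡.sym (fin-just xs))))) ⟩
    (1# - w) * ∏neg xs * Q (t * w) (suc n) (nothing ∷ map just (map fin xs)) ∎

  -- On even lists W is `G 1#`, where the factor 1 - w of `G-zero` vanishes; on odd lists it is zero
  -- by definition.
  W-zero : ∀ xs → W (fin 0# ∷ map fin xs) ≈ 0#
  W-zero xs with G-zero 1# xs
  ... | h rewrite length-map fin xs with halve (suc (length xs))
  ... | true , n = trans h (solve 2 (λ a b → (:1 :- :1) :* a :* b := :0) refl _ _)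
  ... | false , n = refl

  -- Picking 0 leaves the weights κ(0, z) = -z. Picking y instead gives κ(y, 0) = t y, which fills
  -- the gap in the product of the -z over the remaining variables.
  D-zero : ∀ f h q → (∀ xs → f (fin 0# ∷ map fin xs) ≈ q * (∏neg xs * h (map fin xs))) →
    ∀ xs → D f (fin 0# ∷ map fin xs) ≈ ∏neg xs * (f (map fin xs) + q * t * D h (map fin xs))
  D-zero f h q eq xs = begin
    ∏ (κ (fin 0#)) (map fin xs) * f (map fin xs) - alt (λ y ys → (κ y (fin 0#) * ∏ (κ y) ys) * f (fin 0# ∷ ys)) (map fin xs)
      ≈⟨ +-cong (*-congʳ (trans (reflexive (∏-map _ fin xs)) (∏-cong (λ z →
            solve 2 (λ z t → (t :* (:0 :* :1) :- z :* :1) :* (:1 :* :1 :- :0 :* z) := :- z) refl z t) xs)))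
          (-‿cong (trans (reflexive (alt-map fin _ xs)) (alt-cong-pick xs term))) ⟩
    ∏neg xs * f (map fin xs) - alt (λ y ys → - (∏neg xs * (q * t)) * (∏ (κ (fin y)) (map fin ys) * h (map fin ys))) xs
      ≈⟨ +-congˡ (-‿cong (trans (alt-* _ _ xs) (*-congˡ (reflexive (≡.sym (alt-map fin _ xs)))))) ⟩
    ∏neg xs * f (map fin xs) - (- (∏neg xs * (q * t))) * D h (map fin xs)
      ≈⟨ solve 4 (λ m f u d → m :* f :- (:- (m :* u)) :* d := m :* (f :+ u :* d)) refl _ _ _ _ ⟩
    ∏neg xs * (f (map fin xs) + q * t * D h (map fin xs)) ∎
    where
    term : ∀ {y ys} → Pick y xs ys → (κ (fin y) (fin 0#) * ∏ (κ (fin y)) (map fin ys)) * f (fin 0# ∷ map fin ys)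
      ≈ - (∏neg xs * (q * t)) * (∏ (κ (fin y)) (map fin ys) * h (map fin ys))
    term {y} {ys} p = begin
      (κ (fin y) (fin 0#) * ∏ (κ (fin y)) (map fin ys)) * f (fin 0# ∷ map fin ys) ≈⟨ *-congˡ (eq ys) ⟩
      (κ (fin y) (fin 0#) * ∏ (κ (fin y)) (map fin ys)) * (q * (∏neg ys * h (map fin ys)))
        ≈⟨ solve 6 (λ y t q a m h → (((t :* (y :* :1) :- :0 :* :1) :* (:1 :* :1 :- y :* :0)) :* a) :* (q :* (m :* h))
             := :- (((:- y) :* m) :* (q :* t)) :* (a :* h)) refl y t q _ _ _ ⟩
      - ((- y * ∏neg ys) * (q * t)) * (∏ (κ (fin y)) (map fin ys) * h (map fin ys)) ≈⟨ *-congʳ (-‿cong (*-congʳ (∏-pick _ p))) ⟨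
      - (∏neg xs * (q * t)) * (∏ (κ (fin y)) (map fin ys) * h (map fin ys)) ∎

  -- By `D-zero` and induction the divided power D^(r) occurs once directly and once as t D D^(r-1)
  -- = t [r]_t D^(r). Together these give 1 + t [r]_t = [r+1]_t, which the new factor ι cancels.
  D^-zero : ∀ r xs → D^ (suc r) W (fin 0# ∷ map fin xs) ≈ ∏neg xs * D^ r W (map fin xs)
  D^-zero zero xs = begin
    -- Since W vanishes at 0, `D-zero` applies with q = 0, and the choice of its second function is
    -- immaterial.
    ι 0 * D W (fin 0# ∷ map fin xs) ≈⟨ *-congˡ (D-zero W W 0# (λ ys → trans (W-zero ys) (sym (zeroˡ _))) xs) ⟩
    ι 0 * (∏neg xs * (W (map fin xs) + 0# * t * D W (map fin xs)))
      ≈⟨ solve 5 (λ i m w t d → i :* (m :* (w :+ :0 :* t :* d)) := (i :* (:1 :+ t :* :0)) :* (m :* w)) refl _ _ _ _ _ ⟩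
    (ι 0 * (1# + t * 0#)) * (∏neg xs * W (map fin xs)) ≈⟨ *-congʳ (ι-inv 0) ⟩
    1# * (∏neg xs * W (map fin xs)) ≈⟨ *-identityˡ _ ⟩
    ∏neg xs * W (map fin xs) ∎
  D^-zero (suc r) xs = begin
    ι (suc r) * D (D^ (suc r) W) (fin 0# ∷ map fin xs)
      ≈⟨ *-congˡ (D-zero (D^ (suc r) W) (D^ r W) 1# (λ ys → trans (D^-zero r ys) (sym (*-identityˡ _))) xs) ⟩
    ι (suc r) * (∏neg xs * (D^ (suc r) W (map fin xs) + 1# * t * D (D^ r W) (map fin xs)))
      ≈⟨ *-congˡ (*-congˡ (+-congˡ (*-congˡ (trans (sym (*-identityˡ _)) (*-congʳ (sym (ι-inv r))))))) ⟩
    ι (suc r) * (∏neg xs * (ι r * D (D^ r W) (map fin xs) + 1# * t * ((ι r * qint t (suc r)) * D (D^ r W) (map fin xs))))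
      ≈⟨ solve 6 (λ j m i d t q → j :* (m :* (i :* d :+ :1 :* t :* ((i :* q) :* d))) := (j :* (:1 :+ t :* q)) :* (m :* (i :* d))) refl _ _ _ _ _ _ ⟩
    (ι (suc r) * (1# + t * qint t (suc r))) * (∏neg xs * D^ (suc r) W (map fin xs)) ≈⟨ *-congʳ (ι-inv (suc r)) ⟩
    1# * (∏neg xs * D^ (suc r) W (map fin xs)) ≈⟨ *-identityˡ _ ⟩
    ∏neg xs * D^ (suc r) W (map fin xs) ∎

  -- The term r = 0 vanishes with W and the others shift r by one. The first factor of `g` is the ε
  -- of `G-zero`; the remaining ones belong to t w and the opposite parity.
  S-zero : ∀ w xs → S w (fin 0# ∷ map fin xs) ≈ ε (even? (suc (length xs))) w * ∏neg xs * S (t * w) (map fin xs)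
  S-zero w xs = begin
    1# * W (fin 0# ∷ A) + Σ≤ (length A) (λ r → g b (suc r) w * D^ (suc r) W (fin 0# ∷ A))
      ≈⟨ +-cong (trans (*-congˡ (W-zero xs)) (zeroʳ _)) (Σ≤-cong (length A) (λ r _ → trans (*-congˡ (D^-zero r xs))
           (solve 4 (λ e g m d → (e :* g) :* (m :* d) := (e :* m) :* (g :* d)) refl (ε b w) (g (not b) r (t * w)) (∏neg xs) (D^ r W A)))) ⟩
    0# + Σ≤ (length A) (λ r → (ε b w * ∏neg xs) * (g (not b) r (t * w) * D^ r W A)) ≈⟨ trans (+-identityˡ _) (Σ≤-* _ (length A) _) ⟩
    (ε b w * ∏neg xs) * Σ≤ (length A) (λ r → g (not b) r (t * w) * D^ r W A)
      ≈⟨ reflexive (≡.cong₂ (λ b b' → (ε b w * ∏neg xs) * Σ≤ (length A) (λ r → g b' r (t * w) * D^ r W A))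
           (≡.cong (λ n → even? (suc n)) (length-map fin xs))
           (≡.trans (≡.cong not (even?-suc (length A))) (not-involutive _))) ⟩
    (ε (even? (suc (length xs))) w * ∏neg xs) * S (t * w) A ∎
    where
    A = map fin xs
    b = even? (suc (length A))

  -- These are, up to sign, the determinants between the nodes 0, x and 1/x; `Generic₂` supplies
  -- those between the nodes of two variables. Regularity of x is also that of the second coordinate
  -- of 1/x.
  record Generic₁ (x : Carrier) : Set (c Level.⊔ ℓ) where
    field
      reg   : Reg x
      reg²  : Reg (x * x - 1#)

  record Generic₂ (x y : Carrier) : Set (c Level.⊔ ℓ) where
    field
      reg-sub : Reg (x - y)
      reg-mul : Reg (x * y - 1#)

  record Generic (xs : List Carrier) : Set (c Level.⊔ ℓ) where
    constructor generic
    field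
      single : All Generic₁ xs
      pairs  : AllPairs Generic₂ xs

  all-pick : ∀ {p} {P : Carrier → Set p} {y l l'} → Pick y l l' → All P l → All P l'
  all-pick here (p ∷ ps) = ps
  all-pick (there k) (p ∷ ps) = p ∷ all-pick k ps

  pairs-pick : ∀ {y l l'} → Pick y l l' → AllPairs Generic₂ l → AllPairs Generic₂ l'
  pairs-pick here (p ∷ ps) = ps
  pairs-pick (there k) (p ∷ ps) = all-pick k p ∷ pairs-pick k ps

  generic-pick : ∀ {y l l'} → Pick y l l' → Generic l → Generic l'
  generic-pick k (generic s p) = generic (all-pick k s) (pairs-pick k p)

  nodes : List Carrier → List Pt
  nodes [] = []
  nodes (x ∷ xs) = fin x ∷ inv x ∷ nodes xs

  private
    node-all : ∀ {p} {P : Pt → Set p} {xs} → All (λ x → P (fin x) × P (inv x)) xs → All P (nodes xs)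
    node-all [] = []
    node-all ((p , q) ∷ ps) = p ∷ q ∷ node-all ps

  nodes-regular : ∀ {xs} → Generic xs → AllPairs (λ p q → Reg (det q p)) (fin 0# ∷ nodes xs)
  nodes-regular {xs} (generic s p) = node-all (All.map (λ {x} h →
       reg-resp (solve 1 (λ x → x := x :* :1 :- :0 :* :1) refl x) (Generic₁.reg h) ,
       reg-resp (solve 1 (λ x → :1 := :1 :* :1 :- :0 :* x) refl x) reg-1) s) ∷ go s p
    where
    go : ∀ {xs} → All Generic₁ xs → AllPairs Generic₂ xs → AllPairs (λ p q → Reg (det q p)) (nodes xs)
    go [] [] = []
    go {x ∷ xs} (s ∷ ss) (p ∷ ps) =
      (reg-resp (solve 1 (λ x → :- (x :* x :- :1) := :1 :* :1 :- x :* x) refl x) (reg-neg (Generic₁.reg² s)) ∷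
       node-all (All.map (λ {y} h →
         reg-resp (solve 2 (λ x y → :- (x :- y) := y :* :1 :- x :* :1) refl x y) (reg-neg (Generic₂.reg-sub h)) ,
         reg-resp (solve 2 (λ x y → :- (x :* y :- :1) := :1 :* :1 :- x :* y) refl x y) (reg-neg (Generic₂.reg-mul h))) p)) ∷
      node-all (All.map (λ {y} h →
         reg-resp (solve 2 (λ x y → x :* y :- :1 := y :* x :- :1 :* :1) refl x y) (Generic₂.reg-mul h) ,
         reg-resp (solve 2 (λ x y → x :- y := :1 :* x :- :1 :* y) refl x y) (Generic₂.reg-sub h)) p) ∷
      go ss ps

  nodes-length : ∀ xs → length (nodes xs) ≡ dbl (length xs)
  nodes-length [] = ≡.refl
  nodes-length (x ∷ xs) = ≡.cong (λ n → suc (suc n)) (nodes-length xs)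

  private
    sub0 : ∀ {x y} → x ≈ y → x - y ≈ 0#
    sub0 {x} {y} eq = trans (+-congʳ eq) (-‿inverseʳ y)

    unsub0 : ∀ {x y} → x - y ≈ 0# → x ≈ y
    unsub0 {x} {y} eq = trans (solve 2 (λ x y → x := (x :- y) :+ y) refl x y) (trans (+-congʳ eq) (+-identityˡ y))

  -- A bound n on the length carries the induction, because the node 0 drops one variable and the
  -- nodes 1/y drop two. The parameter w is quantified inside, because the node 0 calls for t w. The
  -- vanishing form is finally evaluated at the affine point of the head x.
  G≈S : ∀ n xs → length xs ℕ.≤ n → Generic xs → ∀ w → G w (map fin xs) ≈ S w (map fin xs)
  G≈S n [] _ _ w = sym (*-identityˡ 1#)
  G≈S (suc n) (x ∷ xs) (ℕ.s≤s len) (generic (s₁ ∷ s) (p₁ ∷ p)) w = unsub0 (form-zero F-form (fin 0# ∷ nodes xs)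
      (≡.cong suc (≡.trans (nodes-length xs) (≡.cong dbl (≡.sym (length-map fin xs)))))
      (nodes-regular (generic s p)) (reg-1 ∷ node-all (All.map (λ h → reg-1 , Generic₁.reg h) s))
      (at-zero ∷ node-all (at-nodes (λ p → p))) x 1#)
    where
    F : List Pt → Carrier
    F l = G w l - S w l
    F-form : Form (dbl (length (map fin xs))) (λ a b → F ((a , b) ∷ map fin xs))
    F-form = form-sub (G-form w (map fin xs)) (S-form w (map fin xs))
    F-anti : Anti F
    F-anti sw = trans (+-cong (G-anti w sw) (-‿cong (S-anti w sw))) (solve 2 (λ a b → (:- a) :- (:- b) := :- (a :- b)) refl _ _)
    at-zero : F (fin 0# ∷ map fin xs) ≈ 0#
    at-zero = sub0 (trans (G-zero w xs) (trans (*-congˡ (G≈S n xs len (generic s p) (t * w))) (sym (S-zero w xs))))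
    pick-fin : ∀ {y l l'} → Pick y l l' → Pick (fin y) (map fin l) (map fin l')
    pick-fin here = here
    pick-fin (there k) = there (pick-fin k)
    at-node : ∀ {y ys} → Pick y xs ys → F (fin y ∷ map fin xs) ≈ 0# × F (inv y ∷ map fin xs) ≈ 0#
    at-node {y} {ys} k = anti-pick-0 F F-anti (pick-fin k) (tors _ (F-anti (here {x = fin y} {y = fin y} {l = map fin ys}))) ,
      anti-pick-0 F F-anti (pick-fin k) (sub0 (trans (G-residual w y (map fin ys)) (trans
        (*-congˡ (G≈S n ys (ℕP.≤-trans (ℕP.n≤1+n _) (≡.subst (ℕ._≤ n) (pick-length k) len)) (generic-pick k (generic s p)) w))
        (sym (S-residual w y (map fin ys))))))
    at-nodes : ∀ {zs} → (∀ {y} → (∃ λ ys → Pick y zs ys) → ∃ λ ys → Pick y xs ys) →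
      All (λ y → F (fin y ∷ map fin xs) ≈ 0# × F (inv y ∷ map fin xs) ≈ 0#) zs
    at-nodes {[]} h = []
    at-nodes {z ∷ zs} h = at-node (proj₂ (h (_ , here))) ∷ at-nodes (λ (ys , k) → h (_ , there k))

-- Filtrations by order, and sums over partitions by zero parts.

record Filtration {c ℓ} (R : CommutativeRing c ℓ) (o : Level.Level) : Set (c Level.⊔ ℓ Level.⊔ Level.suc o) where
  open RingKit R
  field
    Ord   : ℕ → Carrier → Set o
    resp  : ∀ {n x y} → x ≈ y → Ord n x → Ord n y
    ord-0 : ∀ {n} → Ord n 0#
    ord-+ : ∀ {n x y} → Ord n x → Ord n y → Ord n (x + y)
    ord-* : ∀ {n x} y → Ord n x → Ord n (y * x)
    ord-z : ∀ x → Ord 0 x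

  -- Elements that raise the order by one; in the application these are the variables x_i.
  Small : Carrier → Set _
  Small x = ∀ {n y} → Ord n y → Ord (suc n) (x * y)

  ord-neg : ∀ {n x} → Ord n x → Ord n (- x)
  ord-neg h = resp (solve 1 (λ x → (:- :1) :* x := :- x) refl _) (ord-* (- 1#) h)

even?-+ : ∀ m n → even? n ≡ true → even? (m ℕ.+ n) ≡ true → even? m ≡ true
even?-+ zero n _ _ = ≡.refl
even?-+ (suc zero) n p q with ≡.trans (≡.sym q) (≡.trans (even?-suc n) (≡.cong not p))
... | ()
even?-+ (suc (suc m)) n p q = ≡.trans (even?-suc² m) (even?-+ m n p (≡.trans (≡.sym (even?-suc² (m ℕ.+ n))) q))

-- The sum over partitions with at most n parts, all ≤ d, and even conjugate, by the number r of zero parts.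
sumT : ∀ {c ℓ} (R : CommutativeRing c ℓ) → ℕ → ℕ → (List ℕ → CommutativeRing.Carrier R) → CommutativeRing.Carrier R
sumT R zero n F = F (List.replicate n 0)
sumT R (suc d) n F = Σ≤ n (λ r → if even? (n ℕ.∸ r) then sumT R d (n ℕ.∸ r) (λ ν → F (map suc ν List.++ List.replicate r 0)) else 0#)
  where open RingKit R

-- Expansion of the identity into Hall-Littlewood numerators.

module Expansion {c ℓ} (R : CommutativeRing c ℓ) (tors : TorsionFree₂ R)
  (t : CommutativeRing.Carrier R) (ι : ℕ → CommutativeRing.Carrier R) (ι-inv : InvertsQIntegers R t ι) where

  open RingKit R
  open Alternants R
  open Bordered R
  open BinaryForms R
  open ClearedIdentity R tors t ι ι-inv

  pp : List Carrier → Carrier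
  pp = ∏₂ (λ x z → 1# - x * z)

  pp-pick : ∀ {y l l'} → Pick y l l' → pp l ≈ ∏ (λ z → 1# - y * z) l' * pp l'
  pp-pick = ∏₂-pick (λ x z → 1# - x * z) (λ x y → +-congˡ (-‿cong (*-comm x y)))

  DA : (Carrier → Carrier → Carrier) → ℕ → (List Carrier → Carrier) → List Carrier → Carrier
  DA K zero f l = f l
  DA K (suc r) f l = ι r * alt (λ y ys → ∏ (K y) ys * DA K r f ys) l

  K₁ K₀ : Carrier → Carrier → Carrier
  K₁ y z = κ (fin y) (fin z)
  K₀ y z = t * y - z

  D^-fin : ∀ r f xs → D^ r f (map fin xs) ≈ DA K₁ r (λ l → f (map fin l)) xs
  D^-fin zero f xs = refl
  D^-fin (suc r) f xs = *-congˡ (trans (reflexive (alt-map fin _ xs))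
    (alt-cong xs (λ y ys → *-cong (reflexive (∏-map _ fin ys)) (D^-fin r f ys))))

  -- After r picks only lists of one known length remain, so agreement on that length suffices; this
  -- is how the parity tests in `Wz` become conditions on r.
  DA-cong : ∀ K r {f h} xs → (∀ ys → r ℕ.+ length ys ≡ length xs → f ys ≈ h ys) → DA K r f xs ≈ DA K r h xs
  DA-cong K zero xs eq = eq xs ≡.refl
  DA-cong K (suc r) xs eq = *-congˡ (alt-cong-pick xs (λ p → *-congˡ (DA-cong K r _ (λ ys e →
    eq ys (≡.trans (≡.cong suc e) (≡.sym (pick-length p)))))))

  -- Taking y out of `pp` leaves the product of the 1 - y z, which is exactly the factor by which
  -- `K₁` exceeds `K₀`.
  DA-pp : ∀ r h xs → DA K₁ r (λ l → pp l * h l) xs ≈ pp xs * DA K₀ r h xs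
  DA-pp zero h xs = refl
  DA-pp (suc r) h xs = trans (*-congˡ (trans (alt-cong-pick xs (λ {y} {ys} p → begin
      ∏ (K₁ y) ys * DA K₁ r (λ l → pp l * h l) ys ≈⟨ *-cong (trans (∏-cong (K-split y) ys) (∏-* _ _ ys)) (DA-pp r h ys) ⟩
      (∏ (K₀ y) ys * ∏ (λ z → 1# - y * z) ys) * (pp ys * DA K₀ r h ys)
        ≈⟨ solve 4 (λ a b c d → (a :* b) :* (c :* d) := (b :* c) :* (a :* d)) refl _ _ _ _ ⟩
      (∏ (λ z → 1# - y * z) ys * pp ys) * (∏ (K₀ y) ys * DA K₀ r h ys) ≈⟨ *-congʳ (pp-pick p) ⟨
      pp xs * (∏ (K₀ y) ys * DA K₀ r h ys) ∎)) (alt-* _ _ xs)))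
    (solve 3 (λ a b c → a :* (b :* c) := b :* (a :* c)) refl _ _ _)
    where
    K-split : ∀ y z → K₁ y z ≈ K₀ y z * (1# - y * z)
    K-split y z = solve 3 (λ y z t → (t :* (y :* :1) :- z :* :1) :* (:1 :* :1 :- y :* z) := (t :* y :- z) :* (:1 :- y :* z)) refl y z t

  DA-- : ∀ K r f h xs → DA K r (λ l → f l - h l) xs ≈ DA K r f xs - DA K r h xs
  DA-- K zero f h xs = refl
  DA-- K (suc r) f h xs = trans (*-congˡ (trans (alt-cong xs (λ y ys → trans (*-congˡ (DA-- K r f h ys))
      (solve 3 (λ a b c → a :* (b :- c) := a :* b :- a :* c) refl _ _ _))) (alt-- _ _ xs)))
    (solve 3 (λ a b c → a :* (b :- c) := a :* b :- a :* c) refl _ _ _)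

  DA-* : ∀ K r k f xs → DA K r (λ l → k * f l) xs ≈ k * DA K r f xs
  DA-* K zero k f xs = refl
  DA-* K (suc r) k f xs = trans (*-congˡ (trans (alt-cong xs (λ y ys → trans (*-congˡ (DA-* K r k f ys))
      (solve 3 (λ a b c → a :* (b :* c) := b :* (a :* c)) refl _ _ _))) (alt-* _ _ xs)))
    (solve 3 (λ a b c → a :* (b :* c) := b :* (a :* c)) refl _ _ _)

  DA-+ : ∀ K r f h xs → DA K r (λ l → f l + h l) xs ≈ DA K r f xs + DA K r h xs
  DA-+ K zero f h xs = refl
  DA-+ K (suc r) f h xs = trans (*-congˡ (trans (alt-cong xs (λ y ys → trans (*-congˡ (DA-+ K r f h ys)) (distribˡ _ _ _))) (alt-+ _ _ xs)))
    (distribˡ _ _ _)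

  DA-0 : ∀ K r xs → DA K r (λ _ → 0#) xs ≈ 0#
  DA-0 K r xs = trans (DA-cong K r {λ _ → 0#} {λ _ → 0# * 0#} xs (λ _ _ → sym (zeroˡ 0#))) (trans (DA-* K r 0# (λ _ → 0#) xs) (zeroˡ _))

  DA-Σ : ∀ K r n (f : ℕ → List Carrier → Carrier) xs → DA K r (λ l → Σ≤ n (λ i → f i l)) xs ≈ Σ≤ n (λ i → DA K r (f i) xs)
  DA-Σ K r zero f xs = refl
  DA-Σ K r (suc n) f xs = trans (DA-+ K r _ _ xs) (+-congˡ (DA-Σ K r n (λ i → f (suc i)) xs))

  DA-sumT : ∀ K r d n (f : List ℕ → List Carrier → Carrier) xs → DA K r (λ l → sumT R d n (λ μ → f μ l)) xs ≈ sumT R d n (λ μ → DA K r (f μ) xs)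
  DA-sumT K r zero n f xs = refl
  DA-sumT K r (suc d) n f xs = trans (DA-Σ K r n _ xs) (Σ≤-cong n (λ i _ → inner i (even? (n ℕ.∸ i))))
    where
    inner : ∀ i b → DA K r (λ l → if b then sumT R d (n ℕ.∸ i) (λ ν → f (map suc ν List.++ List.replicate i 0) l) else 0#) xs
      ≈ (if b then sumT R d (n ℕ.∸ i) (λ ν → DA K r (f (map suc ν List.++ List.replicate i 0)) xs) else 0#)
    inner i true = DA-sumT K r d (n ℕ.∸ i) (λ ν → f (map suc ν List.++ List.replicate i 0)) xs
    inner i false = DA-0 K r xs

  sumT-cong : ∀ d n {F H : List ℕ → Carrier} → (∀ μ → length μ ≡ n → F μ ≈ H μ) → sumT R d n F ≈ sumT R d n H
  sumT-cong zero n eq = eq _ (length-replicate n)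
  sumT-cong (suc d) n {F} {H} eq = Σ≤-cong n (λ r r≤n → inner r r≤n (even? (n ℕ.∸ r)))
    where
    inner : ∀ r → r ℕ.≤ n → ∀ b → (if b then sumT R d (n ℕ.∸ r) (λ ν → F (map suc ν List.++ List.replicate r 0)) else 0#)
      ≈ (if b then sumT R d (n ℕ.∸ r) (λ ν → H (map suc ν List.++ List.replicate r 0)) else 0#)
    inner r r≤n true = sumT-cong d (n ℕ.∸ r) (λ ν len → eq _ (≡.trans (length-++ (map suc ν)) (≡.trans
      (≡.cong₂ ℕ._+_ (≡.trans (length-map suc ν) len) (length-replicate r)) (ℕP.m∸n+n≡m r≤n))))
    inner r r≤n false = refl

  sumT-* : ∀ k d n F → sumT R d n (λ μ → k * F μ) ≈ k * sumT R d n F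
  sumT-* k zero n F = refl
  sumT-* k (suc d) n F = trans (Σ≤-cong n (λ r _ → inner r (even? (n ℕ.∸ r)))) (Σ≤-* k n _)
    where
    inner : ∀ r b → (if b then sumT R d (n ℕ.∸ r) (λ ν → k * F (map suc ν List.++ List.replicate r 0)) else 0#)
      ≈ k * (if b then sumT R d (n ℕ.∸ r) (λ ν → F (map suc ν List.++ List.replicate r 0)) else 0#)
    inner r true = sumT-* k d (n ℕ.∸ r) _
    inner r false = sym (zeroʳ k)

  δ : List Carrier → Carrier
  δ [] = 1#
  δ (_ ∷ _) = 0#

  mutual
    -- Approximations to W and G divided by `pp`, obtained by unrolling the recursion d times. At
    -- the bottom W is replaced by δ, its value on the empty list and zero elsewhere.
    Wz : ℕ → List Carrier → Carrier
    Wz zero l = δ l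
    Wz (suc d) l = if even? (length l) then ∏id l * Z d t l else 0#

    Z : ℕ → Carrier → List Carrier → Carrier
    Z d w l = Σ≤ (length l) (λ r → g (even? (length l)) r w * DA K₀ r (Wz d) l)

  Wz-nil : ∀ d → Wz d [] ≈ 1#
  Wz-nil zero = refl
  Wz-nil (suc d) = trans (*-identityˡ _) (trans (*-identityˡ _) (Wz-nil d))

  -- At affine points e_1(x, y) = x y (x - y)(1 - t) and e_t(x, y) = (x - y)(1 - t), so rescaling
  -- turns the Pfaffian at w = 1 into the one at w = t.
  W-fin : ∀ l → W (map fin l) ≈ (if even? (length l) then ∏id l * G t (map fin l) else 0#)
  W-fin l rewrite length-map fin l with halve (length l)
  ... | false , n = refl
  ... | true , n = begin
    Q 1# n (map just (map fin l))
      ≈⟨ reflexive (≡.cong (Q 1# n) (map-∘ l)) ⟨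
    Q 1# n (map (λ x → just (fin x)) l)
      ≈⟨ Q-scale (e 1#) k (λ x y → e t (just (fin x)) (just (fin y))) (λ x y → k (just (fin x)) (just (fin y))) (λ x → just (fin x)) (λ x → x)
           (λ x y → solve 3 (λ x y t → (x :* :1 :- y :* :1) :* ((:1 :- :1) :* (:1 :* :1) :+ (:1 :- t) :* (x :* y))
             := x :* y :* ((x :* :1 :- y :* :1) :* ((:1 :- t) :* (:1 :* :1) :+ (t :- t) :* (x :* y)))) refl x y t)
           (λ _ _ → refl) n l ⟩
    ∏id l * Pfaffian.Q (λ x y → e t (just (fin x)) (just (fin y))) (λ x y → k (just (fin x)) (just (fin y))) n l
      ≈⟨ *-congˡ (trans (Q-scale (e t) k _ _ (λ x → just (fin x)) (λ _ → 1#) (λ _ _ → solve 1 (λ z → z := :1 :* :1 :* z) refl _)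
           (λ _ _ → refl) n l) (trans (*-congʳ (∏1 l)) (*-identityˡ _))) ⟨
    ∏id l * Q t n (map (λ x → just (fin x)) l) ≈⟨ *-congˡ (reflexive (≡.cong (Q t n) (map-∘ l))) ⟩
    ∏id l * Q t n (map just (map fin l)) ∎

  -- `G≈S` and `Z` are the same combination of divided powers, applied to W and to `Wz d`; `DA-pp`
  -- carries `pp` inside, so the error of G is the image of the error of W.
  G≈Z : ∀ d w l → Generic l → G w (map fin l) - pp l * Z d w l
    ≈ Σ≤ (length l) (λ r → g (even? (length l)) r w * DA K₁ r (λ l → W (map fin l) - pp l * Wz d l) l)
  G≈Z d w l gen = begin
    G w (map fin l) - pp l * Z d w l
      ≈⟨ +-cong (G≈S (length l) l ℕP.≤-refl gen w) (-‿cong (sym (Σ≤-* (pp l) n _))) ⟩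
    S w (map fin l) - Σ≤ n (λ r → pp l * (g b r w * DA K₀ r (Wz d) l))
      ≈⟨ +-cong (reflexive (≡.cong (λ n → Σ≤ n (λ r → g (even? n) r w * D^ r W (map fin l))) (length-map fin l))) (sym (Σ≤-neg n _)) ⟩
    Σ≤ n (λ r → g b r w * D^ r W (map fin l)) + Σ≤ n (λ r → - (pp l * (g b r w * DA K₀ r (Wz d) l)))
      ≈⟨ Σ≤-+ n _ _ ⟨
    Σ≤ n (λ r → g b r w * D^ r W (map fin l) - pp l * (g b r w * DA K₀ r (Wz d) l))
      ≈⟨ Σ≤-cong n (λ r _ → trans (solve 4 (λ g x p y → g :* x :- p :* (g :* y) := g :* (x :- p :* y)) refl (g b r w) _ _ _)
           (*-congˡ (trans (+-cong (D^-fin r W l) (-‿cong (sym (DA-pp r (Wz d) l)))) (sym (DA-- K₁ r _ _ l))))) ⟩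
    Σ≤ n (λ r → g b r w * DA K₁ r (λ l → W (map fin l) - pp l * Wz d l) l) ∎
    where
    n = length l
    b = even? n

  module Order {o} (Φ : Filtration R o) where

    open Filtration Φ

    ord-alt : ∀ {p} {P : Set p} {m} {φ : P → List P → Carrier} l → (∀ {y ys} → Pick y l ys → Ord m (φ y ys)) → Ord m (alt φ l)
    ord-alt [] h = ord-0
    ord-alt (x ∷ xs) h = ord-+ (h here) (ord-neg (ord-alt xs (λ p → h (there p))))

    ord-Σ : ∀ {m} n {f : ℕ → Carrier} → (∀ r → Ord m (f r)) → Ord m (Σ≤ n f)
    ord-Σ zero h = h 0
    ord-Σ (suc n) h = ord-+ (h 0) (ord-Σ n (λ r → h (suc r)))

    -- Multiples and signed sums never lower the order, and genericity and smallness pass to the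
    -- shorter lists.
    ord-DA : ∀ {m} K r f l → Generic l → All Small l → (∀ ys → Generic ys → All Small ys → Ord m (f ys)) → Ord m (DA K r f l)
    ord-DA K zero f l gen sm h = h l gen sm
    ord-DA K (suc r) f l gen sm h = ord-* _ (ord-alt l (λ p → ord-* _ (ord-DA K r f _ (generic-pick p gen) (all-pick p sm) h)))

    -- Truncating the sum at parts ≤ d leaves an error of x-order > d: each of the d steps multiplies the error by a product of variables.
    mutual
      Wz-order : ∀ d l → Generic l → All Small l → Ord (suc d) (W (map fin l) - pp l * Wz d l)
      Wz-order d l gen sm = resp (+-congʳ (sym (W-fin l))) (cases d l gen sm)
        where
        cases : ∀ d l → Generic l → All Small l → Ord (suc d) ((if even? (length l) then ∏id l * G t (map fin l) else 0#) - pp l * Wz d l)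
        cases zero [] _ _ = resp (solve 0 (:0 := :1 :* :1 :- :1 :* :1) refl) ord-0
        cases (suc d) [] _ _ = resp (trans (solve 0 (:0 := :1 :* :1 :- :1 :* :1) refl) (+-congˡ (-‿cong (*-congˡ (sym (Wz-nil (suc d))))))) ord-0
        cases zero (x ∷ l) gen (s ∷ sm) with even? (suc (length l))
        ... | true = resp (solve 4 (λ x p g q → x :* (p :* g) := (x :* p) :* g :- q :* :0) refl _ _ _ _) (s (ord-z _))
        ... | false = resp (solve 1 (λ q → :0 := :0 :- q :* :0) refl _) ord-0
        cases (suc d) (x ∷ l) gen (s ∷ sm) with even? (suc (length l)) | GZ-order d t (x ∷ l) gen (s ∷ sm)
        ... | false | _ = resp (solve 1 (λ q → :0 := :0 :- q :* :0) refl _) ord-0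
        -- One factor x of the product of variables is enough to raise the order of the inductive
        -- error.
        ... | true | h = resp (solve 5 (λ x p g q z → x :* (p :* (g :- q :* z)) := (x :* p) :* g :- q :* ((x :* p) :* z)) refl _ _ _ _ _) (s (ord-* _ h))

      GZ-order : ∀ d w l → Generic l → All Small l → Ord (suc d) (G w (map fin l) - pp l * Z d w l)
      GZ-order d w l gen sm = resp (sym (G≈Z d w l gen))
        (ord-Σ (length l) (λ r → ord-* _ (ord-DA K₁ r _ l gen sm (Wz-order d))))

  -- The Hall-Littlewood numerator, the signed sum over permutations of x^μ times the product of the
  -- x_i - t x_j over i < j, developed by the variable in the first place. It is zero when the
  -- lengths differ.
  num : List ℕ → List Carrier → Carrier
  num [] l = δ l
  num (a ∷ μ) l = alt (λ y ys → y ^ a * ∏ (λ z → y - t * z) ys * num μ ys) l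

  num-suc : ∀ μ l → num (map suc μ) l ≈ ∏id l * num μ l
  num-suc [] [] = sym (*-identityˡ 1#)
  num-suc [] (x ∷ l) = sym (zeroʳ _)
  num-suc (a ∷ μ) l = trans (alt-cong-pick l (λ {y} {ys} p → begin
      (y * y ^ a) * ∏ (λ z → y - t * z) ys * num (map suc μ) ys ≈⟨ *-congˡ (num-suc μ ys) ⟩
      (y * y ^ a) * ∏ (λ z → y - t * z) ys * (∏id ys * num μ ys)
        ≈⟨ solve 5 (λ y a k p n → (y :* a) :* k :* (p :* n) := (y :* p) :* (a :* k :* n)) refl _ _ _ _ _ ⟩
      (y * ∏id ys) * (y ^ a * ∏ (λ z → y - t * z) ys * num μ ys) ≈⟨ *-congʳ (∏-pick _ p) ⟨
      ∏id l * (y ^ a * ∏ (λ z → y - t * z) ys * num μ ys) ∎)) (alt-* _ _ l)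

  D₀ : (List Carrier → Carrier) → List Carrier → Carrier
  D₀ f l = alt (λ y ys → ∏ (K₀ y) ys * f ys) l

  -- The variable y of the last place is picked first instead. Exchanging the picks by `alt-alt`
  -- costs a sign for every preceding z, which turns z - t y into t y - z.
  num-snoc-0 : ∀ μ l → num (μ List.++ 0 ∷ []) l ≈ D₀ (num μ) l
  num-snoc-0 [] l = alt-cong l step
    where
    step : ∀ y ys → 1# * ∏ (λ z → y - t * z) ys * δ ys ≈ ∏ (K₀ y) ys * δ ys
    step y [] = *-congʳ (*-identityˡ 1#)
    step y (z ∷ ys) = trans (zeroʳ _) (sym (zeroʳ _))
  num-snoc-0 (a ∷ μ) l = begin
    alt (λ y ys → y ^ a * ∏ (J y) ys * num (μ List.++ 0 ∷ []) ys) l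
      ≈⟨ alt-cong l (λ y ys → trans (*-congˡ (num-snoc-0 μ ys)) (trans (sym (alt-* _ _ ys)) (alt-cong-pick ys (λ p → *-congʳ (*-congˡ (∏-pick (J y) p)))))) ⟩
    alt (λ y ys → alt (λ z zs → y ^ a * ((y - t * z) * ∏ (J y) zs) * (∏ (K₀ z) zs * num μ zs)) ys) l
      ≈⟨ alt-alt (λ y z zs → y ^ a * ((y - t * z) * ∏ (J y) zs) * (∏ (K₀ z) zs * num μ zs)) l ⟩
    - alt (λ y ys → alt (λ z zs → z ^ a * ((z - t * y) * ∏ (J z) zs) * (∏ (K₀ y) zs * num μ zs)) ys) l
      ≈⟨ trans (alt-cong l (λ y ys → alt-neg _ ys)) (alt-neg _ l) ⟨
    alt (λ y ys → alt (λ z zs → - (z ^ a * ((z - t * y) * ∏ (J z) zs) * (∏ (K₀ y) zs * num μ zs))) ys) l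
      ≈⟨ alt-cong l (λ y ys → trans (alt-cong-pick ys (λ {z} {zs} p → trans
           (solve 7 (λ a z t y j k n → :- (a :* ((z :- t :* y) :* j) :* (k :* n)) := ((t :* y :- z) :* k) :* (a :* j :* n)) refl _ z t y _ _ _)
           (*-congʳ (sym (∏-pick (K₀ y) p))))) (alt-* _ _ ys)) ⟩
    alt (λ y ys → ∏ (K₀ y) ys * alt (λ z zs → z ^ a * ∏ (J z) zs * num μ zs) ys) l ∎
    where
    J : Carrier → Carrier → Carrier
    J y z = y - t * z

  ι! : ℕ → Carrier
  ι! zero = 1#
  ι! (suc r) = ι r * ι! r

  num-zeros : ∀ r μ l → DA K₀ r (num μ) l ≈ ι! r * num (μ List.++ List.replicate r 0) l
  num-zeros zero μ l = trans (reflexive (≡.cong (λ ν → num ν l) (≡.sym (++-identityʳ μ)))) (sym (*-identityˡ _))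
  num-zeros (suc r) μ l = begin
    ι r * D₀ (DA K₀ r (num μ)) l
      ≈⟨ *-congˡ (trans (alt-cong l (λ y ys → trans (*-congˡ (num-zeros r μ ys)) (solve 3 (λ a b c → a :* (b :* c) := b :* (a :* c)) refl _ _ _))) (alt-* _ _ l)) ⟩
    ι r * (ι! r * D₀ (num (μ List.++ List.replicate r 0)) l) ≈⟨ *-congˡ (*-congˡ (num-snoc-0 (μ List.++ List.replicate r 0) l)) ⟨
    ι r * (ι! r * num ((μ List.++ List.replicate r 0) List.++ 0 ∷ []) l)
      ≈⟨ *-assoc _ _ _ ⟨
    ι! (suc r) * num ((μ List.++ List.replicate r 0) List.++ 0 ∷ []) l
      ≈⟨ *-congˡ (reflexive (≡.cong (λ ν → num ν l) (≡.trans (++-assoc μ (List.replicate r 0) (0 ∷ [])) (≡.cong (μ List.++_) (zeros r))))) ⟩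
    ι! (suc r) * num (μ List.++ List.replicate (suc r) 0) l ∎
    where
    zeros : ∀ r → List.replicate r 0 List.++ 0 ∷ [] ≡ 0 ∷ List.replicate r 0
    zeros zero = ≡.refl
    zeros (suc r) = ≡.cong (0 ∷_) (zeros r)

  module Coefficients (cf : Carrier → List ℕ → Carrier)
    (cf-zeros : ∀ w n → even? n ≡ true → cf w (List.replicate n 0) ≈ g true n w * ι! n)
    (cf-suc : ∀ w r ν → even? r ≡ true → even? (length ν) ≡ true →
       cf w (map suc ν List.++ List.replicate r 0) ≈ g true r w * ι! r * cf t ν) where

    -- The index r is the number of zero parts. The other n - r parts are one larger than those of a
    -- partition at level d - 1 and w = t, and an odd n - r contributes nothing because W vanishes
    -- on odd lists. At d = 0 the δ leaves only r = n.
    Z-sum : ∀ d w l → even? (length l) ≡ true → Z d w l ≈ sumT R d (length l) (λ μ → cf w μ * num μ l)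
    Z-sum zero w l ev rewrite ev = begin
      Σ≤ n (λ r → g true r w * DA K₀ r δ l) ≈⟨ Σ≤-top n _ (λ r r<n → trans (*-congˡ (below r r<n)) (zeroʳ _)) ⟩
      g true n w * DA K₀ n δ l ≈⟨ *-congˡ (num-zeros n [] l) ⟩
      g true n w * (ι! n * num (List.replicate n 0) l) ≈⟨ *-assoc _ _ _ ⟨
      g true n w * ι! n * num (List.replicate n 0) l ≈⟨ *-congʳ (cf-zeros w n ev) ⟨
      cf w (List.replicate n 0) * num (List.replicate n 0) l ∎
      where
      n = length l
      below : ∀ r → r ℕ.< n → DA K₀ r δ l ≈ 0#
      below r r<n = trans (DA-cong K₀ r l vanish) (DA-0 K₀ r l)
        where
        vanish : ∀ ys → r ℕ.+ length ys ≡ length l → δ ys ≈ 0#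
        vanish [] e = ⊥-elim (ℕP.<-irrefl (≡.trans (≡.sym (ℕP.+-identityʳ r)) e) r<n)
        vanish (_ ∷ _) e = refl
    Z-sum (suc d) w l ev = begin
      Σ≤ n (λ r → g (even? n) r w * DA K₀ r (Wz (suc d)) l)
        ≈⟨ reflexive (≡.cong (λ b → Σ≤ n (λ r → g b r w * DA K₀ r (Wz (suc d)) l)) ev) ⟩
      Σ≤ n (λ r → g true r w * DA K₀ r (Wz (suc d)) l) ≈⟨ Σ≤-cong n term ⟩
      Σ≤ n (λ r → if even? (n ℕ.∸ r) then sumT R d (n ℕ.∸ r) (λ ν → cf w (extend r ν) * num (extend r ν) l) else 0#) ∎
      where
      n = length l
      extend : ℕ → List ℕ → List ℕ
      extend r ν = map suc ν List.++ List.replicate r 0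
      term : ∀ r → r ℕ.≤ n → g true r w * DA K₀ r (Wz (suc d)) l
        ≈ (if even? (n ℕ.∸ r) then sumT R d (n ℕ.∸ r) (λ ν → cf w (extend r ν) * num (extend r ν) l) else 0#)
      -- The parity test in `Wz` becomes a test of n ∸ r, the length of the first column of the
      -- partition.
      term r r≤n = trans (*-congˡ (DA-cong K₀ r l (λ ys e → reflexive (≡.cong (λ m → if even? m then ∏id ys * Z d t ys else 0#)
          (≡.trans (≡.sym (ℕP.m+n∸m≡n r (length ys))) (≡.cong (ℕ._∸ r) e)))))) (branch (even? (n ℕ.∸ r)) ≡.refl)
        where
        branch : ∀ b → even? (n ℕ.∸ r) ≡ b → g true r w * DA K₀ r (λ ys → if b then ∏id ys * Z d t ys else 0#) l
          ≈ (if b then sumT R d (n ℕ.∸ r) (λ ν → cf w (extend r ν) * num (extend r ν) l) else 0#)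
        branch false _ = trans (*-congˡ (DA-0 K₀ r l)) (zeroʳ _)
        branch true ev′ = begin
          g true r w * DA K₀ r (λ ys → ∏id ys * Z d t ys) l
            ≈⟨ *-congˡ (DA-cong K₀ r l (λ ys e → trans (*-congˡ (Z-sum-at ys e)) (trans (sym (sumT-* _ d (n ℕ.∸ r) _))
                 (sumT-cong d (n ℕ.∸ r) (λ ν _ → trans (solve 3 (λ p c m → p :* (c :* m) := c :* (p :* m)) refl _ _ _) (*-congˡ (sym (num-suc ν ys)))))))) ⟩
          g true r w * DA K₀ r (λ ys → sumT R d (n ℕ.∸ r) (λ ν → cf t ν * num (map suc ν) ys)) l
            ≈⟨ *-congˡ (DA-sumT K₀ r d (n ℕ.∸ r) _ l) ⟩
          g true r w * sumT R d (n ℕ.∸ r) (λ ν → DA K₀ r (λ ys → cf t ν * num (map suc ν) ys) l)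
            ≈⟨ sumT-* _ d (n ℕ.∸ r) _ ⟨
          sumT R d (n ℕ.∸ r) (λ ν → g true r w * DA K₀ r (λ ys → cf t ν * num (map suc ν) ys) l)
            ≈⟨ sumT-cong d (n ℕ.∸ r) (λ ν len → begin
                 g true r w * DA K₀ r (λ ys → cf t ν * num (map suc ν) ys) l
                   ≈⟨ *-congˡ (trans (DA-* K₀ r (cf t ν) _ l) (*-congˡ (num-zeros r (map suc ν) l))) ⟩
                 g true r w * (cf t ν * (ι! r * num (extend r ν) l))
                   ≈⟨ solve 4 (λ g c i m → g :* (c :* (i :* m)) := (g :* i :* c) :* m) refl _ _ _ _ ⟩
                 (g true r w * ι! r * cf t ν) * num (extend r ν) l
                   ≈⟨ *-congʳ (cf-suc w r ν ev-r (≡.trans (≡.cong even? len) ev′)) ⟨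
                 cf w (extend r ν) * num (extend r ν) l ∎) ⟩
          sumT R d (n ℕ.∸ r) (λ ν → cf w (extend r ν) * num (extend r ν) l) ∎
          where
          -- The total number of places and the number of nonzero parts are even, hence so is the
          -- number of zero parts, as `cf-suc` requires.
          ev-r : even? r ≡ true
          ev-r = even?-+ r (n ℕ.∸ r) ev′ (≡.trans (≡.cong even? (ℕP.m+[n∸m]≡n r≤n)) ev)
          Z-sum-at : ∀ ys → r ℕ.+ length ys ≡ n → Z d t ys ≈ sumT R d (n ℕ.∸ r) (λ μ → cf t μ * num μ ys)
          Z-sum-at ys e = trans (Z-sum d t ys (≡.trans (≡.cong even? len) ev′))
            (reflexive (≡.cong (λ m → sumT R d m (λ μ → cf t μ * num μ ys)) len))
            where
            len : length ys ≡ n ℕ.∸ r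
            len = ≡.trans (≡.sym (ℕP.m+n∸m≡n r (length ys))) (≡.cong (ℕ._∸ r) e)

-- Cauchy products and the ring of formal power series.

module Cauchy {c ℓ} (A : CommutativeRing c ℓ) where

  open RingKit A

  tail : (ℕ → Carrier) → ℕ → Carrier
  tail f a = f (suc a)

  -- Recursion on the shifted first factor avoids the index a - k, so the ring laws are proved by
  -- plain induction.
  conv : ℕ → (ℕ → Carrier) → (ℕ → Carrier) → Carrier
  conv zero f g = f 0 * g 0
  conv (suc a) f g = f 0 * g (suc a) + conv a (tail f) g

  conv-cong : ∀ a {f f' g g'} → (∀ k → f k ≈ f' k) → (∀ k → g k ≈ g' k) → conv a f g ≈ conv a f' g'
  conv-cong zero p q = *-cong (p 0) (q 0)
  conv-cong (suc a) p q = +-cong (*-cong (p 0) (q (suc a))) (conv-cong a (λ k → p (suc k)) q)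

  conv-+ˡ : ∀ a f f' g → conv a (λ k → f k + f' k) g ≈ conv a f g + conv a f' g
  conv-+ˡ zero f f' g = distribʳ _ _ _
  conv-+ˡ (suc a) f f' g = trans (+-congˡ (conv-+ˡ a _ _ g))
    (solve 5 (λ x y z u v → (x :+ y) :* z :+ (u :+ v) := (x :* z :+ u) :+ (y :* z :+ v)) refl _ _ _ _ _)

  conv-* : ∀ a k f g → conv a (λ i → k * f i) g ≈ k * conv a f g
  conv-* zero k f g = *-assoc _ _ _
  conv-* (suc a) k f g = trans (+-cong (*-assoc _ _ _) (conv-* a k _ g)) (sym (distribˡ _ _ _))

  conv-0 : ∀ a g → conv a (λ _ → 0#) g ≈ 0#
  conv-0 zero g = zeroˡ _
  conv-0 (suc a) g = trans (+-cong (zeroˡ _) (conv-0 a g)) (+-identityˡ _)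

  conv-assoc : ∀ a f g h → conv a (λ b → conv b f g) h ≈ conv a f (λ b → conv b g h)
  conv-assoc zero f g h = *-assoc _ _ _
  conv-assoc (suc a) f g h = begin
    f 0 * g 0 * h (suc a) + conv a (λ b → f 0 * g (suc b) + conv b (tail f) g) h
      ≈⟨ +-congˡ (trans (conv-+ˡ a _ _ h) (+-cong (conv-* a _ _ h) (conv-assoc a (tail f) g h))) ⟩
    f 0 * g 0 * h (suc a) + (f 0 * conv a (tail g) h + conv a (tail f) (λ b → conv b g h))
      ≈⟨ solve 5 (λ f g h c d → f :* g :* h :+ (f :* c :+ d) := f :* (g :* h :+ c) :+ d) refl _ _ _ _ _ ⟩
    f 0 * (g 0 * h (suc a) + conv a (tail g) h) + conv a (tail f) (λ b → conv b g h) ∎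

  conv-sucʳ : ∀ a f g → conv (suc a) f g ≈ f (suc a) * g 0 + conv a f (tail g)
  conv-sucʳ zero f g = +-comm _ _
  conv-sucʳ (suc a) f g = trans (+-congˡ (conv-sucʳ a (tail f) g))
    (solve 3 (λ x y z → x :+ (y :+ z) := y :+ (x :+ z)) refl _ _ _)

  conv-comm : ∀ a f g → conv a f g ≈ conv a g f
  conv-comm zero f g = *-comm _ _
  conv-comm (suc a) f g = trans (+-cong (*-comm _ _) (conv-comm a (tail f) g)) (sym (conv-sucʳ a g f))

module SeriesRing where

  open import Defs

  sumℤ-++ : ∀ l l' → sumℤ (l List.++ l') ≡ sumℤ l ℤ.+ sumℤ l'
  sumℤ-++ [] l' = ≡.sym (ℤP.+-identityˡ _)
  sumℤ-++ (x ∷ l) l' = ≡.trans (≡.cong (λ z → x ℤ.+ z) (sumℤ-++ l l')) (≡.sym (ℤP.+-assoc x _ _))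

  sumℤ-concatMap : ∀ {a b} {A : Set a} {B : Set b} (h : B → ℤ) (ψ : A → List B) l →
    sumℤ (map h (List.concatMap ψ l)) ≡ sumℤ (map (λ x → sumℤ (map h (ψ x))) l)
  sumℤ-concatMap h ψ [] = ≡.refl
  sumℤ-concatMap h ψ (x ∷ l) = ≡.trans (≡.cong sumℤ (map-++ h (ψ x) _))
    (≡.trans (sumℤ-++ (map h (ψ x)) _) (≡.cong (λ z → sumℤ (map h (ψ x)) ℤ.+ z) (sumℤ-concatMap h ψ l)))

  _at_ : ∀ {m} → FPS (suc m) → ℕ → FPS m
  (f at k) α = f (k ∷ α)

  ⊗-cons : ∀ {m} (f g : FPS (suc m)) a α → (f ⊗ g) (a ∷ α) ≡ sumℤ (List.applyUpTo (λ k → (f at k ⊗ g at (a ℕ.∸ k)) α) (suc a))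
  ⊗-cons f g a α = ≡.trans (sumℤ-concatMap h ψ (List.upTo (suc a))) (≡.trans
    (≡.cong sumℤ (map-cong (λ k → ≡.cong sumℤ (≡.sym (map-∘ {g = h} {f = φ k} (splits α)))) (List.upTo (suc a))))
    (≡.cong sumℤ (map-upTo (λ k → (f at k ⊗ g at (a ℕ.∸ k)) α) (suc a))))
    where
    h : Vec ℕ _ × Vec ℕ _ → ℤ
    h (β , γ) = f β ℤ.* g γ
    φ : ℕ → Vec ℕ _ × Vec ℕ _ → Vec ℕ _ × Vec ℕ _
    φ k (β , γ) = (k ∷ β) , ((a ℕ.∸ k) ∷ γ)
    ψ : ℕ → List (Vec ℕ _ × Vec ℕ _)
    ψ k = map (φ k) (splits α)

  -- Only the multiplicative laws are collected, since the additive ones hold coefficientwise. They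
  -- are proved by induction on m, each series being a series in its first variable over the ring
  -- for m.
  record Mul (m : ℕ) : Set where
    field
      cong  : ∀ {f f' g g' : FPS m} → f ≈ f' → g ≈ g' → f ⊗ g ≈ f' ⊗ g'
      assoc : ∀ (f g h : FPS m) → (f ⊗ g) ⊗ h ≈ f ⊗ (g ⊗ h)
      comm  : ∀ (f g : FPS m) → f ⊗ g ≈ g ⊗ f
      one   : ∀ (f : FPS m) → 𝟙 ⊗ f ≈ f
      dist  : ∀ (f g h : FPS m) → (f ⊕ g) ⊗ h ≈ (f ⊗ h) ⊕ (g ⊗ h)

  𝟘≈ : ∀ {m} (α : Vec ℕ m) → 𝟘 α ≡ + 0
  𝟘≈ α with eqVec α zeroV
  ... | true = ≡.refl
  ... | false = ≡.refl

  toRing : ∀ {m} → Mul m → CommutativeRing _ _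
  toRing {m} M = record
    { Carrier = FPS m ; _≈_ = _≈_ ; _+_ = _⊕_ ; _*_ = _⊗_ ; -_ = ⊝_ ; 0# = 𝟘 ; 1# = 𝟙
    ; isCommutativeRing = record
      { isRing = record
        { +-isAbelianGroup = record
          { isGroup = record
            { isMonoid = record
              { isSemigroup = record
                { isMagma = record { isEquivalence = equiv ; ∙-cong = λ p q α → ≡.cong₂ ℤ._+_ (p α) (q α) }
                ; assoc = λ f g h α → ℤP.+-assoc (f α) (g α) (h α) }
              ; identity = (λ f α → ≡.trans (≡.cong (λ z → z ℤ.+ f α) (𝟘≈ α)) (ℤP.+-identityˡ (f α)))
                         , (λ f α → ≡.trans (≡.cong (λ z → f α ℤ.+ z) (𝟘≈ α)) (ℤP.+-identityʳ (f α))) }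
            ; inverse = (λ f α → ≡.trans (ℤP.+-inverseˡ (f α)) (≡.sym (𝟘≈ α)))
                      , (λ f α → ≡.trans (ℤP.+-inverseʳ (f α)) (≡.sym (𝟘≈ α)))
            ; ⁻¹-cong = λ p α → ≡.cong ℤ.-_ (p α) }
          ; comm = λ f g α → ℤP.+-comm (f α) (g α) }
        ; *-cong = M.cong
        ; *-assoc = M.assoc
        ; *-identity = M.one , (λ f α → ≡.trans (M.comm f 𝟙 α) (M.one f α))
        ; distrib = (λ f g h α → ≡.trans (M.comm f (g ⊕ h) α) (≡.trans (M.dist g h f α) (≡.cong₂ ℤ._+_ (M.comm g f α) (M.comm h f α))))
                  , (λ f g h → M.dist g h f) }
      ; *-comm = M.comm } }
    where
    module M = Mul M
    open import Relation.Binary.Structures using (IsEquivalence)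
    equiv : IsEquivalence (_≈_ {m})
    equiv = record { refl = λ α → ≡.refl ; sym = λ p α → ≡.sym (p α) ; trans = λ p q α → ≡.trans (p α) (q α) }

  ring-0 : Mul 0
  ring-0 = record
    { cong = λ {f} {f'} {g} {g'} p q → λ { [] → ≡.cong₂ (λ x y → x ℤ.* y ℤ.+ + 0) (p []) (q []) }
    ; assoc = λ f g h → λ { [] → ≡.cong (λ z → z ℤ.+ + 0) (≡.trans (≡.cong (λ z → z ℤ.* h []) (ℤP.+-identityʳ (f [] ℤ.* g [])))
        (≡.trans (ℤP.*-assoc (f []) (g []) (h [])) (≡.cong (λ z → f [] ℤ.* z) (≡.sym (ℤP.+-identityʳ (g [] ℤ.* h [])))))) }
    ; comm = λ f g → λ { [] → ≡.cong (λ z → z ℤ.+ + 0) (ℤP.*-comm (f []) (g [])) }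
    ; one = λ f → λ { [] → ≡.trans (ℤP.+-identityʳ _) (ℤP.*-identityˡ (f [])) }
    ; dist = λ f g h → λ { [] → ≡.trans (ℤP.+-identityʳ _) (≡.trans (ℤP.*-distribʳ-+ (h []) (f []) (g []))
        (≡.sym (≡.cong₂ ℤ._+_ (ℤP.+-identityʳ (f [] ℤ.* h [])) (ℤP.+-identityʳ (g [] ℤ.* h []))))) } }

  module Step {m : ℕ} (M : Mul m) where
    open Cauchy (toRing M)

    -- Splitting off the first exponent exhibits ⊗ as a Cauchy product over series with one variable
    -- fewer; the laws in `step` are carried over through it.
    ⊗-conv : ∀ (f g : FPS (suc m)) a → (f ⊗ g) at a ≈ conv a (f at_) (g at_)
    ⊗-conv f g a α = ≡.trans (⊗-cons f g a α) (go a (f at_) (g at_))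
      where
      go : ∀ a (F G : ℕ → FPS m) → sumℤ (List.applyUpTo (λ k → (F k ⊗ G (a ℕ.∸ k)) α) (suc a)) ≡ conv a F G α
      go zero F G = ℤP.+-identityʳ _
      go (suc a) F G = ≡.cong (λ z → (F 0 ⊗ G (suc a)) α ℤ.+ z) (go a (tail F) G)

    𝟙-at : ∀ k → (𝟙 {suc m} at suc k) ≈ 𝟘 {m}
    𝟙-at k α = ≡.sym (𝟘≈ α)

    step : Mul (suc m)
    step = record
      { cong = λ { {f} {f'} {g} {g'} p q (a ∷ α) → ≡.trans (⊗-conv f g a α)
          (≡.trans (conv-cong a {f at_} {f' at_} {g at_} {g' at_} (λ k β → p (k ∷ β)) (λ k β → q (k ∷ β)) α) (≡.sym (⊗-conv f' g' a α))) }
      ; assoc = λ { f g h (a ∷ α) → ≡.trans (⊗-conv (f ⊗ g) h a α) (≡.trans (conv-cong a {(f ⊗ g) at_} {λ b → conv b (f at_) (g at_)} {h at_} {h at_} (⊗-conv f g) (λ k β → ≡.refl) α)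
          (≡.trans (conv-assoc a (f at_) (g at_) (h at_) α) (≡.sym (≡.trans (⊗-conv f (g ⊗ h) a α)
            (conv-cong a {f at_} {f at_} {(g ⊗ h) at_} {λ b → conv b (g at_) (h at_)} (λ k β → ≡.refl) (⊗-conv g h) α))))) }
      ; comm = λ { f g (a ∷ α) → ≡.trans (⊗-conv f g a α) (≡.trans (conv-comm a (f at_) (g at_) α) (≡.sym (⊗-conv g f a α))) }
      ; one = λ { f (a ∷ α) → ≡.trans (⊗-conv 𝟙 f a α) (one a (f at_) α) }
      ; dist = λ { f g h (a ∷ α) → ≡.trans (⊗-conv (f ⊕ g) h a α) (≡.trans (conv-+ˡ a (f at_) (g at_) (h at_) α)
          (≡.sym (≡.cong₂ ℤ._+_ (⊗-conv f h a α) (⊗-conv g h a α)))) } }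
      where
      module M = Mul M
      one : ∀ a F → conv a (𝟙 {suc m} at_) F ≈ F a
      one zero F = M.one (F 0)
      one (suc a) F α = ≡.trans (≡.cong₂ ℤ._+_ (M.one (F (suc a)) α)
        (≡.trans (conv-cong a {tail (𝟙 {suc m} at_)} {λ _ → 𝟘} {F} {F} 𝟙-at (λ k β → ≡.refl) α) (≡.trans (conv-0 a F α) (𝟘≈ α)))) (ℤP.+-identityʳ _)

  mul : ∀ m → Mul m
  mul zero = ring-0
  mul (suc m) = Step.step (mul m)

  series : ℕ → CommutativeRing _ _
  series m = toRing (mul m)

-- Orders, inverses and regular elements among power series.

module SeriesVariables where

  open import Defs
  open SeriesRing

  module Ring (m : ℕ) = RingKit (series m)

  _⊞_ : ∀ {m} → Vec ℕ m → Vec ℕ m → Vec ℕ m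
  [] ⊞ [] = []
  (a ∷ α) ⊞ (b ∷ β) = (a ℕ.+ b) ∷ (α ⊞ β)

  Σ< : ℕ → (ℕ → ℤ) → ℤ
  Σ< n φ = sumℤ (List.applyUpTo φ n)

  Σ<-cong : ∀ n {φ ψ} → (∀ k → k ℕ.< n → φ k ≡ ψ k) → Σ< n φ ≡ Σ< n ψ
  Σ<-cong zero h = ≡.refl
  Σ<-cong (suc n) h = ≡.cong₂ ℤ._+_ (h 0 (ℕ.s≤s ℕ.z≤n)) (Σ<-cong n (λ k p → h (suc k) (ℕ.s≤s p)))

  Σ<-0 : ∀ n {φ} → (∀ k → φ k ≡ + 0) → Σ< n φ ≡ + 0
  Σ<-0 zero h = ≡.refl
  Σ<-0 (suc n) h = ≡.trans (≡.cong₂ ℤ._+_ (h 0) (Σ<-0 n (λ k → h (suc k)))) ≡.refl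

  Σ<-extend : ∀ m n {φ} → m ℕ.≤ n → (∀ k → m ℕ.≤ k → φ k ≡ + 0) → Σ< n φ ≡ Σ< m φ
  Σ<-extend zero n p h = Σ<-0 n (λ k → h k ℕ.z≤n)
  Σ<-extend (suc m) (suc n) {φ} (ℕ.s≤s p) h = ≡.cong (λ z → φ 0 ℤ.+ z) (Σ<-extend m n p (λ k q → h (suc k) (ℕ.s≤s q)))

  -- This permits replacing a factor by one that agrees with it only at the exponents below α, such
  -- as a finite truncation.
  ⊗-local : ∀ {m} (f g f' g' : FPS m) α → (∀ β γ → β ⊞ γ ≡ α → f β ℤ.* g γ ≡ f' β ℤ.* g' γ) → (f ⊗ g) α ≡ (f' ⊗ g') α
  ⊗-local f g f' g' [] h = ≡.cong (λ z → z ℤ.+ + 0) (h [] [] ≡.refl)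
  ⊗-local f g f' g' (a ∷ α) h = ≡.trans (⊗-cons f g a α) (≡.trans (Σ<-cong (suc a) (λ k k≤a →
      ⊗-local (f at k) (g at (a ℕ.∸ k)) (f' at k) (g' at (a ℕ.∸ k)) α (λ β γ e →
        h (k ∷ β) ((a ℕ.∸ k) ∷ γ) (≡.cong₂ _∷_ (ℕP.m+[n∸m]≡n (ℕP.≤-pred k≤a)) e))))
    (≡.sym (⊗-cons f' g' a α)))

  ⊗-vanish : ∀ {m} (f g : FPS m) α → (∀ β γ → β ⊞ γ ≡ α → f β ≡ + 0 ⊎ g γ ≡ + 0) → (f ⊗ g) α ≡ + 0
  ⊗-vanish {m} f g α h = ≡.trans (⊗-local f g f 𝟘 α (λ β γ e → case (h β γ e)))
    (≡.trans (zeroʳ f α) (𝟘≈ α))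
    where
    open Ring m using (zeroʳ)
    case : ∀ {β γ} → f β ≡ + 0 ⊎ g γ ≡ + 0 → f β ℤ.* g γ ≡ f β ℤ.* 𝟘 γ
    case {β} {γ} (inj₁ p) = ≡.trans (≡.cong (λ z → z ℤ.* g γ) p) (≡.trans (ℤP.*-zeroˡ (g γ)) (≡.sym (≡.trans (≡.cong (λ z → z ℤ.* 𝟘 γ) p) (ℤP.*-zeroˡ (𝟘 γ)))))
    case {β} {γ} (inj₂ q) = ≡.cong (λ z → f β ℤ.* z) (≡.trans q (≡.sym (𝟘≈ γ)))

  sum-⊞ : ∀ {m} (β γ : Vec ℕ m) → Vec.sum (β ⊞ γ) ≡ Vec.sum β ℕ.+ Vec.sum γ
  sum-⊞ [] [] = ≡.refl
  sum-⊞ (b ∷ β) (c ∷ γ) rewrite sum-⊞ β γ = begin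
    b ℕ.+ c ℕ.+ (Vec.sum β ℕ.+ Vec.sum γ) ≡⟨ ℕP.+-assoc b c _ ⟩
    b ℕ.+ (c ℕ.+ (Vec.sum β ℕ.+ Vec.sum γ)) ≡⟨ ≡.cong (b ℕ.+_) (≡.trans (≡.sym (ℕP.+-assoc c (Vec.sum β) _)) (≡.trans (≡.cong (ℕ._+ Vec.sum γ) (ℕP.+-comm c (Vec.sum β))) (ℕP.+-assoc (Vec.sum β) c _))) ⟩
    b ℕ.+ (Vec.sum β ℕ.+ (c ℕ.+ Vec.sum γ)) ≡⟨ ℕP.+-assoc b _ _ ⟨
    b ℕ.+ Vec.sum β ℕ.+ (c ℕ.+ Vec.sum γ) ∎
    where open ≡.≡-Reasoning

  module Degree {m} (deg : Vec ℕ m → ℕ) (deg-⊞ : ∀ β γ → deg (β ⊞ γ) ≡ deg β ℕ.+ deg γ) where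

    -- Any additive degree will do: the total degree controls `inv1m`, and the x-degree measures the
    -- truncation error.
    Order : ℕ → FPS m → Set
    Order n f = ∀ α → deg α ℕ.< n → f α ≡ + 0

    order-⊗ : ∀ {k n f g} → Order k f → Order n g → Order (k ℕ.+ n) (f ⊗ g)
    order-⊗ {k} {n} {f} {g} p q α d = ⊗-vanish f g α go
      where
      go : ∀ β γ → β ⊞ γ ≡ α → f β ≡ + 0 ⊎ g γ ≡ + 0
      go β γ e with deg β ℕ.<? k
      ... | yes b = inj₁ (p β b)
      ... | no b = inj₂ (q γ (ℕP.+-cancelˡ-< k _ _ (ℕP.≤-<-trans (ℕP.+-monoˡ-≤ (deg γ) (ℕP.≮⇒≥ b))
              (≡.subst (ℕ._< k ℕ.+ n) (≡.trans (≡.cong deg (≡.sym e)) (deg-⊞ β γ)) d))))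

    order-0 : ∀ {f} → Order 0 f
    order-0 α ()

    filtration : Filtration (series m) _
    filtration = record
      { Ord = Order
      ; resp = λ eq h α d → ≡.trans (≡.sym (eq α)) (h α d)
      ; ord-0 = λ α _ → 𝟘≈ α
      ; ord-+ = λ p q α d → ≡.cong₂ ℤ._+_ (p α d) (q α d)
      ; ord-* = λ {n} {x} y h → order-⊗ {0} {n} {y} {x} (order-0 {y}) h
      ; ord-z = λ f → order-0 {f} }

  module Total {m} = Degree {m} Vec.sum sum-⊞

  pow-order : ∀ {m} (s : FPS m) → Total.Order 1 s → ∀ n → Total.Order n (pow s n)
  pow-order s h zero = λ _ ()
  pow-order s h (suc n) = Total.order-⊗ {k = 1} {n = n} {f = s} {g = pow s n} h (pow-order s h n)

  module Geometric {m} (s : FPS m) (s-small : Total.Order 1 s) where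

    open Ring m hiding (_≈_)

    geo : ℕ → FPS m
    geo zero = 𝟘
    geo (suc n) = 𝟙 ⊕ s ⊗ geo n

    geo-inv : ∀ n → (𝟙 ⊖ s) ⊗ geo n ≈ 𝟙 ⊖ pow s n
    geo-inv zero = solve 1 (λ s → (:1 :- s) :* :0 := :1 :- :1) refl s
    geo-inv (suc n) = trans (solve 2 (λ s g → (:1 :- s) :* (:1 :+ s :* g) := (:1 :- s) :+ s :* ((:1 :- s) :* g)) refl s (geo n))
      (trans (+-congˡ {𝟙 ⊖ s} (*-congˡ {s} (geo-inv n))) (solve 2 (λ s p → (:1 :- s) :+ s :* (:1 :- p) := :1 :- s :* p) refl s (pow s n)))

    Σ-pow : ℕ → ℕ → FPS m
    Σ-pow i zero = 𝟘
    Σ-pow i (suc n) = pow s i ⊕ Σ-pow (suc i) n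

    Σ-pow-suc : ∀ i n → Σ-pow (suc i) n ≈ s ⊗ Σ-pow i n
    Σ-pow-suc i zero = sym (zeroʳ s)
    Σ-pow-suc i (suc n) = trans (+-congˡ {pow s (suc i)} (Σ-pow-suc (suc i) n)) (sym (distribˡ s (pow s i) (Σ-pow (suc i) n)))

    geo-Σ : ∀ n → geo n ≈ Σ-pow 0 n
    geo-Σ zero = refl
    geo-Σ (suc n) = +-congˡ {𝟙} (trans (*-congˡ {s} (geo-Σ n)) (sym (Σ-pow-suc 0 n)))

    Σ-pow-coeff : ∀ i n α → Σ-pow i n α ≡ Σ< n (λ k → pow s (i ℕ.+ k) α)
    Σ-pow-coeff i zero α = 𝟘≈ α
    Σ-pow-coeff i (suc n) α = ≡.cong₂ ℤ._+_ (≡.cong (λ j → pow s j α) (≡.sym (ℕP.+-identityʳ i)))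
      (≡.trans (Σ-pow-coeff (suc i) n α) (Σ<-cong n (λ k _ → ≡.cong (λ j → pow s j α) (≡.sym (ℕP.+-suc i k)))))

    inv1m-geo : ∀ n α → Vec.sum α ℕ.< n → inv1m s α ≡ geo n α
    inv1m-geo n α p = ≡.trans (≡.cong sumℤ (map-upTo (λ k → pow s k α) (suc (Vec.sum α))))
      (≡.sym (≡.trans (geo-Σ n α) (≡.trans (Σ-pow-coeff 0 n α) (Σ<-extend (suc (Vec.sum α)) n p (λ k q → pow-order s s-small k α q)))))

    -- At a fixed exponent α the series may be replaced by its partial sum up to the total degree of
    -- α, and the remaining power of s has too high an order to be seen at α.
    inv1m-inverse : inv1m s ⊗ (𝟙 ⊖ s) ≈ 𝟙
    inv1m-inverse α = ≡.trans (*-comm (inv1m s) (𝟙 ⊖ s) α) (≡.trans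
      (⊗-local (𝟙 ⊖ s) (inv1m s) (𝟙 ⊖ s) (geo n) α (λ β γ e → ≡.cong (λ z → (𝟙 ⊖ s) β ℤ.* z)
        (inv1m-geo n γ (ℕ.s≤s (≡.subst (Vec.sum γ ℕ.≤_) (≡.trans (≡.sym (sum-⊞ β γ)) (≡.cong Vec.sum e)) (ℕP.m≤n+m _ _))))))
      (≡.trans (geo-inv n α) (≡.trans (≡.cong (λ z → 𝟙 α ℤ.+ ℤ.- z) (pow-order s s-small n α (ℕP.n<1+n _))) (ℤP.+-identityʳ _))))
      where n = suc (Vec.sum α)

  unit-reg : ∀ {m} {r s : FPS m} → s ⊗ r ≈ 𝟙 → BinaryForms.Reg (series m) r
  unit-reg {m} {r} {s} inv z rz = trans (sym (*-identityˡ z)) (trans (*-congʳ (sym inv)) (trans (*-assoc s r z) (trans (*-congˡ {s} rz) (zeroʳ s))))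
    where open Ring m hiding (_≈_)

  private
    tab-0 : ∀ m → tabulate {n = m} (λ _ → 0) ≡ zeroV
    tab-0 zero = ≡.refl
    tab-0 (suc m) = ≡.cong (0 ∷_) (tab-0 m)

  module _ {m : ℕ} where
    open Ring m hiding (_≈_)
    open Cauchy (series m)

    conv-head : ∀ a (F G : ℕ → FPS m) → (∀ k → F (suc k) ≈ 𝟘) → conv a F G ≈ F 0 ⊗ G a
    conv-head zero F G h = refl
    conv-head (suc a) F G h = trans (+-congˡ {F 0 ⊗ G (suc a)} (trans (conv-cong a {tail F} {λ _ → 𝟘} {G} {G} h (λ _ → refl)) (conv-0 a G)))
      (+-identityʳ (F 0 ⊗ G (suc a)))

  var0-at : ∀ {m} → (var {suc m} Fin.zero at 1) ≈ 𝟙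
  var0-at {m} α = ≡.cong (λ v → if eqVec α v then + 1 else + 0) (tab-0 m)

  var-inc : ∀ {m} (i : Fin m) f α → (var i ⊗ f) (updateAt α i suc) ≡ f α
  var-inc {suc m} Fin.zero f (a ∷ α) = ≡.trans (Step.⊗-conv (mul m) (var Fin.zero) f (suc a) α) (≡.trans
    (≡.cong₂ ℤ._+_ (trans (*-congʳ {f at suc a} v0) (zeroˡ (f at suc a)) α)
      (trans (conv-head a (tail v) (f at_) (λ k α → ≡.sym (𝟘≈ α))) (trans (*-congʳ {f at a} (var0-at {m})) (*-identityˡ (f at a))) α))
    (≡.trans (≡.cong (λ z → z ℤ.+ f (a ∷ α)) (𝟘≈ α)) (ℤP.+-identityˡ _)))
    where
    open Ring m hiding (_≈_)
    open Cauchy (series m)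
    v : ℕ → FPS m
    v = var {suc m} Fin.zero at_
    v0 : v 0 ≈ 𝟘
    v0 α = ≡.sym (𝟘≈ α)
  var-inc {suc m} (Fin.suc i) f (a ∷ α) = ≡.trans (Step.⊗-conv (mul m) (var (Fin.suc i)) f a (updateAt α i suc))
    (≡.trans (conv-head a (var (Fin.suc i) at_) (f at_) (λ k α → ≡.sym (𝟘≈ α)) (updateAt α i suc)) (var-inc i (f at a) α))

  var-zero : ∀ {m} (i : Fin m) f α → lookup α i ≡ 0 → (var i ⊗ f) α ≡ + 0
  var-zero {suc m} Fin.zero f (zero ∷ α) _ = ≡.trans (Step.⊗-conv (mul m) (var Fin.zero) f 0 α)
    (≡.trans (trans (*-congʳ {f at 0} v0) (zeroˡ (f at 0)) α) (𝟘≈ α))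
    where
    open Ring m hiding (_≈_)
    v0 : (var {suc m} Fin.zero at 0) ≈ 𝟘
    v0 α = ≡.sym (𝟘≈ α)
  var-zero {suc m} (Fin.suc i) f (a ∷ α) z = ≡.trans (Step.⊗-conv (mul m) (var (Fin.suc i)) f a α)
    (≡.trans (conv-head a (var (Fin.suc i) at_) (f at_) (λ k α → ≡.sym (𝟘≈ α)) α) (var-zero i (f at a) α z))

  data Exponent {m} (i : Fin m) (α : Vec ℕ m) : Set where
    none : lookup α i ≡ 0 → Exponent i α
    some : ∀ β → α ≡ updateAt β i suc → Exponent i α

  exponent : ∀ {m} (i : Fin m) α → Exponent i α
  exponent Fin.zero (zero ∷ α) = none ≡.refl
  exponent Fin.zero (suc a ∷ α) = some (a ∷ α) ≡.refl
  exponent (Fin.suc i) (a ∷ α) with exponent i α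
  ... | none z = none z
  ... | some β ≡.refl = some (a ∷ β) ≡.refl

  inc-comm : ∀ {m} (i j : Fin m) α → updateAt (updateAt α i suc) j suc ≡ updateAt (updateAt α j suc) i suc
  inc-comm Fin.zero Fin.zero (a ∷ α) = ≡.refl
  inc-comm Fin.zero (Fin.suc j) (a ∷ α) = ≡.refl
  inc-comm (Fin.suc i) Fin.zero (a ∷ α) = ≡.refl
  inc-comm (Fin.suc i) (Fin.suc j) (a ∷ α) = ≡.cong (a ∷_) (inc-comm i j α)

  lookup-inc≢ : ∀ {m} (i j : Fin m) α → i ≢ j → lookup (updateAt α i suc) j ≡ lookup α j
  lookup-inc≢ Fin.zero Fin.zero α ne = ⊥-elim (ne ≡.refl)
  lookup-inc≢ Fin.zero (Fin.suc j) (a ∷ α) ne = ≡.refl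
  lookup-inc≢ (Fin.suc i) Fin.zero (a ∷ α) ne = ≡.refl
  lookup-inc≢ (Fin.suc i) (Fin.suc j) (a ∷ α) ne = lookup-inc≢ i j α (λ e → ne (≡.cong Fin.suc e))

  lookup-inc : ∀ {m} (i : Fin m) α → lookup (updateAt α i suc) i ≡ suc (lookup α i)
  lookup-inc Fin.zero (a ∷ α) = ≡.refl
  lookup-inc (Fin.suc i) (a ∷ α) = lookup-inc i α

  var-reg : ∀ {m} (i : Fin m) → BinaryForms.Reg (series m) (var i)
  var-reg i f h α = ≡.trans (≡.sym (var-inc i f α)) (≡.trans (h (updateAt α i suc)) (≡.trans (𝟘≈ (updateAt α i suc)) (≡.sym (𝟘≈ α))))

  -- Comparing coefficients at x_i x^α expresses f_α by the coefficient of f at x_i x^α / x_j, with a smaller exponent of x_j.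
  sub-zero : ∀ {m} (i j : Fin m) → i ≢ j → (deg : Vec ℕ m → ℕ) → (∀ α → deg (updateAt α i suc) ≡ suc (deg α)) → (∀ α → deg (updateAt α j suc) ≡ suc (deg α)) →
    ∀ n f → (∀ α → deg α ℕ.< suc n → ((var i ⊖ var j) ⊗ f) α ≡ + 0) → ∀ α → deg α ℕ.< n → f α ≡ + 0
  sub-zero {m} i j ne deg di dj n f h α d = go (lookup α j) α ≡.refl d
    where
    open Ring m hiding (_≈_)
    same : ∀ α → deg α ℕ.< n → f α ≡ (var j ⊗ f) (updateAt α i suc)
    same α d = ≡.trans (≡.sym (var-inc i f α)) (≡.trans (≡.trans (≡.sym (ℤP.+-identityʳ _))
        (≡.trans (≡.cong (λ z → (var i ⊗ f) β ℤ.+ z) (≡.sym (ℤP.+-inverseˡ ((var j ⊗ f) β)))) (≡.sym (ℤP.+-assoc ((var i ⊗ f) β) _ _))))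
      (≡.trans (≡.cong (λ z → z ℤ.+ (var j ⊗ f) β) (≡.trans (≡.sym (solve 3 (λ a b c → (a :- b) :* c := a :* c :- b :* c) refl (var i) (var j) f β))
        (h β (≡.subst (ℕ._< suc n) (≡.sym (di α)) (ℕ.s≤s d))))) (ℤP.+-identityˡ _)))
      where β = updateAt α i suc
    go : ∀ k α → lookup α j ≡ k → deg α ℕ.< n → f α ≡ + 0
    go k α e d with exponent j α
    ... | none z = ≡.trans (same α d) (var-zero j f (updateAt α i suc) (≡.trans (lookup-inc≢ i j α ne) z))
    go zero .(updateAt β j suc) e d | some β ≡.refl = ⊥-elim (absurd (≡.trans (≡.sym (lookup-inc j β)) e))
      where
      absurd : ∀ {x} → suc x ≡ 0 → _
      absurd ()
    go (suc k) .(updateAt β j suc) e d | some β ≡.refl = ≡.trans (same (updateAt β j suc) d) (≡.trans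
      (≡.cong (var j ⊗ f) (inc-comm j i β)) (≡.trans (var-inc j f (updateAt β i suc))
      (go k (updateAt β i suc) (≡.trans (lookup-inc≢ i j β ne) (ℕP.suc-injective (≡.trans (≡.sym (lookup-inc j β)) e)))
        (≡.subst (ℕ._< n) (≡.trans (dj β) (≡.sym (di β))) d))))

  sum-inc : ∀ {m} (i : Fin m) α → Vec.sum (updateAt α i suc) ≡ suc (Vec.sum α)
  sum-inc Fin.zero (a ∷ α) = ≡.refl
  sum-inc (Fin.suc i) (a ∷ α) = ≡.trans (≡.cong (a ℕ.+_) (sum-inc i α)) (ℕP.+-suc a _)

  sub-reg : ∀ {m} (i j : Fin m) → i ≢ j → BinaryForms.Reg (series m) (var i ⊖ var j)
  sub-reg i j ne f h α = ≡.trans (sub-zero i j ne Vec.sum (sum-inc i) (sum-inc j) (suc (Vec.sum α)) f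
    (λ β _ → ≡.trans (h β) (𝟘≈ β)) α (ℕP.n<1+n _)) (≡.sym (𝟘≈ α))

  torsion : ∀ {m} (f : FPS m) → f ≈ ⊝ f → f ≈ 𝟘
  torsion f h α = ≡.trans (int (f α) (h α)) (≡.sym (𝟘≈ α))
    where
    int : ∀ z → z ≡ ℤ.- z → z ≡ + 0
    int (+ zero) _ = ≡.refl

  var-order : ∀ {m} (i : Fin m) (deg : Vec ℕ m → ℕ) → (∀ α → deg (updateAt α i suc) ≡ suc (deg α)) →
    ∀ n f → (∀ α → deg α ℕ.< n → f α ≡ + 0) → ∀ α → deg α ℕ.< suc n → (var i ⊗ f) α ≡ + 0
  var-order i deg di n f h α d with exponent i α
  ... | none z = var-zero i f α z
  ... | some β ≡.refl = ≡.trans (var-inc i f β) (h β (ℕP.≤-pred (≡.subst (ℕ._< suc n) (di β) d)))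

-- Permutations and inversions.

module FinFold {c ℓ} (M : CommutativeMonoid c ℓ) where

  open CommutativeMonoid M
  open import Relation.Binary.Reasoning.Setoid setoid

  fold : ∀ {n} → (Fin n → Carrier) → Carrier
  fold {zero} f = ε
  fold {suc n} f = f Fin.zero ∙ fold (f ∘ Fin.suc)

  fold-punch : ∀ {n} (f : Fin (suc n) → Carrier) p → fold f ≈ f p ∙ fold (f ∘ punchIn p)
  fold-punch f Fin.zero = refl
  fold-punch {suc n} f (Fin.suc p) = begin
    f Fin.zero ∙ fold (f ∘ Fin.suc) ≈⟨ ∙-congˡ (fold-punch (f ∘ Fin.suc) p) ⟩
    f Fin.zero ∙ (f (Fin.suc p) ∙ fold (f ∘ Fin.suc ∘ punchIn p)) ≈⟨ assoc _ _ _ ⟨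
    (f Fin.zero ∙ f (Fin.suc p)) ∙ fold (f ∘ Fin.suc ∘ punchIn p) ≈⟨ ∙-congʳ (comm _ _) ⟩
    (f (Fin.suc p) ∙ f Fin.zero) ∙ fold (f ∘ Fin.suc ∘ punchIn p) ≈⟨ assoc _ _ _ ⟩
    f (Fin.suc p) ∙ (f Fin.zero ∙ fold (f ∘ Fin.suc ∘ punchIn p)) ∎

module Permutations where

  open import Defs hiding (_≈_)

  -- A structural witness that a function comes from `perms`; it allows induction on permutations
  -- without ever comparing functions.
  data Perm : ∀ {n} → (Fin n → Fin n) → Set where
    nil : ∀ {w : Fin 0 → Fin 0} → Perm w
    ext : ∀ {n} p {σ : Fin n → Fin n} → Perm σ → Perm (extPerm p σ)

  perms-perm : ∀ n → All Perm (perms n)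
  perms-perm zero = nil ∷ []
  perms-perm (suc n) = AllP.concat⁺ (AllP.map⁺ (All.tabulate {xs = List.allFin (suc n)} (λ {p} _ → AllP.map⁺ (All.map (ext p) (perms-perm n)))))

  module _ {c ℓ} (M : CommutativeMonoid c ℓ) where

    open CommutativeMonoid M
    open FinFold M

    fold-perm : ∀ {n} {w : Fin n → Fin n} → Perm w → (f : Fin n → Carrier) → fold (f ∘ w) ≈ fold f
    fold-perm nil f = refl
    fold-perm (ext p {σ} π) f = trans (∙-congˡ (fold-perm π (f ∘ punchIn p))) (sym (fold-punch f p))

  filterᵇ-map : ∀ {a b} {A : Set a} {B : Set b} (f : A → B) (p : B → Bool) l → List.filterᵇ p (map f l) ≡ map f (List.filterᵇ (p ∘ f) l)
  filterᵇ-map f p [] = ≡.refl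
  filterᵇ-map f p (x ∷ l) with p (f x)
  ... | true = ≡.cong (f x ∷_) (filterᵇ-map f p l)
  ... | false = filterᵇ-map f p l

  filterᵇ-true : ∀ {a} {A : Set a} (l : List A) → List.filterᵇ (λ _ → true) l ≡ l
  filterᵇ-true [] = ≡.refl
  filterᵇ-true (x ∷ l) = ≡.cong (x ∷_) (filterᵇ-true l)

  allFin-suc : ∀ n → List.allFin (suc n) ≡ Fin.zero ∷ map Fin.suc (List.allFin n)
  allFin-suc n = ≡.cong (Fin.zero ∷_) (≡.sym (map-tabulate (λ i → i) Fin.suc))

  suc² : ∀ {n} → Fin n × Fin n → Fin (suc n) × Fin (suc n)
  suc² (i , j) = Fin.suc i , Fin.suc j

  pairs-suc : ∀ n → pairs (suc n) ≡ map (λ j → Fin.zero , Fin.suc j) (List.allFin n) List.++ map suc² (pairs n)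
  pairs-suc n = ≡.trans (≡.cong (List.concatMap row) (allFin-suc n)) (≡.cong₂ List._++_ head
      (≡.trans (concatMap-map row Fin.suc (List.allFin n)) (≡.trans (concatMap-cong rows (List.allFin n)) (≡.sym (map-concatMap suc² row′ (List.allFin n))))))
    where
    row : Fin (suc n) → List (Fin (suc n) × Fin (suc n))
    row i = map (λ j → (i , j)) (List.filterᵇ (λ j → toℕ i ℕ.<ᵇ toℕ j) (List.allFin (suc n)))
    row′ : Fin n → List (Fin n × Fin n)
    row′ i = map (λ j → (i , j)) (List.filterᵇ (λ j → toℕ i ℕ.<ᵇ toℕ j) (List.allFin n))
    head : row Fin.zero ≡ map (λ j → Fin.zero , Fin.suc j) (List.allFin n)
    head = ≡.trans (≡.cong (λ l → map (λ j → (Fin.zero , j)) (List.filterᵇ (λ j → 0 ℕ.<ᵇ toℕ j) l)) (allFin-suc n))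
      (≡.trans (≡.cong (map (λ j → (Fin.zero , j))) (≡.trans (filterᵇ-map Fin.suc (λ j → 0 ℕ.<ᵇ toℕ j) (List.allFin n)) (≡.cong (map Fin.suc) (filterᵇ-true (List.allFin n)))))
        (≡.sym (map-∘ (List.allFin n))))
    rows : ∀ i → row (Fin.suc i) ≡ map suc² (row′ i)
    rows i = ≡.trans (≡.cong (λ l → map (λ j → (Fin.suc i , j)) (List.filterᵇ (λ j → suc (toℕ i) ℕ.<ᵇ toℕ j) l)) (allFin-suc n))
      (≡.trans (≡.cong (map (λ j → (Fin.suc i , j))) (filterᵇ-map Fin.suc (λ j → suc (toℕ i) ℕ.<ᵇ toℕ j) (List.allFin n)))
        (≡.trans (≡.sym (map-∘ _)) (map-∘ _)))

  count : ∀ {a} {A : Set a} → (A → Bool) → List A → ℕ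
  count b l = length (List.filterᵇ b l)

  count-++ : ∀ {a} {A : Set a} (b : A → Bool) l l' → count b (l List.++ l') ≡ count b l ℕ.+ count b l'
  count-++ b [] l' = ≡.refl
  count-++ b (x ∷ l) l' with b x
  ... | true = ≡.cong suc (count-++ b l l')
  ... | false = count-++ b l l'

  count-map : ∀ {a b} {A : Set a} {B : Set b} (f : A → B) (p : B → Bool) l → count p (map f l) ≡ count (p ∘ f) l
  count-map f p [] = ≡.refl
  count-map f p (x ∷ l) with p (f x)
  ... | true = ≡.cong suc (count-map f p l)
  ... | false = count-map f p l

  count-cong : ∀ {a} {A : Set a} {b b' : A → Bool} → (∀ x → b x ≡ b' x) → ∀ l → count b l ≡ count b' l
  count-cong h [] = ≡.refl
  count-cong {b = b} {b'} h (x ∷ l) with b x | b' x | h x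
  ... | true | true | _ = ≡.cong suc (count-cong h l)
  ... | false | false | _ = count-cong h l

  open FinFold ℕP.+-0-commutativeMonoid

  bit : Bool → ℕ
  bit b = if b then 1 else 0

  count-fold : ∀ {n} {A : Set} (b : A → Bool) (f : Fin n → A) → count b (List.tabulate f) ≡ fold (λ i → bit (b (f i)))
  count-fold {zero} b f = ≡.refl
  count-fold {suc n} b f with b (f Fin.zero)
  ... | true = ≡.cong suc (count-fold b (f ∘ Fin.suc))
  ... | false = count-fold b (f ∘ Fin.suc)

  -- `punchIn p` omits only the value p, so all values below p are attained.
  count-below : ∀ {n} (p : Fin (suc n)) → fold (λ j → bit (toℕ (punchIn p j) ℕ.<ᵇ toℕ p)) ≡ toℕ p
  count-below {n} Fin.zero = zeros n
    where
    zeros : ∀ n → fold {n} (λ _ → 0) ≡ 0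
    zeros zero = ≡.refl
    zeros (suc n) = zeros n
  count-below {suc n} (Fin.suc p) = ≡.cong suc (count-below p)

  punchIn-<ᵇ : ∀ {n} (p : Fin (suc n)) i j → (toℕ (punchIn p i) ℕ.<ᵇ toℕ (punchIn p j)) ≡ (toℕ i ℕ.<ᵇ toℕ j)
  punchIn-<ᵇ Fin.zero i j = ≡.refl
  punchIn-<ᵇ (Fin.suc p) Fin.zero Fin.zero = ≡.refl
  punchIn-<ᵇ (Fin.suc p) Fin.zero (Fin.suc j) = ≡.refl
  punchIn-<ᵇ (Fin.suc p) (Fin.suc i) Fin.zero = ≡.refl
  punchIn-<ᵇ (Fin.suc p) (Fin.suc i) (Fin.suc j) = punchIn-<ᵇ p i j

  -- The first value p is inverted with exactly the smaller values, all of which come later; the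
  -- other inversions are those of σ because `punchIn p` is monotone.
  inversions-ext : ∀ {n} p {σ : Fin n → Fin n} → Perm σ → inversions (extPerm p σ) ≡ toℕ p ℕ.+ inversions σ
  inversions-ext {n} p {σ} π = ≡.trans (≡.cong (count inv) (pairs-suc n)) (≡.trans
    (count-++ inv (map (λ j → Fin.zero , Fin.suc j) (List.allFin n)) (map suc² (pairs n)))
    (≡.cong₂ ℕ._+_
      (≡.trans (count-map (λ j → Fin.zero , Fin.suc j) inv (List.allFin n)) (≡.trans (count-fold (λ j → toℕ (punchIn p (σ j)) ℕ.<ᵇ toℕ p) (λ j → j))
        (≡.trans (fold-perm ℕP.+-0-commutativeMonoid π (λ j → bit (toℕ (punchIn p j) ℕ.<ᵇ toℕ p))) (count-below p))))
      (≡.trans (count-map suc² inv (pairs n)) (count-cong (λ (i , j) → punchIn-<ᵇ p (σ j) (σ i)) (pairs n)))))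
    where
    inv : Fin (suc n) × Fin (suc n) → Bool
    inv (i , j) = toℕ (extPerm p σ j) ℕ.<ᵇ toℕ (extPerm p σ i)

-- Signed sums of series.

module Alternation (N : ℕ) where

  open import Defs
  open SeriesRing
  open SeriesVariables
  open Permutations
  open RingKit (series (suc (suc N))) hiding (_≈_)
  open Alternants (series (suc (suc N)))

  S : Set
  S = Ser N

  neg^ : ℕ → S → S
  neg^ zero f = f
  neg^ (suc n) f = ⊝ neg^ n f

  scale-neg^ : ∀ n f → scale (if evenᵇ n then + 1 else ℤ.- (+ 1)) f ≈ neg^ n f
  scale-neg^ zero f α = ℤP.*-identityˡ (f α)
  scale-neg^ (suc zero) f α = ℤP.-1*i≡-i (f α)
  scale-neg^ (suc (suc n)) f α = ≡.trans (scale-neg^ n f α) (≡.sym (ℤP.neg-involutive (neg^ n f α)))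

  neg^-+ : ∀ m n f → neg^ (m ℕ.+ n) f ≈ neg^ m (neg^ n f)
  neg^-+ zero n f = refl
  neg^-+ (suc m) n f = -‿cong (neg^-+ m n f)

  neg^-cong : ∀ n {f g} → f ≈ g → neg^ n f ≈ neg^ n g
  neg^-cong zero h = h
  neg^-cong (suc n) h = -‿cong (neg^-cong n h)

  neg^-* : ∀ n f g → f ⊗ neg^ n g ≈ neg^ n (f ⊗ g)
  neg^-* zero f g = refl
  neg^-* (suc n) f g = trans (sym (-‿distribʳ-* f (neg^ n g))) (-‿cong (neg^-* n f g))

  neg^-⊕ : ∀ n f g → neg^ n (f ⊕ g) ≈ neg^ n f ⊕ neg^ n g
  neg^-⊕ zero f g = refl
  neg^-⊕ (suc n) f g = trans (-‿cong (neg^-⊕ n f g)) (sym (-‿+-comm (neg^ n f) (neg^ n g)))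

  neg^-0 : ∀ n → neg^ n 𝟘 ≈ 𝟘
  neg^-0 zero = refl
  neg^-0 (suc n) = trans (-‿cong (neg^-0 n)) -0#≈0#

  sumF-cong : ∀ {a} {A : Set a} {f g : A → S} {l} → All (λ x → f x ≈ g x) l → sumF (map f l) ≈ sumF (map g l)
  sumF-cong [] = refl
  sumF-cong (p ∷ ps) = +-cong p (sumF-cong ps)

  sumF-tab : ∀ {n} {f g : Fin n → S} → (∀ i → f i ≈ g i) → sumF (List.tabulate f) ≈ sumF (List.tabulate g)
  sumF-tab {zero} h = refl
  sumF-tab {suc n} h = +-cong (h Fin.zero) (sumF-tab (h ∘ Fin.suc))

  sumF-tab-neg : ∀ {n} (f : Fin n → S) → sumF (List.tabulate (λ i → ⊝ f i)) ≈ ⊝ sumF (List.tabulate f)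
  sumF-tab-neg {zero} f = sym -0#≈0#
  sumF-tab-neg {suc n} f = trans (+-congˡ {⊝ f Fin.zero} (sumF-tab-neg (f ∘ Fin.suc))) (-‿+-comm (f Fin.zero) _)

  sumF-++ : ∀ l l' → sumF (l List.++ l') ≈ sumF l ⊕ sumF l'
  sumF-++ [] l' = sym (+-identityˡ (sumF l'))
  sumF-++ (x ∷ l) l' = trans (+-congˡ {x} (sumF-++ l l')) (sym (+-assoc x (sumF l) (sumF l')))

  sumF-concatMap : ∀ {a b} {A : Set a} {B : Set b} (h : B → S) (ψ : A → List B) l →
    sumF (map h (List.concatMap ψ l)) ≈ sumF (map (λ x → sumF (map h (ψ x))) l)
  sumF-concatMap h ψ [] = refl
  sumF-concatMap h ψ (x ∷ l) = trans (reflexive (≡.cong sumF (map-++ h (ψ x) _)))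
    (trans (sumF-++ (map h (ψ x)) _) (+-congˡ {sumF (map h (ψ x))} (sumF-concatMap h ψ l)))

  sumF-linear : ∀ {a} {A : Set a} n k (f : A → S) l → sumF (map (λ x → neg^ n (k ⊗ f x)) l) ≈ neg^ n (k ⊗ sumF (map f l))
  sumF-linear n k f [] = sym (trans (neg^-cong n (zeroʳ k)) (neg^-0 n))
  sumF-linear n k f (x ∷ l) = trans (+-congˡ {neg^ n (k ⊗ f x)} (sumF-linear n k f l))
    (trans (sym (neg^-⊕ n (k ⊗ f x) _)) (neg^-cong n (sym (distribˡ k (f x) (sumF (map f l))))))

  -- The sign in `alt` is the parity of the picked position. This form meets sums over `perms`;
  -- `alt-vec` meets the row expansion of `pfaffian`.
  alt-tab : ∀ {a} {P : Set a} n (φ : P → List P → S) (X : Fin (suc n) → P) →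
    alt φ (List.tabulate X) ≈ sumF (List.tabulate (λ p → neg^ (toℕ p) (φ (X p) (List.tabulate (X ∘ punchIn p)))))
  alt-tab zero φ X = +-congˡ {φ (X Fin.zero) []} -0#≈0#
  alt-tab (suc n) φ X = +-congˡ {φ (X Fin.zero) (List.tabulate (X ∘ Fin.suc))} (trans (-‿cong (alt-tab n (λ y ys → φ y (X Fin.zero ∷ ys)) (X ∘ Fin.suc)))
    (sym (sumF-tab-neg (λ p → neg^ (toℕ p) (φ (X (Fin.suc p)) (X Fin.zero ∷ List.tabulate (X ∘ Fin.suc ∘ punchIn p)))))))

  alt-vec : ∀ {a} {P : Set a} n (φ : P → List P → S) (v : Vec P (suc n)) →
    alt φ (Vec.toList v) ≈ sumF (List.tabulate (λ p → neg^ (toℕ p) (φ (lookup v p) (Vec.toList (Vec.removeAt v p)))))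
  alt-vec zero φ (x ∷ []) = +-congˡ {φ x []} -0#≈0#
  alt-vec (suc n) φ (x ∷ y ∷ v) = +-congˡ {φ x (Vec.toList (y ∷ v))} (trans (-‿cong (alt-vec n (λ z zs → φ z (x ∷ zs)) (y ∷ v)))
    (sym (sumF-tab-neg (λ p → neg^ (toℕ p) (φ (lookup (y ∷ v) p) (x ∷ Vec.toList (Vec.removeAt (y ∷ v) p)))))))

-- The permutation sum in the definition of Hall-Littlewood polynomials as an iterated signed sum.

module Numerator (N : ℕ) where

  open import Defs
  open SeriesRing
  open SeriesVariables
  open Permutations
  open Alternation N
  open RingKit (series (suc (suc N))) hiding (_≈_)
  open Alternants (series (suc (suc N)))
  open FinFold *-commutativeMonoid

  t : S
  t = tV

  prodF-fold : ∀ {n} (f : Fin n → S) → prodF (map f (List.allFin n)) ≡ fold f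
  prodF-fold f = ≡.trans (≡.cong prodF (map-tabulate (λ i → i) f)) (go f)
    where
    go : ∀ {n} (f : Fin n → S) → prodF (List.tabulate f) ≡ fold f
    go {zero} f = ≡.refl
    go {suc n} f = ≡.cong (f Fin.zero ⊗_) (go (f ∘ Fin.suc))

  ∏-tab : ∀ {a} {P : Set a} {n} (f : P → S) (X : Fin n → P) → ∏ f (List.tabulate X) ≡ fold (f ∘ X)
  ∏-tab {n = zero} f X = ≡.refl
  ∏-tab {n = suc n} f X = ≡.cong (f (X Fin.zero) ⊗_) (∏-tab f (X ∘ Fin.suc))

  prodF-++ : ∀ l l' → prodF (l List.++ l') ≈ prodF l ⊗ prodF l'
  prodF-++ [] l' = sym (*-identityˡ (prodF l'))
  prodF-++ (x ∷ l) l' = trans (*-congˡ {x} (prodF-++ l l')) (sym (*-assoc x (prodF l) (prodF l')))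

  prodF-pairs : ∀ n (f : Fin (suc n) × Fin (suc n) → S) →
    prodF (map f (pairs (suc n))) ≈ fold (λ j → f (Fin.zero , Fin.suc j)) ⊗ prodF (map (f ∘ suc²) (pairs n))
  prodF-pairs n f = trans (reflexive (≡.cong prodF (≡.trans (≡.cong (map f) (pairs-suc n)) (map-++ f (map (λ j → Fin.zero , Fin.suc j) (List.allFin n)) (map suc² (pairs n))))))
    (trans (prodF-++ (map f (map (λ j → Fin.zero , Fin.suc j) (List.allFin n))) (map f (map suc² (pairs n))))
      (*-cong (reflexive (≡.trans (≡.cong prodF (≡.sym (map-∘ (List.allFin n)))) (prodF-fold (λ j → f (Fin.zero , Fin.suc j)))))
              (reflexive (≡.cong prodF (≡.sym (map-∘ (pairs n)))))))

  term : ∀ {n} → Vec ℕ n → (Fin n → S) → S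
  term {n} μ Y = fold (λ i → pow (Y i) (lookup μ i)) ⊗ prodF (map (λ p → Y (proj₁ p) ⊖ t ⊗ Y (proj₂ p)) (pairs n))

  term-∷ : ∀ {n} a (μ : Vec ℕ n) Y → term (a ∷ μ) Y ≈
    (pow (Y Fin.zero) a ⊗ fold (λ j → Y Fin.zero ⊖ t ⊗ Y (Fin.suc j))) ⊗ term μ (Y ∘ Fin.suc)
  term-∷ {n} a μ Y = trans (*-congˡ {fold (λ i → pow (Y i) (lookup (a ∷ μ) i))} (prodF-pairs n (λ p → Y (proj₁ p) ⊖ t ⊗ Y (proj₂ p))))
    (solve 4 (λ p q r s → (p :* q) :* (r :* s) := (p :* r) :* (q :* s)) refl
      (pow (Y Fin.zero) a) (fold (λ i → pow (Y (Fin.suc i)) (lookup μ i))) (fold (λ j → Y Fin.zero ⊖ t ⊗ Y (Fin.suc j)))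
      (prodF (map (λ p → Y (Fin.suc (proj₁ p)) ⊖ t ⊗ Y (Fin.suc (proj₂ p))) (pairs n))))

  alternant : ∀ {n} → Vec ℕ n → (Fin n → S) → S
  alternant {n} μ X = sumF (map (λ w → scale (sign w) (term μ (X ∘ w))) (perms n))

  open BinaryForms (series (suc (suc N))) using (_^_)

  pow-^ : ∀ x n → pow x n ≡ x ^ n
  pow-^ x zero = ≡.refl
  pow-^ x (suc n) = ≡.cong (x ⊗_) (pow-^ x n)

  module _ (num : List ℕ → List S → S) (num-[] : num [] [] ≈ 𝟙)
    (num-∷ : ∀ a μ l → num (a ∷ μ) l ≈ alt (λ y ys → y ^ a ⊗ ∏ (λ z → y ⊖ t ⊗ z) ys ⊗ num μ ys) l) where

    -- Permutations are grouped by their first value p. The sign splits as (-1)^p times the sign of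
    -- σ, and the factors X p - t z do not depend on σ because their product runs over all remaining
    -- variables.
    alternant-num : ∀ {n} (μ : Vec ℕ n) X → alternant μ X ≈ num (Vec.toList μ) (List.tabulate X)
    alternant-num [] X = trans (trans (+-identityʳ _) (trans (scale-neg^ 0 _) (*-identityˡ 𝟙))) (sym num-[])
    alternant-num {suc n} (a ∷ μ) X = begin
      alternant (a ∷ μ) X ≈⟨ sumF-concatMap _ (λ p → map (extPerm p) (perms n)) (List.allFin (suc n)) ⟩
      sumF (map (λ p → sumF (map h (map (extPerm p) (perms n)))) (List.allFin (suc n)))
        ≈⟨ reflexive (≡.cong sumF (map-tabulate (λ i → i) (λ p → sumF (map h (map (extPerm p) (perms n)))))) ⟩
      sumF (List.tabulate (λ p → sumF (map h (map (extPerm p) (perms n))))) ≈⟨ sumF-tab each ⟩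
      sumF (List.tabulate (λ p → neg^ (toℕ p) (X p ^ a ⊗ ∏ (λ z → X p ⊖ t ⊗ z) (rest p) ⊗ num (Vec.toList μ) (rest p))))
        ≈⟨ alt-tab n (λ y ys → y ^ a ⊗ ∏ (λ z → y ⊖ t ⊗ z) ys ⊗ num (Vec.toList μ) ys) X ⟨
      alt (λ y ys → y ^ a ⊗ ∏ (λ z → y ⊖ t ⊗ z) ys ⊗ num (Vec.toList μ) ys) (List.tabulate X) ≈⟨ num-∷ a (Vec.toList μ) (List.tabulate X) ⟨
      num (a ∷ Vec.toList μ) (List.tabulate X) ∎
      where
      h : (Fin (suc n) → Fin (suc n)) → S
      h w = scale (sign w) (term (a ∷ μ) (X ∘ w))
      rest : Fin (suc n) → List S
      rest p = List.tabulate (X ∘ punchIn p)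
      coeff : Fin (suc n) → S
      coeff p = X p ^ a ⊗ ∏ (λ z → X p ⊖ t ⊗ z) (rest p)
      single : ∀ p {σ} → Perm σ → h (extPerm p σ) ≈ neg^ (toℕ p) (coeff p ⊗ scale (sign σ) (term μ (X ∘ punchIn p ∘ σ)))
      single p {σ} π = begin
        h (extPerm p σ) ≈⟨ scale-neg^ (inversions (extPerm p σ)) _ ⟩
        neg^ (inversions (extPerm p σ)) (term (a ∷ μ) (X ∘ extPerm p σ))
          ≈⟨ reflexive (≡.cong (λ m → neg^ m (term (a ∷ μ) (X ∘ extPerm p σ))) (inversions-ext p π)) ⟩
        neg^ (toℕ p ℕ.+ inversions σ) (term (a ∷ μ) (X ∘ extPerm p σ)) ≈⟨ neg^-+ (toℕ p) (inversions σ) _ ⟩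
        neg^ (toℕ p) (neg^ (inversions σ) (term (a ∷ μ) (X ∘ extPerm p σ)))
          ≈⟨ neg^-cong (toℕ p) (trans (neg^-cong (inversions σ) (trans (term-∷ a μ (X ∘ extPerm p σ)) (*-congʳ {term μ (X ∘ punchIn p ∘ σ)} (*-cong (reflexive (pow-^ (X p) a))
               (trans (fold-perm *-commutativeMonoid π (λ j → X p ⊖ t ⊗ X (punchIn p j))) (reflexive (≡.sym (∏-tab (λ z → X p ⊖ t ⊗ z) (X ∘ punchIn p)))))))))
               (sym (neg^-* (inversions σ) (coeff p) (term μ (X ∘ punchIn p ∘ σ))))) ⟩
        neg^ (toℕ p) (coeff p ⊗ neg^ (inversions σ) (term μ (X ∘ punchIn p ∘ σ)))
          ≈⟨ neg^-cong (toℕ p) (*-congˡ {coeff p} (scale-neg^ (inversions σ) _)) ⟨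
        neg^ (toℕ p) (coeff p ⊗ scale (sign σ) (term μ (X ∘ punchIn p ∘ σ))) ∎
      each : ∀ p → sumF (map h (map (extPerm p) (perms n))) ≈ neg^ (toℕ p) (coeff p ⊗ num (Vec.toList μ) (rest p))
      each p = begin
        sumF (map h (map (extPerm p) (perms n))) ≈⟨ reflexive (≡.cong sumF (map-∘ (perms n))) ⟨
        sumF (map (h ∘ extPerm p) (perms n)) ≈⟨ sumF-cong (All.map (single p) (perms-perm n)) ⟩
        sumF (map (λ σ → neg^ (toℕ p) (coeff p ⊗ scale (sign σ) (term μ (X ∘ punchIn p ∘ σ)))) (perms n))
          ≈⟨ sumF-linear (toℕ p) (coeff p) (λ σ → scale (sign σ) (term μ (X ∘ punchIn p ∘ σ))) (perms n) ⟩
        neg^ (toℕ p) (coeff p ⊗ alternant μ (X ∘ punchIn p)) ≈⟨ neg^-cong (toℕ p) (*-congˡ {coeff p} (alternant-num μ (X ∘ punchIn p))) ⟩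
        neg^ (toℕ p) (coeff p ⊗ num (Vec.toList μ) (rest p)) ∎

  record Bijective {n} (w : Fin n → Fin n) : Set where
    field
      injective  : ∀ {i j} → w i ≡ w j → i ≡ j
      surjective : ∀ k → ∃ λ i → w i ≡ k

  perm-bijective : ∀ {n} {w : Fin n → Fin n} → Perm w → Bijective w
  perm-bijective nil = record { injective = λ { {()} } ; surjective = λ () }
  perm-bijective {suc n} (ext p {σ} π) = record { injective = inj ; surjective = sur }
    where
    open Bijective (perm-bijective π)
    inj : ∀ {i j} → extPerm p σ i ≡ extPerm p σ j → i ≡ j
    inj {Fin.zero} {Fin.zero} e = ≡.refl
    inj {Fin.zero} {Fin.suc j} e = ⊥-elim (FinP.punchInᵢ≢i p (σ j) (≡.sym e))
    inj {Fin.suc i} {Fin.zero} e = ⊥-elim (FinP.punchInᵢ≢i p (σ i) e)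
    inj {Fin.suc i} {Fin.suc j} e = ≡.cong Fin.suc (injective (punchIn-injective p (σ i) (σ j) e))
    sur : ∀ k → ∃ λ i → extPerm p σ i ≡ k
    sur k with p FinP.≟ k
    ... | yes e = Fin.zero , e
    ... | no ne with surjective (punchOut ne)
    ... | i , e = Fin.suc i , ≡.trans (≡.cong (punchIn p) e) (punchIn-punchOut ne)

  module Act (w : Fin N → Fin N) (bij : Bijective w) where

    open Bijective bij

    act-cong : ∀ {f g : S} → f ≈ g → act w f ≈ act w g
    act-cong h (a ∷ b ∷ xs) = h (a ∷ b ∷ tabulate (λ i → lookup xs (w i)))

    -- Multiplicativity of `act` is stated against an arbitrary cofactor h. It is then read off
    -- coefficientwise for a single variable and is closed under products by associativity, without
    -- analysing how permutations act on `splits`.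
    Substitutes : S → S → Set
    Substitutes f f' = ∀ h → act w (f ⊗ h) ≈ f' ⊗ act w h

    private
      reindex : ∀ xs i → tabulate (λ k → lookup (updateAt xs (w i) suc) (w k)) ≡ updateAt (tabulate (λ k → lookup xs (w k))) i suc
      reindex xs i = ≡.trans (VecP.tabulate-cong pointwise) (VecP.tabulate∘lookup _)
        where
        pointwise : ∀ k → lookup (updateAt xs (w i) suc) (w k) ≡ lookup (updateAt (tabulate (λ k → lookup xs (w k))) i suc) k
        pointwise k with i FinP.≟ k
        ... | yes ≡.refl = ≡.trans (lookup-inc (w i) xs) (≡.sym (≡.trans (lookup-inc i (tabulate (λ k → lookup xs (w k)))) (≡.cong suc (VecP.lookup∘tabulate (λ k → lookup xs (w k)) i))))
        ... | no ne = ≡.trans (lookup-inc≢ (w i) (w k) xs (λ e → ne (injective e)))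
               (≡.sym (≡.trans (lookup-inc≢ i k (tabulate (λ k → lookup xs (w k))) ne) (VecP.lookup∘tabulate (λ k → lookup xs (w k)) k)))

    act-x : ∀ i → Substitutes (xV i) (xV (w i))
    act-x i h (a ∷ b ∷ xs) with exponent (w i) xs
    ... | none z = ≡.trans (var-zero (Fin.suc (Fin.suc i)) h (a ∷ b ∷ tabulate (λ k → lookup xs (w k))) (≡.trans (VecP.lookup∘tabulate (λ k → lookup xs (w k)) i) z))
                    (≡.sym (var-zero (Fin.suc (Fin.suc (w i))) (act w h) (a ∷ b ∷ xs) z))
    ... | some ys ≡.refl = ≡.trans (≡.cong (λ v → (xV i ⊗ h) (a ∷ b ∷ v)) (reindex ys i))
           (≡.trans (var-inc (Fin.suc (Fin.suc i)) h (a ∷ b ∷ tabulate (λ k → lookup ys (w k))))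
             (≡.sym (var-inc (Fin.suc (Fin.suc (w i))) (act w h) (a ∷ b ∷ ys))))

    act-t : Substitutes tV tV
    act-t h (zero ∷ b ∷ xs) = ≡.trans (var-zero Fin.zero h (zero ∷ b ∷ tabulate (λ k → lookup xs (w k))) ≡.refl) (≡.sym (var-zero Fin.zero (act w h) (zero ∷ b ∷ xs) ≡.refl))
    act-t h (suc a ∷ b ∷ xs) = ≡.trans (var-inc Fin.zero h (a ∷ b ∷ tabulate (λ k → lookup xs (w k)))) (≡.sym (var-inc Fin.zero (act w h) (a ∷ b ∷ xs)))

    act-1 : Substitutes 𝟙 𝟙
    act-1 h = trans (act-cong (*-identityˡ h)) (sym (*-identityˡ (act w h)))

    act-⊗ : ∀ {f f' g g'} → Substitutes f f' → Substitutes g g' → Substitutes (f ⊗ g) (f' ⊗ g')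
    act-⊗ {f} {f'} {g} {g'} p q h = trans (act-cong (*-assoc f g h)) (trans (p (g ⊗ h)) (trans (*-congˡ {f'} (q h)) (sym (*-assoc f' g' (act w h)))))

    act-⊖ : ∀ {f f' g g'} → Substitutes f f' → Substitutes g g' → Substitutes (f ⊖ g) (f' ⊖ g')
    act-⊖ {f} {f'} {g} {g'} p q h = trans (act-cong (solve 3 (λ f g h → (f :- g) :* h := f :* h :- g :* h) refl f g h))
      (trans split (trans (+-cong (p h) (-‿cong (q h))) (solve 3 (λ f g h → f :* h :- g :* h := (f :- g) :* h) refl f' g' (act w h))))
      where
      split : act w (f ⊗ h ⊖ g ⊗ h) ≈ act w (f ⊗ h) ⊖ act w (g ⊗ h)
      split (a ∷ b ∷ xs) = ≡.refl

    act-pow : ∀ {f f'} → Substitutes f f' → ∀ n → Substitutes (pow f n) (pow f' n)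
    act-pow p zero = act-1
    act-pow {f} {f'} p (suc n) = act-⊗ {f} {f'} {pow f n} {pow f' n} p (act-pow p n)

    act-prod : ∀ {a} {A : Set a} {f f' : A → S} → (∀ x → Substitutes (f x) (f' x)) → ∀ l → Substitutes (prodF (map f l)) (prodF (map f' l))
    act-prod h [] = act-1
    act-prod {f = f} {f'} h (x ∷ l) = act-⊗ {f x} {f' x} {prodF (map f l)} {prodF (map f' l)} (h x) (act-prod h l)

    -- Surjectivity of w ensures that a nonzero exponent remains visible after reindexing.
    act-𝟙 : act w 𝟙 ≈ 𝟙
    act-𝟙 (a ∷ b ∷ xs) = ≡.cong (λ z → if (a ℕ.≡ᵇ 0) ∧ ((b ℕ.≡ᵇ 0) ∧ z) then + 1 else + 0) (eq-zero xs (zero? xs))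
      where
      eqVec-pos : ∀ {n} (xs : Vec ℕ n) k → lookup xs k ≢ 0 → eqVec xs zeroV ≡ false
      eqVec-pos (zero ∷ xs) Fin.zero ne = ⊥-elim (ne ≡.refl)
      eqVec-pos (suc x ∷ xs) k ne = ≡.refl
      eqVec-pos (zero ∷ xs) (Fin.suc k) ne = eqVec-pos xs k ne
      zero? : ∀ {n} (xs : Vec ℕ n) → (xs ≡ zeroV) ⊎ (∃ λ k → lookup xs k ≢ 0)
      zero? [] = inj₁ ≡.refl
      zero? (suc x ∷ xs) = inj₂ (Fin.zero , λ ())
      zero? (zero ∷ xs) with zero? xs
      ... | inj₁ e = inj₁ (≡.cong (0 ∷_) e)
      ... | inj₂ (k , ne) = inj₂ (Fin.suc k , ne)
      tab-zero : ∀ {n} (v : Fin n → ℕ) → (∀ k → v k ≡ 0) → tabulate v ≡ zeroV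
      tab-zero {zero} v h = ≡.refl
      tab-zero {suc n} v h = ≡.cong₂ _∷_ (h Fin.zero) (tab-zero (v ∘ Fin.suc) (h ∘ Fin.suc))
      eq-zero : ∀ xs → (xs ≡ zeroV) ⊎ (∃ λ k → lookup xs k ≢ 0) → eqVec (tabulate (λ i → lookup xs (w i))) zeroV ≡ eqVec xs zeroV
      eq-zero _ (inj₁ ≡.refl) = ≡.cong (λ v → eqVec v zeroV) (tab-zero (λ k → lookup zeroV (w k)) (λ k → VecP.lookup-replicate (w k) 0))
      eq-zero xs (inj₂ (k , ne)) with surjective k
      ... | i , ≡.refl = ≡.trans (eqVec-pos (tabulate (λ k → lookup xs (w k))) i (λ e → ne (≡.trans (≡.sym (VecP.lookup∘tabulate (λ k → lookup xs (w k)) i)) e))) (≡.sym (eqVec-pos xs (w i) ne))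

    act-substitutes : ∀ {f f'} → Substitutes f f' → act w f ≈ f'
    act-substitutes {f} {f'} p = trans (act-cong (sym (*-identityʳ f))) (trans (p 𝟙) (trans (*-congˡ {f'} act-𝟙) (*-identityʳ f')))

  hlNumerator-alternant : ∀ (μ : Vec ℕ N) → hlNumerator N μ ≈ alternant μ xV
  hlNumerator-alternant μ = sumF-cong (All.map single (perms-perm N))
    where
    single : ∀ {w} → Perm w → scale (sign w) (act w (xmono μ ⊗ prodF (map (λ { (i , j) → xV i ⊖ tV ⊗ xV j }) (pairs N))))
      ≈ scale (sign w) (term μ (xV ∘ w))
    single {w} π = scale-cong (sign w) (trans
      (act-substitutes {xmono μ ⊗ prodF (map (λ p → xV (proj₁ p) ⊖ tV ⊗ xV (proj₂ p)) (pairs N))}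
        {prodF (map (λ i → pow (xV (w i)) (lookup μ i)) (List.allFin N)) ⊗ prodF (map (λ p → xV (w (proj₁ p)) ⊖ tV ⊗ xV (w (proj₂ p))) (pairs N))}
        (act-⊗ {xmono μ} {prodF (map (λ i → pow (xV (w i)) (lookup μ i)) (List.allFin N))}
          {prodF (map (λ p → xV (proj₁ p) ⊖ tV ⊗ xV (proj₂ p)) (pairs N))} {prodF (map (λ p → xV (w (proj₁ p)) ⊖ tV ⊗ xV (w (proj₂ p))) (pairs N))}
          (act-prod {f = λ i → pow (xV i) (lookup μ i)} {λ i → pow (xV (w i)) (lookup μ i)} (λ i → act-pow {xV i} {xV (w i)} (act-x i) (lookup μ i)) (List.allFin N))
          (act-prod {f = λ p → xV (proj₁ p) ⊖ tV ⊗ xV (proj₂ p)} {λ p → xV (w (proj₁ p)) ⊖ tV ⊗ xV (w (proj₂ p))}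
            (λ (i , j) → act-⊖ {xV i} {xV (w i)} {tV ⊗ xV j} {tV ⊗ xV (w j)} (act-x i) (act-⊗ {tV} {tV} {xV j} {xV (w j)} act-t (act-x j))) (pairs N))))
      (*-congʳ {prodF (map (λ p → xV (w (proj₁ p)) ⊖ tV ⊗ xV (w (proj₂ p))) (pairs N))} (reflexive (prodF-fold (λ i → pow (xV (w i)) (lookup μ i))))))
      where
      open Act w (perm-bijective π)
      scale-cong : ∀ c {f g : S} → f ≈ g → scale c f ≈ scale c g
      scale-cong c h α = ≡.cong (λ z → c ℤ.* z) (h α)

-- Partitions with an added first column.

module PartitionLists where

  open import Defs using (decreasingᵇ; evenᵇ)

  -- Adds to the diagram of ν a first column with one box for every entry of ν, zero entries
  -- included, and then r zero parts.
  extend : ℕ → List ℕ → List ℕ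
  extend r ν = map suc ν List.++ List.replicate r 0

  maxL : List ℕ → ℕ
  maxL = List.foldr ℕ._⊔_ 0

  max-zeros : ∀ r → maxL (List.replicate r 0) ≡ 0
  max-zeros zero = ≡.refl
  max-zeros (suc r) = max-zeros r

  max-extend : ∀ r a ν → maxL (extend r (a ∷ ν)) ≡ suc (maxL (a ∷ ν))
  max-extend r a [] rewrite max-zeros r = ≡.cong suc (≡.sym (ℕP.⊔-identityʳ a))
  max-extend r a (b ∷ ν) rewrite max-extend r b ν = ≡.refl

  headᵇ : ℕ → List ℕ → Bool
  headᵇ c [] = true
  headᵇ c (x ∷ l) = x ℕ.≤ᵇ c

  decreasing-∷ : ∀ c l → decreasingᵇ (c ∷ l) ≡ decreasingᵇ l ∧ headᵇ c l
  decreasing-∷ c [] = ≡.refl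
  decreasing-∷ c (x ∷ l) with x ℕ.≤ᵇ c | decreasingᵇ (x ∷ l)
  ... | true | true = ≡.refl
  ... | true | false = ≡.refl
  ... | false | true = ≡.refl
  ... | false | false = ≡.refl

  head-extend : ∀ b r ν → headᵇ (suc b) (extend r ν) ≡ headᵇ b ν
  head-extend b zero [] = ≡.refl
  head-extend b (suc r) [] = ≡.refl
  head-extend b r (zero ∷ ν) = ≡.refl
  head-extend b r (suc x ∷ ν) = ≡.refl

  conjL : ℕ → List ℕ → ℕ
  conjL j l = length (List.filterᵇ (λ a → j ℕ.≤ᵇ a) l)

  conjEvenL : List ℕ → Bool
  conjEvenL l = List.foldr (λ j b → evenᵇ (conjL j l) ∧ b) true (map suc (List.upTo (maxL l)))

  evenᵇ-even? : ∀ n → evenᵇ n ≡ even? n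
  evenᵇ-even? zero = ≡.refl
  evenᵇ-even? (suc zero) = ≡.refl
  evenᵇ-even? (suc (suc n)) = ≡.trans (evenᵇ-even? n) (≡.sym (even?-suc² n))

  conj-extend-1 : ∀ r ν → conjL 1 (extend r ν) ≡ length ν
  conj-extend-1 zero [] = ≡.refl
  conj-extend-1 (suc r) [] = conj-extend-1 r []
  conj-extend-1 r (a ∷ ν) = ≡.cong suc (conj-extend-1 r ν)

  conj-extend-suc : ∀ j r ν → conjL (suc (suc j)) (extend r ν) ≡ conjL (suc j) ν
  conj-extend-suc j zero [] = ≡.refl
  conj-extend-suc j (suc r) [] = conj-extend-suc j r []
  conj-extend-suc j r (a ∷ ν) with j ℕ.<ᵇ a
  ... | true = ≡.cong suc (conj-extend-suc j r ν)
  ... | false = conj-extend-suc j r ν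

  -- The new first column has length `length ν`, and the later columns are those of ν.
  conjEven-extend : ∀ r ν → conjEvenL (extend r ν) ≡ even? (length ν) ∧ conjEvenL ν
  conjEven-extend r [] rewrite max-zeros r = ≡.refl
  conjEven-extend r (a ∷ ν) rewrite max-extend r a ν = ≡.cong₂ _∧_
      (≡.trans (≡.cong evenᵇ (conj-extend-1 r l)) (evenᵇ-even? (length l)))
      (≡.trans (≡.cong (List.foldr p true) shift) (go (List.upTo (maxL l))))
    where
    l = a ∷ ν
    p q : ℕ → Bool → Bool
    p j b = evenᵇ (conjL j (extend r l)) ∧ b
    q j b = evenᵇ (conjL j l) ∧ b
    shift : map suc (List.applyUpTo suc (maxL l)) ≡ map suc (map suc (List.upTo (maxL l)))
    shift = ≡.cong (map suc) (≡.sym (map-upTo suc (maxL l)))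
    go : ∀ js → List.foldr p true (map suc (map suc js)) ≡ List.foldr q true (map suc js)
    go [] = ≡.refl
    go (j ∷ js) = ≡.cong₂ _∧_ (≡.cong evenᵇ (conj-extend-suc j r l)) (go js)

  conjEven-zeros : ∀ n → conjEvenL (List.replicate n 0) ≡ true
  conjEven-zeros n = ≡.cong (λ m → List.foldr (λ j b → evenᵇ (conjL j (List.replicate n 0)) ∧ b) true (map suc (List.upTo m))) (max-zeros n)

  decreasing-zeros : ∀ n → decreasingᵇ (List.replicate n 0) ≡ true
  decreasing-zeros zero = ≡.refl
  decreasing-zeros (suc zero) = ≡.refl
  decreasing-zeros (suc (suc n)) = decreasing-zeros (suc n)

-- Sums over decreasing vectors in a box, sorted by the number of zeros.

module BoxSums {c ℓ} (R : CommutativeRing c ℓ) where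

  open import Defs using (decreasingᵇ; evenᵇ)
  open PartitionLists
  open RingKit R

  guard : Bool → Carrier → Carrier
  guard b x = if b then x else 0#

  guard-∧ : ∀ a b x → guard (a ∧ b) x ≡ guard a (guard b x)
  guard-∧ true b x = ≡.refl
  guard-∧ false b x = ≡.refl

  box : ℕ → ℕ → (List ℕ → Carrier) → Carrier
  box zero d F = F []
  box (suc n) d F = Σ≤ d (λ a → box n d (λ l → F (a ∷ l)))

  box-cong : ∀ n d {F H : List ℕ → Carrier} → (∀ l → length l ≡ n → F l ≈ H l) → box n d F ≈ box n d H
  box-cong zero d h = h [] ≡.refl
  box-cong (suc n) d h = Σ≤-cong d (λ a _ → box-cong n d (λ l e → h (a ∷ l) (≡.cong suc e)))

  Σ≤-0 : ∀ n → Σ≤ n (λ _ → 0#) ≈ 0#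
  Σ≤-0 zero = refl
  Σ≤-0 (suc n) = trans (+-identityˡ _) (Σ≤-0 n)

  box-0 : ∀ n d → box n d (λ _ → 0#) ≈ 0#
  box-0 zero d = refl
  box-0 (suc n) d = trans (Σ≤-cong d (λ _ _ → box-0 n d)) (Σ≤-0 d)

  Σ≤-swap : ∀ m n (f : ℕ → ℕ → Carrier) → Σ≤ m (λ i → Σ≤ n (f i)) ≈ Σ≤ n (λ j → Σ≤ m (λ i → f i j))
  Σ≤-swap zero n f = refl
  Σ≤-swap (suc m) n f = trans (+-congˡ (Σ≤-swap m n (f ∘ suc))) (sym (Σ≤-+ n _ _))

  Σ≤-snoc : ∀ n f → Σ≤ (suc n) f ≈ Σ≤ n f + f (suc n)
  Σ≤-snoc zero f = refl
  Σ≤-snoc (suc n) f = trans (+-congˡ (Σ≤-snoc n (f ∘ suc))) (sym (+-assoc _ _ _))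

  box-zeros : ∀ n d (F : List ℕ → Carrier) → box n d (λ l → guard (decreasingᵇ (0 ∷ l)) (F l)) ≈ F (List.replicate n 0)
  box-zeros zero d F = refl
  box-zeros (suc n) zero F = box-zeros n zero (λ l → F (0 ∷ l))
  box-zeros (suc n) (suc d) F = trans (+-cong (box-zeros n (suc d) (λ l → F (0 ∷ l)))
    (trans (Σ≤-cong d (λ _ _ → box-0 n (suc d))) (Σ≤-0 d))) (+-identityʳ _)

  decr : ℕ → ℕ → (List ℕ → Carrier) → Carrier
  decr n d F = box n d (λ l → guard (decreasingᵇ l) (F l))

  -- A decreasing vector has its zeros at the end, so it is `extend r ν` for a unique r. The
  -- induction is on the first entry: 0 forces all entries to be zero, and for `suc b` the
  -- decomposition of the rest is used.
  decr-suc : ∀ n d F → decr n (suc d) F ≈ Σ≤ n (λ r → decr (n ℕ.∸ r) d (λ ν → F (extend r ν)))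
  decr-suc zero d F = refl
  decr-suc (suc n) d F = begin
    box n (suc d) (λ l → guard (decreasingᵇ (0 ∷ l)) (F (0 ∷ l))) + Σ≤ d (λ b → box n (suc d) (λ l → guard (decreasingᵇ (suc b ∷ l)) (F (suc b ∷ l))))
      ≈⟨ +-cong (box-zeros n (suc d) (λ l → F (0 ∷ l))) (Σ≤-cong d (λ b _ → part b)) ⟩
    F (List.replicate (suc n) 0) + Σ≤ d (λ b → Σ≤ n (λ r → box (n ℕ.∸ r) d (λ ν → guard (decreasingᵇ (b ∷ ν)) (F (extend r (b ∷ ν))))))
      -- For fixed r the sum over the first entry b rebuilds a sum over decreasing vectors one
      -- longer; the all-zero vector becomes the term r = n + 1.
      ≈⟨ trans (+-comm _ _) (+-congʳ (Σ≤-swap d n _)) ⟩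
    Σ≤ n (λ r → decr (suc (n ℕ.∸ r)) d (λ ν → F (extend r ν))) + F (List.replicate (suc n) 0)
      ≈⟨ +-cong (Σ≤-cong n (λ r r≤n → reflexive (≡.cong (λ m → decr m d (λ ν → F (extend r ν))) (≡.sym (ℕP.+-∸-assoc 1 r≤n)))))
           (reflexive (≡.cong (λ m → decr m d (λ ν → F (extend (suc n) ν))) (≡.sym (ℕP.n∸n≡0 n)))) ⟩
    Σ≤ n (λ r → decr (suc n ℕ.∸ r) d (λ ν → F (extend r ν))) + decr (suc n ℕ.∸ suc n) d (λ ν → F (extend (suc n) ν)) ≈⟨ Σ≤-snoc n (λ r → decr (suc n ℕ.∸ r) d (λ ν → F (extend r ν))) ⟨
    Σ≤ (suc n) (λ r → decr (suc n ℕ.∸ r) d (λ ν → F (extend r ν))) ∎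
    where
    part : ∀ b → box n (suc d) (λ l → guard (decreasingᵇ (suc b ∷ l)) (F (suc b ∷ l)))
      ≈ Σ≤ n (λ r → box (n ℕ.∸ r) d (λ ν → guard (decreasingᵇ (b ∷ ν)) (F (extend r (b ∷ ν)))))
    part b = trans (box-cong n (suc d) (λ l _ → reflexive (≡.trans (≡.cong (λ q → guard q (F (suc b ∷ l))) (decreasing-∷ (suc b) l))
        (guard-∧ (decreasingᵇ l) (headᵇ (suc b) l) _)))) (trans (decr-suc n d (λ l → guard (headᵇ (suc b) l) (F (suc b ∷ l))))
      (Σ≤-cong n (λ r _ → box-cong (n ℕ.∸ r) d (λ ν _ → reflexive (≡.sym (≡.trans (≡.cong (λ q → guard q (F (extend r (b ∷ ν)))) (decreasing-∷ b ν))
        (≡.trans (guard-∧ (decreasingᵇ ν) (headᵇ b ν) _) (≡.cong (λ q → guard (decreasingᵇ ν) (guard q (F (extend r (b ∷ ν))))) (≡.sym (head-extend b r ν))))))))))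

  -- Both sides obey the same recursion on the number of zeros: `conjEven-extend` splits off the
  -- parity of n - r, which is the guard in `sumT`.
  box-sumT : ∀ d n F → decr n d (λ l → guard (conjEvenL l) (F l)) ≈ sumT R d n F
  box-sumT zero n F = reflexive (≡.trans (only n (λ l → guard (decreasingᵇ l) (guard (conjEvenL l) (F l))))
      (≡.cong₂ (λ a b → guard a (guard b (F (List.replicate n 0)))) (decreasing-zeros n) (conjEven-zeros n)))
    where
    only : ∀ n (H : List ℕ → Carrier) → box n 0 H ≡ H (List.replicate n 0)
    only zero H = ≡.refl
    only (suc n) H = only n (λ l → H (0 ∷ l))
  box-sumT (suc d) n F = trans (decr-suc n d _) (Σ≤-cong n (λ r _ → trans
      (box-cong (n ℕ.∸ r) d (λ ν e → reflexive (≡.cong (guard (decreasingᵇ ν)) (≡.trans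
        (≡.cong (λ q → guard q (F (extend r ν))) (≡.trans (conjEven-extend r ν) (≡.cong (λ m → even? m ∧ conjEvenL ν) e)))
        (guard-∧ (even? (n ℕ.∸ r)) (conjEvenL ν) _))))) (split r (even? (n ℕ.∸ r)))))
    where
    split : ∀ r b → decr (n ℕ.∸ r) d (λ ν → guard b (guard (conjEvenL ν) (F (extend r ν))))
      ≈ (if b then sumT R d (n ℕ.∸ r) (λ ν → F (extend r ν)) else 0#)
    split r true = box-sumT d (n ℕ.∸ r) (λ ν → F (extend r ν))
    split r false = trans (box-cong (n ℕ.∸ r) d (λ ν _ → reflexive (none (decreasingᵇ ν)))) (box-0 (n ℕ.∸ r) d)
      where
      none : ∀ b → guard b 0# ≡ 0#
      none true = ≡.refl
      none false = ≡.refl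

-- The coefficients of the left-hand side, and q-factorials as units.

module Weights (N : ℕ) where

  open import Defs
  open SeriesRing
  open SeriesVariables
  open Permutations
  open PartitionLists
  open Alternation N using (S)
  open RingKit (series (suc (suc N))) hiding (_≈_)

  t : S
  t = tV

  t-order : ∀ q → Total.Order 1 (⊝ (t ⊗ q))
  t-order q α d = ≡.cong ℤ.-_ (var-order Fin.zero Vec.sum (sum-inc Fin.zero) 0 q (λ _ ()) α d)

  -- [r+1]_t = 1 + t [r]_t is 1 - s with s = -t [r]_t of positive order, so the geometric series
  -- inverts it.
  ι : ℕ → S
  ι r = inv1m (⊝ (t ⊗ qint t r))

  ι-inv : ∀ r → ι r ⊗ qint t (suc r) ≈ 𝟙
  ι-inv r = trans (*-congˡ {ι r} (+-congˡ {𝟙} (sym (-‿involutive (t ⊗ qint t r))))) (Geometric.inv1m-inverse (⊝ (t ⊗ qint t r)) (t-order (qint t r)))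

  open ClearedIdentity (series (suc (suc N))) torsion t ι ι-inv using (g)
  open Expansion (series (suc (suc N))) torsion t ι ι-inv using (ι!)

  Π< : ℕ → (ℕ → S) → S
  Π< zero f = 𝟙
  Π< (suc n) f = f 0 ⊗ Π< n (f ∘ suc)

  Π<-cong : ∀ n {f h} → (∀ i → f i ≈ h i) → Π< n f ≈ Π< n h
  Π<-cong zero e = refl
  Π<-cong (suc n) e = *-cong (e 0) (Π<-cong n (λ i → e (suc i)))

  Π<-* : ∀ n f h → Π< n f ⊗ Π< n h ≈ Π< n (λ i → f i ⊗ h i)
  Π<-* zero f h = *-identityˡ 𝟙
  Π<-* (suc n) f h = trans (solve 4 (λ a b c d → (a :* b) :* (c :* d) := (a :* c) :* (b :* d)) refl (f 0) (Π< n (f ∘ suc)) (h 0) (Π< n (h ∘ suc)))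
    (*-congˡ {f 0 ⊗ h 0} (Π<-* n (f ∘ suc) (h ∘ suc)))

  Π<-𝟙 : ∀ n {f} → (∀ i → f i ≈ 𝟙) → Π< n f ≈ 𝟙
  Π<-𝟙 zero e = refl
  Π<-𝟙 (suc n) {f} e = trans (*-cong (e 0) (Π<-𝟙 n (λ i → e (suc i)))) (*-identityˡ 𝟙)

  Π<-last : ∀ n f → Π< (suc n) f ≈ f n ⊗ Π< n f
  Π<-last zero f = refl
  Π<-last (suc n) f = trans (*-congˡ {f 0} (Π<-last n (f ∘ suc))) (solve 3 (λ a b c → a :* (b :* c) := b :* (a :* c)) refl (f 0) (f (suc n)) (Π< n (f ∘ suc)))

  prodF-upTo : ∀ n f → prodF (map f (List.upTo n)) ≡ Π< n f
  prodF-upTo n f = ≡.trans (≡.cong prodF (map-upTo f n)) (go n f)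
    where
    go : ∀ n f → prodF (List.applyUpTo f n) ≡ Π< n f
    go zero f = ≡.refl
    go (suc n) f = ≡.cong (f 0 ⊗_) (go n (f ∘ suc))

  prodF-suc-upTo : ∀ n f → prodF (map f (map suc (List.upTo n))) ≡ Π< n (f ∘ suc)
  prodF-suc-upTo n f = ≡.trans (≡.cong prodF (≡.sym (map-∘ (List.upTo n)))) (prodF-upTo n (f ∘ suc))

  prodF-cong : ∀ {f h : ℕ → S} {l} → All (λ j → f j ≈ h j) l → prodF (map f l) ≈ prodF (map h l)
  prodF-cong [] = refl
  prodF-cong (p ∷ ps) = *-cong p (prodF-cong ps)

  geometric : ∀ k → sumF (map (pow t) (List.upTo k)) ≈ qint t k
  geometric k = trans (reflexive (≡.cong sumF (map-upTo (pow t) k))) (go k)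
    where
    shift : ∀ i k → sumF (List.applyUpTo (λ j → pow t (suc (i ℕ.+ j))) k) ≈ t ⊗ sumF (List.applyUpTo (λ j → pow t (i ℕ.+ j)) k)
    shift i zero = sym (zeroʳ t)
    shift i (suc k) = trans (+-congˡ {pow t (suc (i ℕ.+ 0))} (trans (reflexive (≡.cong sumF (apply-cong k (λ j → ≡.cong (pow t ∘ suc) (ℕP.+-suc i j)))))
        (trans (shift (suc i) k) (*-congˡ {t} (reflexive (≡.cong sumF (apply-cong k (λ j → ≡.cong (pow t) (≡.sym (ℕP.+-suc i j))))))))))
      (sym (distribˡ t (pow t (i ℕ.+ 0)) _))
      where
      apply-cong : ∀ {f h : ℕ → S} k → (∀ j → f j ≡ h j) → List.applyUpTo f k ≡ List.applyUpTo h k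
      apply-cong zero e = ≡.refl
      apply-cong (suc k) e = ≡.cong₂ _∷_ (e 0) (apply-cong k (λ j → e (suc j)))
    go : ∀ k → sumF (List.applyUpTo (pow t) k) ≈ qint t k
    go zero = refl
    go (suc k) = +-congˡ {𝟙} (trans (shift 0 k) (*-congˡ {t} (go k)))

  -- v_m(t) is the q-factorial [m]_t!, a product of the q-integers that the ι invert one by one.
  vm-inverse : ∀ m → vm m ⊗ ι! m ≈ 𝟙
  vm-inverse m = trans (*-cong (trans (reflexive (prodF-suc-upTo m (λ k → sumF (map (pow tV) (List.upTo k))))) (Π<-cong m (λ i → geometric (suc i)))) (ι!-Π m))
    (trans (Π<-* m (λ i → qint t (suc i)) ι) (Π<-𝟙 m (λ i → trans (*-comm (qint t (suc i)) (ι i)) (ι-inv i))))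
    where
    ι!-Π : ∀ m → ι! m ≈ Π< m ι
    ι!-Π zero = refl
    ι!-Π (suc m) = trans (*-congˡ {ι m} (ι!-Π m)) (sym (Π<-last m ι))

  evens-suc² : ∀ m → evensUpTo (suc (suc m)) ≡ 2 ∷ map (λ j → suc (suc j)) (evensUpTo m)
  evens-suc² m = ≡.trans (≡.cong (List.filterᵇ evenᵇ) (≡.cong (map suc) (upTo-suc² m))) (≡.cong (2 ∷_) (≡.trans
      (≡.cong (List.filterᵇ evenᵇ) (≡.trans (≡.sym (map-∘ (List.upTo m))) (map-∘ (List.upTo m))))
      (filterᵇ-map (λ j → suc (suc j)) evenᵇ (map suc (List.upTo m)))))
    where
    upTo-suc² : ∀ m → List.upTo (suc (suc m)) ≡ 0 ∷ 1 ∷ map (λ j → suc (suc j)) (List.upTo m)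
    upTo-suc² m = ≡.cong (λ l → 0 ∷ 1 ∷ l) (≡.sym (map-upTo (λ j → suc (suc j)) m))

  evens-≥2 : ∀ m → All (λ j → ∃ λ i → j ≡ suc (suc i)) (evensUpTo m)
  evens-≥2 zero = []
  evens-≥2 (suc zero) = []
  evens-≥2 (suc (suc m)) = ≡.subst (All _) (≡.sym (evens-suc² m)) ((0 , ≡.refl) ∷ AllP.map⁺ (All.map (λ { (i , ≡.refl) → suc (suc i) , ≡.refl }) (evens-≥2 m)))

  -- One family covers both products of the theorem: w = u gives the u-factor of m_0, and w = t
  -- gives the factor of b^el, as t times t^(j-2) is t^(j-1).
  E : S → ℕ → S
  E w m = prodF (map (λ j → 𝟙 ⊖ w ⊗ pow t (j ℕ.∸ 2)) (evensUpTo m))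

  E-g : ∀ m w → even? m ≡ true → E w m ≈ g true m w
  E-g zero w _ = refl
  E-g (suc (suc m)) w ev = begin
    E w (suc (suc m)) ≈⟨ reflexive (≡.cong (λ l → prodF (map (λ j → 𝟙 ⊖ w ⊗ pow t (j ℕ.∸ 2)) l)) (evens-suc² m)) ⟩
    (𝟙 ⊖ w ⊗ 𝟙) ⊗ prodF (map (λ j → 𝟙 ⊖ w ⊗ pow t (j ℕ.∸ 2)) (map (λ j → suc (suc j)) (evensUpTo m)))
      ≈⟨ *-cong (solve 1 (λ w → :1 :- w :* :1 := :1 :- w) refl w) (trans (reflexive (≡.cong prodF (≡.sym (map-∘ (evensUpTo m)))))
           (prodF-cong {λ j → 𝟙 ⊖ w ⊗ pow t j} {λ j → 𝟙 ⊖ (t ⊗ (t ⊗ w)) ⊗ pow t (j ℕ.∸ 2)} (All.map (λ { {j} (i , ≡.refl) →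
              solve 3 (λ w t p → :1 :- w :* (t :* (t :* p)) := :1 :- (t :* (t :* w)) :* p) refl w t (pow t i) }) (evens-≥2 m)))) ⟩
    (𝟙 ⊖ w) ⊗ E (t ⊗ (t ⊗ w)) m ≈⟨ *-congˡ {𝟙 ⊖ w} (trans (E-g m (t ⊗ (t ⊗ w)) (≡.trans (≡.sym (even?-suc² m)) ev)) (sym (*-identityˡ _))) ⟩
    (𝟙 ⊖ w) ⊗ (𝟙 ⊗ g true m (t ⊗ (t ⊗ w))) ∎

  multL : ℕ → List ℕ → ℕ
  multL i l = length (List.filterᵇ (λ a → a ℕ.≡ᵇ i) l)

  B : ℕ → S
  B m = prodF (map (λ j → 𝟙 ⊖ pow t (j ℕ.∸ 1)) (evensUpTo m))

  B-E : ∀ m → B m ≈ E t m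
  B-E m = prodF-cong (All.map (λ { {j} (i , ≡.refl) → refl }) (evens-≥2 m))

  belL vinvL : List ℕ → S
  belL l = Π< (maxL l) (λ i → B (multL (suc i) l))
  vinvL l = Π< (suc (maxL l)) (λ i → ι! (multL i l))

  -- The weight of a numerator: the product for the zero parts at w, then b^el, then the inverse of
  -- v_μ(t).
  cf : S → List ℕ → S
  cf w l = E w (multL 0 l) ⊗ belL l ⊗ vinvL l

  mult-zeros : ∀ r → multL 0 (List.replicate r 0) ≡ r
  mult-zeros zero = ≡.refl
  mult-zeros (suc r) = ≡.cong suc (mult-zeros r)

  mult-extend-0 : ∀ r ν → multL 0 (extend r ν) ≡ r
  mult-extend-0 r [] = mult-zeros r
  mult-extend-0 r (a ∷ ν) = mult-extend-0 r ν

  mult-extend-suc : ∀ i r ν → multL (suc i) (extend r ν) ≡ multL i ν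
  mult-extend-suc i zero [] = ≡.refl
  mult-extend-suc i (suc r) [] = mult-extend-suc i r []
  mult-extend-suc i r (a ∷ ν) with a ℕ.≡ᵇ i
  ... | true = ≡.cong suc (mult-extend-suc i r ν)
  ... | false = mult-extend-suc i r ν

  cf-zeros : ∀ w n → even? n ≡ true → cf w (List.replicate n 0) ≈ g true n w ⊗ ι! n
  cf-zeros w n ev = *-cong
    (trans (*-cong (trans (reflexive (≡.cong (E w) (mult-zeros n))) (E-g n w ev))
      (reflexive (≡.cong (λ m → Π< m (λ i → B (multL (suc i) zs))) (max-zeros n)))) (*-identityʳ (g true n w)))
    (trans (reflexive (≡.cong (λ m → Π< (suc m) (λ i → ι! (multL i zs))) (max-zeros n)))
      (trans (*-identityʳ (ι! (multL 0 zs))) (reflexive (≡.cong ι! (mult-zeros n)))))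
    where
    zs = List.replicate n 0

  -- Adding a column shifts all multiplicities by one. The zero parts of ν become parts equal to 1,
  -- and their b^el factor is the zero-part factor `E` at w = t.
  cf-suc : ∀ w r ν → even? r ≡ true → even? (length ν) ≡ true → cf w (extend r ν) ≈ g true r w ⊗ ι! r ⊗ cf t ν
  -- The empty ν is separate because the largest part then does not grow.
  cf-suc w r [] ev _ = trans (cf-zeros w r ev) (solve 2 (λ a b → a :* b := a :* b :* ((:1 :* :1) :* (:1 :* :1))) refl (g true r w) (ι! r))
  cf-suc w r (a ∷ ν) ev _ = begin
    E w (multL 0 (extend r l)) ⊗ belL (extend r l) ⊗ vinvL (extend r l)
      ≈⟨ *-cong (*-cong (trans (reflexive (≡.cong (E w) (mult-extend-0 r l))) (E-g r w ev)) bel-ext) vinv-ext ⟩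
    g true r w ⊗ (E t (multL 0 l) ⊗ belL l) ⊗ (ι! r ⊗ vinvL l)
      ≈⟨ solve 5 (λ g e b i v → g :* (e :* b) :* (i :* v) := g :* i :* (e :* b :* v)) refl (g true r w) (E t (multL 0 l)) (belL l) (ι! r) (vinvL l) ⟩
    g true r w ⊗ ι! r ⊗ cf t l ∎
    where
    l = a ∷ ν
    bel-ext : belL (extend r l) ≈ E t (multL 0 l) ⊗ belL l
    bel-ext = trans (reflexive (≡.cong (λ m → Π< m (λ i → B (multL (suc i) (extend r l)))) (max-extend r a ν)))
      (trans (Π<-cong (suc (maxL l)) {λ i → B (multL (suc i) (extend r l))} {λ i → B (multL i l)} (λ i → reflexive (≡.cong B (mult-extend-suc i r l))))
        (*-congʳ {belL l} (B-E (multL 0 l))))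
    vinv-ext : vinvL (extend r l) ≈ ι! r ⊗ vinvL l
    vinv-ext = *-cong (reflexive (≡.cong ι! (mult-extend-0 r l)))
      (trans (reflexive (≡.cong (λ m → Π< m (λ i → ι! (multL (suc i) (extend r l)))) (max-extend r a ν)))
        (Π<-cong (suc (maxL l)) {λ i → ι! (multL (suc i) (extend r l))} {λ i → ι! (multL i l)} (λ i → reflexive (≡.cong ι! (mult-extend-suc i r l)))))

  maxPart-toList : ∀ {n} (μ : Vec ℕ n) → maxPart μ ≡ maxL (Vec.toList μ)
  maxPart-toList [] = ≡.refl
  maxPart-toList (a ∷ μ) = ≡.cong (a ℕ.⊔_) (maxPart-toList μ)

  bel-belL : ∀ (μ : Vec ℕ N) → bel μ ≈ belL (Vec.toList μ)
  bel-belL μ = trans (reflexive (prodF-suc-upTo (maxPart μ) (λ i → B (mult i μ))))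
    (reflexive (≡.cong (λ m → Π< m (λ i → B (mult (suc i) μ))) (maxPart-toList μ)))

  vPart-inverse : ∀ (μ : Vec ℕ N) → vinvL (Vec.toList μ) ⊗ vPart μ ≈ 𝟙
  vPart-inverse μ = trans (*-comm (vinvL (Vec.toList μ)) (vPart μ)) (trans (*-congʳ {vinvL (Vec.toList μ)} (trans (reflexive (prodF-upTo (suc (maxPart μ)) (λ i → vm (mult i μ))))
      (reflexive (≡.cong (λ m → Π< (suc m) (λ i → vm (mult i μ))) (maxPart-toList μ)))))
    (trans (Π<-* (suc (maxL (Vec.toList μ))) (λ i → vm (mult i μ)) (λ i → ι! (mult i μ))) (Π<-𝟙 (suc (maxL (Vec.toList μ))) {λ i → vm (mult i μ) ⊗ ι! (mult i μ)} (λ i → vm-inverse (mult i μ)))))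

-- Comparison with both sides of the theorem.

module Assembly (N : ℕ) where

  open import Defs
  open SeriesRing
  open SeriesVariables
  open Permutations
  open PartitionLists using (conjEvenL)
  open Alternation N
  open Numerator N using (hlNumerator-alternant; alternant-num; prodF-pairs; ∏-tab)
  open Weights N
  open RingKit (series (suc (suc N))) hiding (_≈_)
  open Alternants (series (suc (suc N)))
  open Bordered (series (suc (suc N)))
  open BinaryForms (series (suc (suc N))) using (Reg; _^_; reg-resp; reg-neg; Pt)
  module CI = ClearedIdentity (series (suc (suc N))) torsion t ι ι-inv
  module Ex = Expansion (series (suc (suc N))) torsion t ι ι-inv
  open BoxSums (series (suc (suc N))) using (box; guard; box-sumT; box-cong; guard-∧)

  X : List S
  X = List.tabulate xV

  -- The entries already contain their denominators as inverse series, so the clearing factor is 1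
  -- here.
  pf-Q : (a : Fin N → Fin N → S) → ∀ n {k} (v : Vec (Fin N) k) → k ≡ dbl n → pfaffian a v ≈ Pfaffian.Q a (λ _ _ → 𝟙) n (Vec.toList v)
  pf-Q a zero [] _ = refl
  pf-Q a (suc n) {suc (suc k)} (i ∷ rest) e = begin
    sumF (map summand (List.allFin (suc k))) ≈⟨ reflexive (≡.cong sumF (map-tabulate (λ p → p) summand)) ⟩
    sumF (List.tabulate summand)
      ≈⟨ sumF-tab (λ p → trans (scale-neg^ (toℕ p) (a i (lookup rest p) ⊗ pfaffian a (Vec.removeAt rest p))) (neg^-cong (toℕ p) (*-cong
           (trans (sym (*-identityʳ (a i (lookup rest p)))) (*-congˡ {a i (lookup rest p)} (sym (trans (*-cong (∏-one {f = λ _ → 𝟙} (λ _ → refl) (others p)) (∏-one {f = λ _ → 𝟙} (λ _ → refl) (others p))) (*-identityˡ 𝟙)))))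
           (pf-Q a n (Vec.removeAt rest p) (ℕP.suc-injective (ℕP.suc-injective e)))))) ⟩
    sumF (List.tabulate (λ p → neg^ (toℕ p) (a i (lookup rest p) ⊗ (∏ (λ _ → 𝟙) (others p) ⊗ ∏ (λ _ → 𝟙) (others p)) ⊗ Pfaffian.Q a (λ _ _ → 𝟙) n (others p))))
      ≈⟨ alt-vec k (λ y ys → a i y ⊗ (∏ (λ _ → 𝟙) ys ⊗ ∏ (λ _ → 𝟙) ys) ⊗ Pfaffian.Q a (λ _ _ → 𝟙) n ys) rest ⟨
    Pfaffian.Q a (λ _ _ → 𝟙) (suc n) (i ∷ Vec.toList rest) ∎
    where
    others : Fin (suc k) → List (Fin N)
    others p = Vec.toList (Vec.removeAt rest p)
    summand : Fin (suc k) → S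
    summand p = scale (if evenᵇ (toℕ p) then + 1 else ℤ.- (+ 1)) (a i (lookup rest p) ⊗ pfaffian a (Vec.removeAt rest p))

  small-product : ∀ {f : S} (g : S) → Total.Order 1 f → Total.Order 1 (f ⊗ g)
  small-product {f} g h = Total.order-⊗ {k = 1} {n = 0} {f = f} {g = g} h (λ _ ())

  x-total : ∀ i → Total.Order 1 (xV i)
  x-total i α d = ≡.trans (≡.sym (*-identityʳ (xV i) α)) (var-order (Fin.suc (Fin.suc i)) Vec.sum (sum-inc (Fin.suc (Fin.suc i))) 0 𝟙 (λ _ ()) α d)

  xx-inv : ∀ i j → inv1m (xV i ⊗ xV j) ⊗ (𝟙 ⊖ xV i ⊗ xV j) ≈ 𝟙
  xx-inv i j = Geometric.inv1m-inverse (xV i ⊗ xV j) (small-product {xV i} (xV j) (x-total i))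

  txx-inv : ∀ i j → inv1m (tV ⊗ xV i ⊗ xV j) ⊗ (𝟙 ⊖ tV ⊗ xV i ⊗ xV j) ≈ 𝟙
  txx-inv i j = Geometric.inv1m-inverse (tV ⊗ xV i ⊗ xV j) (λ α d → trans (*-congʳ {xV j} (*-comm tV (xV i))) (*-assoc (xV i) tV (xV j)) α ∙
      small-product {xV i} (tV ⊗ xV j) (x-total i) α d)
    where
    _∙_ : ∀ {x y z : ℤ} → x ≡ y → y ≡ z → x ≡ z
    _∙_ = ≡.trans

  -- Minus this element is a unit, inverted by the geometric series.
  x-reg : ∀ i j → Reg (xV i ⊗ xV j ⊖ 𝟙)
  x-reg i j = reg-resp (solve 1 (λ p → :- (:1 :- p) := p :- :1) refl (xV i ⊗ xV j)) (reg-neg {𝟙 ⊖ xV i ⊗ xV j} (unit-reg {s = inv1m (xV i ⊗ xV j)} (xx-inv i j)))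

  xs-generic : CI.Generic X
  xs-generic = CI.generic (AllP.tabulate⁺ (λ i → record { reg = var-reg (Fin.suc (Fin.suc i)) ; reg² = x-reg i i })) (pairwise (λ i → i) (λ e → e))
    where
    pairwise : ∀ {n} (f : Fin n → Fin N) → (∀ {i j} → f i ≡ f j → i ≡ j) → AllPairs CI.Generic₂ (List.tabulate (xV ∘ f))
    pairwise {zero} f inj = []
    pairwise {suc n} f inj = AllP.tabulate⁺ (λ j → record
        { reg-sub = sub-reg _ _ (λ e → FinP.0≢1+n (inj (FinP.suc-injective (FinP.suc-injective e)))) ; reg-mul = x-reg (f Fin.zero) (f (Fin.suc j)) })
      ∷ pairwise (f ∘ Fin.suc) (λ e → FinP.suc-injective (inj e))

  xdeg-⊞ : ∀ β γ → xdeg (β ⊞ γ) ≡ xdeg {N} β ℕ.+ xdeg {N} γ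
  xdeg-⊞ (a ∷ b ∷ β) (c ∷ d ∷ γ) = sum-⊞ β γ

  module XO = Degree xdeg xdeg-⊞

  open Filtration XO.filtration using (Small; Ord; ord-+; ord-neg; ord-*; ord-z)

  xdeg-inc : ∀ i α → xdeg {N} (updateAt α (Fin.suc (Fin.suc i)) suc) ≡ suc (xdeg {N} α)
  xdeg-inc i (a ∷ b ∷ α) = sum-inc i α

  x-small : ∀ i → Small (xV i)
  x-small i {n} {y} h α d = var-order (Fin.suc (Fin.suc i)) xdeg (xdeg-inc i) n y h α d

  xs-small : All Small X
  xs-small = AllP.tabulate⁺ (λ i {n} {y} → x-small i {n} {y})

  ord-pow : ∀ {n x} → Small x → ∀ a {y} → Ord n y → Ord (a ℕ.+ n) (x ^ a ⊗ y)
  ord-pow sm zero {y} h = Filtration.resp XO.filtration {x = y} (sym (*-identityˡ y)) h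
  ord-pow {n} {x} sm (suc a) {y} h = Filtration.resp XO.filtration {x = x ⊗ (x ^ a ⊗ y)} (sym (*-assoc x (x ^ a) y)) (sm {a ℕ.+ n} {x ^ a ⊗ y} (ord-pow {n} {x} sm a {y} h))

  ord-∏ : ∀ {n y} x → Small x → ∀ l → All Small l → Ord n y → Ord (length l ℕ.+ n) (∏ (λ z → x ⊖ t ⊗ z) l ⊗ y)
  ord-∏ {n} {y} x sm [] [] h = Filtration.resp XO.filtration {x = y} (sym (*-identityˡ y)) h
  ord-∏ {n} {y} x sm (z ∷ l) (sz ∷ sl) h = Filtration.resp XO.filtration {x = x ⊗ r ⊕ (⊝ (t ⊗ (z ⊗ r)))}
      (solve 5 (λ x t z p y → x :* (p :* y) :+ (:- (t :* (z :* (p :* y)))) := ((x :- t :* z) :* p) :* y) refl x t z (∏ (λ z → x ⊖ t ⊗ z) l) y)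
      (ord-+ {x = x ⊗ r} {⊝ (t ⊗ (z ⊗ r))} (sm {_} {r} ih) (ord-neg {x = t ⊗ (z ⊗ r)} (ord-* {x = z ⊗ r} t (sz {_} {r} ih))))
    where
    r = ∏ (λ z → x ⊖ t ⊗ z) l ⊗ y
    ih = ord-∏ {n} {y} x sm l sl h

  -- n (n - 1) / 2, the number of pairs and so the degree of the Vandermonde product.
  triangle : ℕ → ℕ
  triangle zero = 0
  triangle (suc n) = n ℕ.+ triangle n

  -- Picking y while m variables remain contributes y^a and m factors y - t z, each of x-order at
  -- least one.
  num-order : ∀ μ l → All Small l → Ord (ListAction.sum μ ℕ.+ triangle (length l)) (Ex.num μ l)
  num-order [] [] _ = ord-z 𝟙
  num-order [] (x ∷ l) _ α _ = 𝟘≈ α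
  num-order (a ∷ μ) l sm = Ex.Order.ord-alt XO.filtration l (λ {y} {ys} p →
    Filtration.resp XO.filtration {x = y ^ a ⊗ (∏ (λ z → y ⊖ t ⊗ z) ys ⊗ Ex.num μ ys)} (sym (*-assoc (y ^ a) (∏ (λ z → y ⊖ t ⊗ z) ys) (Ex.num μ ys)))
      (≡.subst (λ m → Ord m (y ^ a ⊗ (∏ (λ z → y ⊖ t ⊗ z) ys ⊗ Ex.num μ ys))) (degrees p)
        (ord-pow {_} {y} (small-at p sm) a {∏ (λ z → y ⊖ t ⊗ z) ys ⊗ Ex.num μ ys}
          (ord-∏ {_} {Ex.num μ ys} y (small-at p sm) ys (CI.all-pick p sm) (num-order μ ys (CI.all-pick p sm))))))
    where
    small-at : ∀ {y ys l} → Pick y l ys → All Small l → Small y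
    small-at here (s ∷ _) {n} {z} = s {n} {z}
    small-at (there p) (_ ∷ ss) {n} {z} = small-at p ss {n} {z}
    degrees : ∀ {y ys} → Pick y l ys → a ℕ.+ (length ys ℕ.+ (ListAction.sum μ ℕ.+ triangle (length ys))) ≡ a ℕ.+ ListAction.sum μ ℕ.+ triangle (length l)
    degrees {y} {ys} p rewrite pick-length p = ≡.trans (≡.cong (a ℕ.+_) (≡.trans (≡.sym (ℕP.+-assoc (length ys) _ _))
      (≡.trans (≡.cong (ℕ._+ triangle (length ys)) (ℕP.+-comm (length ys) (ListAction.sum μ))) (ℕP.+-assoc (ListAction.sum μ) _ _)))) (≡.sym (ℕP.+-assoc a _ _))

  length-pairs : ∀ n → length (pairs n) ≡ triangle n
  length-pairs zero = ≡.refl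
  length-pairs (suc n) = ≡.trans (≡.cong length (pairs-suc n)) (≡.trans (length-++ (map (λ j → Fin.zero , Fin.suc j) (List.allFin n)))
    (≡.cong₂ ℕ._+_ (≡.trans (length-map _ (List.allFin n)) (length-tabulate {n = n} (λ j → j))) (≡.trans (length-map suc² (pairs n)) (length-pairs n))))

  pairs-distinct : ∀ n → All (λ p → proj₁ p ≢ proj₂ p) (pairs n)
  pairs-distinct zero = []
  pairs-distinct (suc n) = ≡.subst (All (λ p → proj₁ p ≢ proj₂ p)) (≡.sym (pairs-suc n)) (AllP.++⁺
    (AllP.map⁺ (All.tabulate {xs = List.allFin n} (λ _ ())))
    (AllP.map⁺ (All.map (λ ne e → ne (FinP.suc-injective e)) (pairs-distinct n))))

  -- By `sub-zero`, cancelling one difference of distinct variables lowers the order bound by just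
  -- one.
  differences-order : ∀ l n f → All (λ p → proj₁ p ≢ proj₂ p) l →
    Ord (n ℕ.+ length l) (prodF (map (λ p → xV (proj₁ p) ⊖ xV (proj₂ p)) l) ⊗ f) → Ord n f
  differences-order [] n f [] h = ≡.subst (λ m → Ord m f) (ℕP.+-identityʳ n)
    (Filtration.resp XO.filtration {x = 𝟙 ⊗ f} (*-identityˡ f) h)
  differences-order ((i , j) ∷ l) n f (ne ∷ nes) h = differences-order l n f nes (λ α d →
    sub-zero (Fin.suc (Fin.suc i)) (Fin.suc (Fin.suc j)) (λ { ≡.refl → ne ≡.refl }) xdeg (xdeg-inc i) (xdeg-inc j)
      (n ℕ.+ length l) (prodF (map (λ p → xV (proj₁ p) ⊖ xV (proj₂ p)) l) ⊗ f)
      (≡.subst (λ m → Ord m ((xV i ⊖ xV j) ⊗ (prodF (map (λ p → xV (proj₁ p) ⊖ xV (proj₂ p)) l) ⊗ f))) (ℕP.+-suc n (length l)) (Filtration.resp XO.filtration {x = ((xV i ⊖ xV j) ⊗ prodF (map (λ p → xV (proj₁ p) ⊖ xV (proj₂ p)) l)) ⊗ f}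
        (*-assoc (xV i ⊖ xV j) (prodF (map (λ p → xV (proj₁ p) ⊖ xV (proj₂ p)) l)) f) h)) α d)

  unit-order : ∀ {n v r f} → r ⊗ v ≈ 𝟙 → Ord n (v ⊗ f) → Ord n f
  unit-order {n} {v} {r} {f} inv h = Filtration.resp XO.filtration {x = r ⊗ (v ⊗ f)}
    (trans (sym (*-assoc r v f)) (trans (*-congʳ {f} inv) (*-identityˡ f))) (ord-* {x = v ⊗ f} r h)

  hl-num : ∀ (μ : Vec ℕ N) → hlNumerator N μ ≈ Ex.num (Vec.toList μ) X
  hl-num μ = trans (hlNumerator-alternant μ) (alternant-num Ex.num refl (λ a ν l → refl) μ xV)

  sum-toList : ∀ {n} (μ : Vec ℕ n) → ListAction.sum (Vec.toList μ) ≡ Vec.sum μ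
  sum-toList [] = ≡.refl
  sum-toList (a ∷ μ) = ≡.cong (a ℕ.+_) (sum-toList μ)

  sumF-at : ∀ {a} {A : Set a} (f : A → S) l α → sumF (map f l) α ≡ sumℤ (map (λ x → f x α) l)
  sumF-at f [] α = 𝟘≈ α
  sumF-at f (x ∷ l) α = ≡.cong (λ z → f x α ℤ.+ z) (sumF-at f l α)

  sumℤ-filter : ∀ {a} {A : Set a} (h : A → ℤ) (p : A → Bool) l → sumℤ (map h (List.filterᵇ p l)) ≡ sumℤ (map (λ x → if p x then h x else + 0) l)
  sumℤ-filter h p [] = ≡.refl
  sumℤ-filter h p (x ∷ l) with p x
  ... | true = ≡.cong (λ z → h x ℤ.+ z) (sumℤ-filter h p l)
  ... | false = ≡.trans (sumℤ-filter h p l) (≡.sym (ℤP.+-identityˡ _))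

  sumF-filter : ∀ {a} {A : Set a} (h : A → S) (p : A → Bool) l → sumF (map h (List.filterᵇ p l)) ≈ sumF (map (λ x → guard (p x) (h x)) l)
  sumF-filter h p [] = refl
  sumF-filter h p (x ∷ l) with p x
  ... | true = +-congˡ {h x} (sumF-filter h p l)
  ... | false = trans (sumF-filter h p l) (sym (+-identityˡ _))

  allVecs-box : ∀ n d (H : List ℕ → S) → sumF (map (λ v → H (Vec.toList v)) (allVecs n d)) ≈ box n d H
  allVecs-box zero d H = +-identityʳ (H [])
  allVecs-box (suc n) d H = begin
    sumF (map (λ v → H (Vec.toList v)) (allVecs (suc n) d))
      ≈⟨ sumF-concatMap (λ v → H (Vec.toList v)) (λ a → map (a ∷_) (allVecs n d)) (List.upTo (suc d)) ⟩
    sumF (map (λ a → sumF (map (λ v → H (Vec.toList v)) (map (a ∷_) (allVecs n d)))) (List.upTo (suc d)))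
      ≈⟨ sumF-cong (All.tabulate {xs = List.upTo (suc d)} (λ {a} _ → trans (reflexive (≡.cong sumF (≡.sym (map-∘ (allVecs n d))))) (allVecs-box n d (λ l → H (a ∷ l))))) ⟩
    sumF (map (λ a → box n d (λ l → H (a ∷ l))) (List.upTo (suc d))) ≈⟨ reflexive (≡.cong sumF (map-upTo (λ a → box n d (λ l → H (a ∷ l))) (suc d))) ⟩
    sumF (List.applyUpTo (λ a → box n d (λ l → H (a ∷ l))) (suc d)) ≈⟨ go d (λ a → box n d (λ l → H (a ∷ l))) ⟩
    Σ≤ d (λ a → box n d (λ l → H (a ∷ l))) ∎
    where
    go : ∀ d (f : ℕ → S) → sumF (List.applyUpTo f (suc d)) ≈ Σ≤ d f
    go zero f = +-identityʳ (f 0)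
    go (suc d) f = +-congˡ {f 0} (go d (f ∘ suc))

  allVecs-sum : ∀ n d (h : Vec ℕ (suc n) → ℤ) → sumℤ (map h (allVecs (suc n) d)) ≡ Σ< (suc d) (λ a → sumℤ (map (λ v → h (a ∷ v)) (allVecs n d)))
  allVecs-sum n d h = ≡.trans (sumℤ-concatMap h (λ a → map (a ∷_) (allVecs n d)) (List.upTo (suc d))) (≡.trans
    (≡.cong sumℤ (map-cong (λ a → ≡.cong sumℤ (≡.sym (map-∘ (allVecs n d)))) (List.upTo (suc d))))
    (≡.cong sumℤ (map-upTo (λ a → sumℤ (map (λ v → h (a ∷ v)) (allVecs n d))) (suc d))))

  -- A vector in the larger box but not in the smaller has an entry above e, hence a sum above e.
  allVecs-extend : ∀ n {e d} → e ℕ.≤ d → (h : Vec ℕ n → ℤ) → (∀ v → e ℕ.< Vec.sum v → h v ≡ + 0) →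
    sumℤ (map h (allVecs n d)) ≡ sumℤ (map h (allVecs n e))
  allVecs-extend zero p h z = ≡.refl
  allVecs-extend (suc n) {e} {d} p h z = ≡.trans (allVecs-sum n d h) (≡.trans
    (Σ<-extend (suc e) (suc d) (ℕ.s≤s p) (λ a q → all-0 a q (allVecs n d)))
    (≡.trans (Σ<-cong (suc e) (λ a _ → allVecs-extend n p (λ v → h (a ∷ v)) (λ v q → z (a ∷ v) (ℕP.<-≤-trans q (ℕP.m≤n+m _ a)))))
      (≡.sym (allVecs-sum n e h))))
    where
    all-0 : ∀ a → e ℕ.< a → ∀ l → sumℤ (map (λ v → h (a ∷ v)) l) ≡ + 0
    all-0 a q [] = ≡.refl
    all-0 a q (v ∷ l) = ≡.cong₂ ℤ._+_ (z (a ∷ v) (ℕP.<-≤-trans q (ℕP.m≤m+n a _))) (all-0 a q l)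

  conjEvenᵇ-toList : ∀ (μ : Vec ℕ N) → conjEvenᵇ μ ≡ conjEvenL (Vec.toList μ)
  conjEvenᵇ-toList μ = ≡.cong (λ m → List.foldr (λ j b → evenᵇ (conjPart j μ) ∧ b) true (map suc (List.upTo m))) (maxPart-toList μ)

  module _ (P : Vec ℕ N → S) (hl : IsHallLittlewood N P) where

    vandermonde-P : ∀ μ → IsPartition μ → vandermonde N ⊗ P μ ≈ vinvL (Vec.toList μ) ⊗ Ex.num (Vec.toList μ) X
    vandermonde-P μ part = begin
      V ⊗ P μ ≈⟨ *-identityˡ (V ⊗ P μ) ⟨
      𝟙 ⊗ (V ⊗ P μ) ≈⟨ *-congʳ {V ⊗ P μ} (vPart-inverse μ) ⟨
      r ⊗ vPart μ ⊗ (V ⊗ P μ) ≈⟨ solve 4 (λ r v V P → r :* v :* (V :* P) := r :* (v :* V :* P)) refl r (vPart μ) V (P μ) ⟩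
      r ⊗ (vPart μ ⊗ V ⊗ P μ) ≈⟨ *-congˡ {r} (trans (hl μ part) (hl-num μ)) ⟩
      r ⊗ Ex.num (Vec.toList μ) X ∎
      where
      r = vinvL (Vec.toList μ)
      V = vandermonde N

    -- The numerator has x-order at least |μ| plus the number of pairs, and the Vandermonde factors
    -- account for the latter. This bound replaces homogeneity in all comparisons of truncations.
    P-order : ∀ μ → IsPartition μ → Ord (Vec.sum μ) (P μ)
    P-order μ part = differences-order (pairs N) (Vec.sum μ) (P μ) (pairs-distinct N)
      (≡.subst (λ m → Ord m (vandermonde N ⊗ P μ)) (≡.cong₂ ℕ._+_ (sum-toList μ) (≡.trans (≡.cong triangle {length X} {N} (length-tabulate xV)) (≡.sym (length-pairs N))))
        (Filtration.resp XO.filtration {x = vinvL (Vec.toList μ) ⊗ Ex.num (Vec.toList μ) X} (sym (vandermonde-P μ part))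
          (ord-* {x = Ex.num (Vec.toList μ) X} (vinvL (Vec.toList μ)) (num-order (Vec.toList μ) X xs-small))))

    termP : Vec ℕ N → S
    termP μ = uFactor μ ⊗ bel μ ⊗ P μ

    good : ∀ {n} → Vec ℕ n → Bool
    good μ = decreasingᵇ (Vec.toList μ) ∧ conjEvenL (Vec.toList μ)

    -- Cuts off by the largest part, as the recursion does, whereas `lhs` cuts off by the size |μ|.
    truncated : ℕ → S
    truncated d = sumF (map termP (List.filterᵇ good (allVecs N d)))

    term-order : ∀ μ → IsPartition μ → Ord (Vec.sum μ) (termP μ)
    term-order μ part = ord-* {x = P μ} (uFactor μ ⊗ bel μ) (P-order μ part)

    -- By `term-order`, partitions of size above the x-degree of γ contribute nothing at γ, so both
    -- cut-offs give the same coefficient.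
    lhs-truncated : ∀ d γ → xdeg γ ℕ.≤ d → lhs N P γ ≡ truncated d γ
    lhs-truncated d γ e≤d = ≡.trans (sumℤ-filter (λ μ → termP μ γ) _ (allVecs N e)) (≡.trans
      (≡.cong sumℤ (map-cong same (allVecs N e))) (≡.trans (≡.sym (allVecs-extend N e≤d h vanish)) (≡.sym
      (≡.trans (sumF-at termP (List.filterᵇ good (allVecs N d)) γ) (sumℤ-filter (λ μ → termP μ γ) good (allVecs N d))))))
      where
      e = xdeg γ
      h : Vec ℕ N → ℤ
      h μ = if good μ then termP μ γ else + 0
      vanish : ∀ μ → e ℕ.< Vec.sum μ → h μ ≡ + 0
      vanish μ p with decreasingᵇ (Vec.toList μ) in part | conjEvenL (Vec.toList μ)
      ... | false | _ = ≡.refl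
      ... | true | false = ≡.refl
      ... | true | true = term-order μ part γ p
      same : ∀ μ → (if decreasingᵇ (Vec.toList μ) ∧ (size μ ℕ.≤ᵇ e) ∧ conjEvenᵇ μ then termP μ γ else + 0) ≡ h μ
      same μ with size μ ℕ.≤ᵇ e in s
      ... | true = ≡.cong (λ b → if decreasingᵇ (Vec.toList μ) ∧ b then termP μ γ else + 0) (conjEvenᵇ-toList μ)
      ... | false = ≡.trans (neither (decreasingᵇ (Vec.toList μ))) (≡.sym (vanish μ (ℕP.≰⇒> (λ q → ≡.subst T s (ℕP.≤⇒≤ᵇ q)))))
        where
        neither : ∀ b → (if b ∧ false then termP μ γ else + 0) ≡ + 0
        neither true = ≡.refl
        neither false = ≡.refl

    weighted : List ℕ → S
    weighted l = cf uV l ⊗ Ex.num l X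

    vandermonde-term : ∀ μ → IsPartition μ → vandermonde N ⊗ termP μ ≈ weighted (Vec.toList μ)
    vandermonde-term μ part = begin
      V ⊗ (uF ⊗ bel μ ⊗ P μ) ≈⟨ solve 4 (λ V u b P → V :* (u :* b :* P) := u :* b :* (V :* P)) refl V uF (bel μ) (P μ) ⟩
      uF ⊗ bel μ ⊗ (V ⊗ P μ) ≈⟨ *-cong (*-congˡ {uF} (bel-belL μ)) (vandermonde-P μ part) ⟩
      uF ⊗ belL (Vec.toList μ) ⊗ (vinvL (Vec.toList μ) ⊗ Ex.num (Vec.toList μ) X)
        ≈⟨ *-assoc (uF ⊗ belL (Vec.toList μ)) (vinvL (Vec.toList μ)) (Ex.num (Vec.toList μ) X) ⟨
      weighted (Vec.toList μ) ∎
      where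
      V = vandermonde N
      uF = uFactor μ

    vandermonde-truncated : ∀ d → vandermonde N ⊗ truncated d ≈ sumT (series (suc (suc N))) d N weighted
    vandermonde-truncated d = begin
      vandermonde N ⊗ sumF (map termP L) ≈⟨ sumF-linear 0 (vandermonde N) termP L ⟨
      sumF (map (λ μ → vandermonde N ⊗ termP μ) L)
        ≈⟨ sumF-cong (All.map (λ {μ} g → vandermonde-term μ (fst (decreasingᵇ (Vec.toList μ)) _ g)) (AllP.all-filter (λ μ → T? (good μ)) (allVecs N d))) ⟩
      sumF (map (λ μ → weighted (Vec.toList μ)) L) ≈⟨ sumF-filter (λ μ → weighted (Vec.toList μ)) good (allVecs N d) ⟩
      sumF (map (λ μ → guard (good μ) (weighted (Vec.toList μ))) (allVecs N d))
        ≈⟨ allVecs-box N d (λ l → guard (decreasingᵇ l ∧ conjEvenL l) (weighted l)) ⟩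
      box N d (λ l → guard (decreasingᵇ l ∧ conjEvenL l) (weighted l))
        ≈⟨ box-cong N d (λ l _ → reflexive (guard-∧ (decreasingᵇ l) (conjEvenL l) (weighted l))) ⟩
      box N d (λ l → guard (decreasingᵇ l) (guard (conjEvenL l) (weighted l))) ≈⟨ box-sumT d N weighted ⟩
      sumT (series (suc (suc N))) d N weighted ∎
      where
      L = List.filterᵇ good (allVecs N d)
      fst : ∀ a b → T (a ∧ b) → a ≡ true
      fst true b _ = ≡.refl

    -- The coefficient of the product at α involves only coefficients of `lhs` of x-degree at most
    -- that of α, so a single cut-off serves them all.
    vandermonde-lhs : ∀ α → (vandermonde N ⊗ lhs N P) α ≡ sumT (series (suc (suc N))) (xdeg α) N weighted α
    vandermonde-lhs α = ≡.trans (⊗-local (vandermonde N) (lhs N P) (vandermonde N) (truncated (xdeg α)) α (λ β γ e →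
        ≡.cong (λ z → vandermonde N β ℤ.* z) (lhs-truncated (xdeg α) γ
          (≡.subst (xdeg γ ℕ.≤_) (≡.trans (≡.sym (xdeg-⊞ β γ)) (≡.cong xdeg e)) (ℕP.m≤n+m (xdeg γ) (xdeg β))))))
      (vandermonde-truncated (xdeg α) α)

  prodF-* : ∀ {a} {A : Set a} (f h : A → S) l → prodF (map (λ x → f x ⊗ h x) l) ≈ prodF (map f l) ⊗ prodF (map h l)
  prodF-* f h [] = sym (*-identityˡ 𝟙)
  prodF-* f h (x ∷ l) = trans (*-congˡ {f x ⊗ h x} (prodF-* f h l))
    (solve 4 (λ a b c d → (a :* b) :* (c :* d) := (a :* c) :* (b :* d)) refl (f x) (h x) (prodF (map f l)) (prodF (map h l)))

  prodF-pointwise : ∀ {a} {A : Set a} {f h : A → S} → (∀ x → f x ≈ h x) → ∀ l → prodF (map f l) ≈ prodF (map h l)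
  prodF-pointwise e [] = refl
  prodF-pointwise e (x ∷ l) = *-cong (e x) (prodF-pointwise e l)

  prodF-𝟙 : ∀ {a} {A : Set a} (l : List A) → prodF (map (λ _ → 𝟙) l) ≈ 𝟙
  prodF-𝟙 [] = refl
  prodF-𝟙 (x ∷ l) = trans (*-identityˡ _) (prodF-𝟙 l)

  ∏₂-tab : ∀ {a} {A : Set a} (d : A → A → S) {n} (f : Fin n → A) → ∏₂ d (List.tabulate f) ≈ prodF (map (λ p → d (f (proj₁ p)) (f (proj₂ p))) (pairs n))
  ∏₂-tab d {zero} f = refl
  ∏₂-tab d {suc n} f = trans (*-cong (reflexive (∏-tab (d (f Fin.zero)) (f ∘ Fin.suc))) (∏₂-tab d (f ∘ Fin.suc)))
    (sym (prodF-pairs n (λ p → d (f (proj₁ p)) (f (proj₂ p)))))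

  one-xx one-txx : Fin N × Fin N → S
  one-xx (i , j) = 𝟙 ⊖ xV i ⊗ xV j
  one-txx (i , j) = 𝟙 ⊖ tV ⊗ xV i ⊗ xV j

  pp-X : Ex.pp X ≈ prodF (map one-xx (pairs N))
  pp-X = ∏₂-tab (λ x z → 𝟙 ⊖ x ⊗ z) xV

  pp⁻¹ : S
  pp⁻¹ = prodF (map (λ p → inv1m (xV (proj₁ p) ⊗ xV (proj₂ p))) (pairs N))

  pp-inverse : pp⁻¹ ⊗ Ex.pp X ≈ 𝟙
  pp-inverse = trans (*-congˡ {pp⁻¹} pp-X)
    (trans (sym (prodF-* (λ p → inv1m (xV (proj₁ p) ⊗ xV (proj₂ p))) one-xx (pairs N)))
      (trans (prodF-pointwise (λ (i , j) → xx-inv i j) (pairs N)) (prodF-𝟙 (pairs N))))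

  point : Fin N → Maybe Pt
  point i = just (CI.fin (xV i))

  entry kernel : Fin N → Fin N → S
  entry i j = CI.e uV (point i) (point j)
  kernel i j = CI.k (point i) (point j)

  entry-clear : ∀ i j → entry i j ≈ pfEntry i j ⊗ kernel i j
  entry-clear i j = begin
    entry i j ≈⟨ solve 4 (λ x y u t → (x :* :1 :- y :* :1) :* ((:1 :- u) :* (:1 :* :1) :+ (u :- t) :* (x :* y))
                  := (x :- y) :* (:1 :- u :+ (u :- t) :* x :* y) :* :1 :* :1) refl x y uV t ⟩
    (x ⊖ y) ⊗ (𝟙 ⊖ uV ⊕ (uV ⊖ t) ⊗ x ⊗ y) ⊗ 𝟙 ⊗ 𝟙
      ≈⟨ *-cong (*-congˡ {(x ⊖ y) ⊗ (𝟙 ⊖ uV ⊕ (uV ⊖ t) ⊗ x ⊗ y)} (sym (xx-inv i j))) (sym (txx-inv i j)) ⟩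
    (x ⊖ y) ⊗ (𝟙 ⊖ uV ⊕ (uV ⊖ t) ⊗ x ⊗ y) ⊗ (p ⊗ (𝟙 ⊖ x ⊗ y)) ⊗ (q ⊗ (𝟙 ⊖ t ⊗ x ⊗ y))
      ≈⟨ solve 6 (λ x y t m p q → m :* (p :* (:1 :- x :* y)) :* (q :* (:1 :- t :* x :* y))
           := m :* p :* q :* ((:1 :* :1 :- x :* y) :* (:1 :* :1 :- t :* (x :* y)))) refl x y t ((x ⊖ y) ⊗ (𝟙 ⊖ uV ⊕ (uV ⊖ t) ⊗ x ⊗ y)) p q ⟩
    pfEntry i j ⊗ kernel i j ∎
    where
    x = xV i
    y = xV j
    p = inv1m (xV i ⊗ xV j)
    q = inv1m (tV ⊗ xV i ⊗ xV j)

  kernel-product : ∏₂ kernel (List.tabulate (λ i → i)) ≈ Ex.pp X ⊗ prodF (map one-txx (pairs N))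
  kernel-product = begin
    ∏₂ kernel (List.tabulate (λ i → i)) ≈⟨ ∏₂-tab kernel (λ i → i) ⟩
    prodF (map (λ p → kernel (proj₁ p) (proj₂ p)) (pairs N))
      ≈⟨ prodF-pointwise (λ (i , j) → solve 3 (λ x y t → (:1 :* :1 :- x :* y) :* (:1 :* :1 :- t :* (x :* y)) := (:1 :- x :* y) :* (:1 :- t :* x :* y))
           refl (xV i) (xV j) t) (pairs N) ⟩
    prodF (map (λ p → one-xx p ⊗ one-txx p) (pairs N)) ≈⟨ prodF-* one-xx one-txx (pairs N) ⟩
    prodF (map one-xx (pairs N)) ⊗ prodF (map one-txx (pairs N)) ≈⟨ *-congʳ {prodF (map one-txx (pairs N))} pp-X ⟨
    Ex.pp X ⊗ prodF (map one-txx (pairs N)) ∎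

  module _ (n : ℕ) (even : N ≡ dbl n) where

    private
      indices : List (Fin N)
      indices = List.tabulate (λ i → i)

      Pfᵢ : S
      Pfᵢ = Pfaffian.Q pfEntry (λ _ _ → 𝟙) n indices

    toList-tabulate : ∀ {a} {A : Set a} {m} (f : Fin m → A) → Vec.toList (tabulate f) ≡ List.tabulate f
    toList-tabulate {m = zero} f = ≡.refl
    toList-tabulate {m = suc m} f = ≡.cong (f Fin.zero ∷_) (toList-tabulate (f ∘ Fin.suc))

    halve-X : halve (length (map CI.fin X)) ≡ (true , n)
    halve-X = ≡.trans (≡.cong halve (≡.trans (length-map CI.fin X) (≡.trans (length-tabulate xV) even))) (halve-dbl n)

    -- Clearing the Pfaffian produces the product of all `kernel` factors. Their parts 1 - t x y
    -- form the product on the right-hand side of the theorem, and their parts 1 - x y form `pp`.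
    G-rhs : CI.G uV (map CI.fin X) ≈ Ex.pp X ⊗ rhsTimesVandermonde N
    G-rhs = begin
      CI.G uV (map CI.fin X) ≈⟨ reflexive (≡.cong (λ h → CI.G' h uV (map CI.fin X)) halve-X) ⟩
      CI.Q uV n (map just (map CI.fin X)) ≈⟨ reflexive (≡.cong (CI.Q uV n) points) ⟩
      CI.Q uV n (map point indices)
        ≈⟨ trans (Q-scale (CI.e uV) CI.k entry kernel point (λ _ → 𝟙) (λ i j → solve 1 (λ z → z := :1 :* :1 :* z) refl (entry i j)) (λ _ _ → refl) n indices)
             (trans (*-congʳ {Pfaffian.Q entry kernel n indices} (∏-one {f = λ _ → 𝟙} (λ _ → refl) indices)) (*-identityˡ (Pfaffian.Q entry kernel n indices))) ⟩
      Pfaffian.Q entry kernel n indices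
        ≈⟨ Q-clear kernel (λ i j → CI.k-sym (point i) (point j)) entry kernel pfEntry (λ _ _ → 𝟙) entry-clear (λ i j → sym (*-identityˡ (kernel i j))) n indices ⟩
      ∏₂ kernel indices ⊗ Pfᵢ ≈⟨ *-congʳ {Pfᵢ} kernel-product ⟩
      Ex.pp X ⊗ prodF (map one-txx (pairs N)) ⊗ Pfᵢ ≈⟨ *-assoc (Ex.pp X) (prodF (map one-txx (pairs N))) Pfᵢ ⟩
      Ex.pp X ⊗ (prodF (map one-txx (pairs N)) ⊗ Pfᵢ)
        ≈⟨ *-congˡ {Ex.pp X} (*-congˡ {prodF (map one-txx (pairs N))} (trans (pf-Q pfEntry n (tabulate {n = N} (λ i → i)) even)
             (reflexive (≡.cong (Pfaffian.Q pfEntry (λ _ _ → 𝟙) n) (toList-tabulate {m = N} (λ i → i)))))) ⟨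
      Ex.pp X ⊗ rhsTimesVandermonde N ∎
      where
      points : map just (map CI.fin X) ≡ map point indices
      points = ≡.trans (≡.sym (map-∘ X)) (≡.trans (map-tabulate xV (λ x → just (CI.fin x))) (≡.sym (map-tabulate (λ i → i) point)))

    even-X : even? (length X) ≡ true
    even-X = ≡.trans (≡.cong even? (≡.trans (length-tabulate xV) even)) (≡.cong proj₁ (halve-dbl n))

    -- Coefficients are compared one at a time: at α the recursion is unrolled as often as the
    -- x-degree of α, so the error has larger order and is invisible there.
    littlewood : (P : Vec ℕ N → S) → IsHallLittlewood N P → vandermonde N ⊗ lhs N P ≈ rhsTimesVandermonde N
    littlewood P hl α = ≡.trans (vandermonde-lhs P hl α) (≡.trans (≡.sym (expansion α)) (≡.sym (agree (rhsTimesVandermonde N α) _ (difference α (ℕP.n<1+n D)))))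
      where
      D = xdeg α
      Z = Ex.Z D uV X
      expansion : Z ≈ sumT (series (suc (suc N))) D N (weighted P hl)
      expansion = trans (Ex.Coefficients.Z-sum cf cf-zeros cf-suc D uV X even-X)
        (reflexive (≡.cong (λ m → sumT (series (suc (suc N))) D m (weighted P hl)) (length-tabulate xV)))
      difference : Ord (suc D) (rhsTimesVandermonde N ⊖ Z)
      -- The order estimate concerns the difference multiplied by `pp`, which is a unit and can be
      -- removed without losing order.
      difference = unit-order {suc D} {Ex.pp X} {pp⁻¹} {f = rhsTimesVandermonde N ⊖ Z} pp-inverse
        (Filtration.resp XO.filtration {x = CI.G uV (map CI.fin X) ⊖ Ex.pp X ⊗ Z}
          (trans (+-congʳ {⊝ (Ex.pp X ⊗ Z)} G-rhs) (solve 3 (λ p r z → p :* r :- p :* z := p :* (r :- z)) refl (Ex.pp X) (rhsTimesVandermonde N) Z))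
          (Ex.Order.GZ-order XO.filtration D uV X xs-generic xs-small))
      agree : ∀ a b → a ℤ.+ ℤ.- b ≡ + 0 → a ≡ b
      agree a b = ℤP.i-j≡0⇒i≡j a b

2*≡dbl : ∀ n → 2 ℕ.* n ≡ dbl n
2*≡dbl zero = ≡.refl
2*≡dbl (suc n) = ≡.cong suc (≡.trans (ℕP.+-suc n (n ℕ.+ 0)) (≡.cong suc (2*≡dbl n)))

open import Defs
open import Data.Nat using (ℕ; _*_)
open import Data.Vec using (Vec)

theorem7 : (n : ℕ) (P : Vec ℕ (2 * n) → Ser (2 * n)) →
    IsHallLittlewood (2 * n) P →
    vandermonde (2 * n) ⊗ lhs (2 * n) P ≈ rhsTimesVandermonde (2 * n)
theorem7 n = Assembly.littlewood (2 * n) n (2*≡dbl n)
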